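{- Let $t\ge 1$ be an integer and let $i\in\{2,4,6,8\}$; put $n=i+8(t+1)$ (so $n$ ranges over all even integers $\ge 18$, each arising from exactly one such pair $(t,i)$). Construct the graph $G''_n$ as follows. (1) Take $t+1$ vertex-disjoint paths $u_s^1u_s^2u_s^3u_s^4$ for $s=0,1,\dots,t$, add a new vertex $u$, and add the edges $u_s^1u_{s+1}^1$ and $u_s^4u_{s+1}^3$ for $s=0,1,\dots,t-1$, together with the edges $uu_t^1$ and $uu_t^4$. Call the result $G_t$. (2) Let $S=\{u_0^1,u_0^3,u\}\cup\{u_s^2,u_s^4 : s=0,1,\dots,t\}$ (so $|S|=2t+5$). Let $G'_t$ be obtained from $G_t$ by adding a new vertex $u'$ and the edges $u'v$ for all $v\in S$. In $G'_t$ every vertex other than $u'$ has degree $3$. (3) Let $S_1=S\setminus\{u_t^2,u_t^4,u\}$, $S_2=S\setminus\{u_t^4,u\}$, $S_3=S\setminus\{u\}$, $S_4=S$. Let $G''_n$ be the graph obtained from $G'_t$ by performing a triangle-insertion at every vertex of $S_{i/2}$. Then $|V(G''_n)|=n$. Then $G''_n$ is an extremal brick, and consequently the number of perfect matchings of $G''_n$ is $(5n+8-i)/8$.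
   Context: Graphs are finite, loopless, and may have multiple edges. A connected graph with at least two vertices is matching covered if every edge lies in some perfect matching. For $X\subseteq V(G)$, $\partial_G(X)$ denotes the set of edges with exactly one end in $X$; in a matching covered graph such a cut is tight if every perfect matching contains exactly one of its edges, and it is trivial if $|X|=1$ or $|V(G)\setminus X|=1$. A brick is a nonbipartite matching covered graph with no nontrivial tight cuts (equivalently, a 3-connected graph $G$ such that $G-\{x,y\}$ has a perfect matching for every pair of distinct vertices $x,y$). A brick $G$ is extremal if its number of perfect matchings equals $|E(G)|-|V(G)|+1$. Triangle-insertion at a vertex $v$ of degree $3$ with incident edges $va_1,va_2,va_3$: delete $v$, add three new vertices $b_1,b_2,b_3$ forming a triangle, and add the edges $a_jb_j$ for $j=1,2,3$ (i.e., splicing the graph at $v$ with $K_4$ at a vertex). Performing triangle-insertions at several degree-3 vertices means doing this at each of them. -}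

module Defs where

open import Data.Nat using (ℕ; zero; suc; _+_; _*_; _∸_; _≤_; _<_; _≡ᵇ_)
open import Data.Nat.Properties using (_≟_)
open import Data.Bool using (Bool; true; false; _∧_; _∨_; _xor_; if_then_else_)
open import Data.Fin using (Fin; toℕ)
import Data.Fin as F
open import Data.Fin.Properties using (all?)
open import Data.Fin.Subset using (Subset; ∣_∣)
open import Data.List using (List; []; _∷_; _++_; length; lookup; map; filter; concatMap; upTo; foldl)
open import Data.Vec using (Vec; []; _∷_)
import Data.Vec as Vec
open import Data.Product using (_×_; _,_; proj₁; proj₂; ∃; Σ)
open import Data.Sum using (_⊎_)
open import Relation.Nullary using (¬_; Dec)
open import Relation.Binary.PropositionalEquality using (_≡_; _≢_)

-- Finite multigraphs.  Vertices are the numbers 0 .. V-1 (i.e. Fin V);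
-- edges form a list of endpoint pairs (parallel edges allowed), an edge
-- is identified by its position in the list (Fin (length E)).

record Graph : Set where
  constructor graph
  field
    V : ℕ
    E : List (ℕ × ℕ)

open Graph public

Vertex : Graph → Set
Vertex G = Fin (V G)

Edge : Graph → Set
Edge G = Fin (length (E G))

ends : (G : Graph) → Edge G → ℕ × ℕ
ends G e = lookup (E G) e

WellFormed : Graph → Set
WellFormed G = ∀ (e : Edge G) →
  (proj₁ (ends G e) < V G) × (proj₂ (ends G e) < V G) × (proj₁ (ends G e) ≢ proj₂ (ends G e))

incident : ℕ × ℕ → ℕ → Bool
incident (a , b) v = (a ≡ᵇ v) ∨ (b ≡ᵇ v)

countT : ∀ {m} → (Fin m → Bool) → ℕ
countT {zero}  f = 0
countT {suc m} f = (if f F.zero then 1 else 0) + countT (λ k → f (F.suc k))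

EdgeSet : Graph → Set
EdgeSet G = Subset (length (E G))

inSet : ∀ {m} → Subset m → Fin m → Bool
inSet M e = Vec.lookup M e

degIn : (G : Graph) → EdgeSet G → ℕ → ℕ
degIn G M v = countT (λ e → inSet M e ∧ incident (ends G e) v)

IsPerfectMatching : (G : Graph) → EdgeSet G → Set
IsPerfectMatching G M = ∀ (v : Vertex G) → degIn G M (toℕ v) ≡ 1

isPM? : (G : Graph) → (M : EdgeSet G) → Dec (IsPerfectMatching G M)
isPM? G M = all? (λ v → degIn G M (toℕ v) ≟ 1)

allSubsets : (m : ℕ) → List (Subset m)
allSubsets zero = [] ∷ []
allSubsets (suc m) = map (true ∷_) (allSubsets m) ++ map (false ∷_) (allSubsets m)

numPM : Graph → ℕ
numPM G = length (filter (isPM? G) (allSubsets (length (E G))))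

Adjacent : Graph → ℕ → ℕ → Set
Adjacent G a b = ∃ λ (e : Edge G) → (ends G e ≡ (a , b)) ⊎ (ends G e ≡ (b , a))

data Reach (G : Graph) : ℕ → ℕ → Set where
  here : ∀ {a} → Reach G a a
  step : ∀ {a b c} → Adjacent G a b → Reach G b c → Reach G a c

Connected : Graph → Set
Connected G = ∀ (x y : Vertex G) → Reach G (toℕ x) (toℕ y)

MatchingCovered : Graph → Set
MatchingCovered G =
  (2 ≤ V G) × Connected G ×
  (∀ (e : Edge G) → ∃ λ (M : EdgeSet G) → IsPerfectMatching G M × inSet M e ≡ true)

Bipartite : Graph → Set
Bipartite G = ∃ λ (c : Vertex G → Bool) →
  ∀ (e : Edge G) (x y : Vertex G) →
    ends G e ≡ (toℕ x , toℕ y) → c x ≢ c y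

memℕ : ∀ {n} → Subset n → ℕ → Bool
memℕ [] _ = false
memℕ (b ∷ bs) zero = b
memℕ (b ∷ bs) (suc k) = memℕ bs k

crosses : ∀ {n} → Subset n → ℕ × ℕ → Bool
crosses X (a , b) = memℕ X a xor memℕ X b

cutCount : (G : Graph) → Subset (V G) → EdgeSet G → ℕ
cutCount G X M = countT (λ e → inSet M e ∧ crosses X (ends G e))

TightCut : (G : Graph) → Subset (V G) → Set
TightCut G X = ∀ (M : EdgeSet G) → IsPerfectMatching G M → cutCount G X M ≡ 1

NontrivialCut : (G : Graph) → Subset (V G) → Set
NontrivialCut G X = (2 ≤ ∣ X ∣) × (2 ≤ V G ∸ ∣ X ∣)

Brick : Graph → Set
Brick G = (¬ Bipartite G) × MatchingCovered G ×
          (∀ (X : Subset (V G)) → NontrivialCut G X → ¬ TightCut G X)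

-- #perfect matchings = |E| - |V| + 1  (written without truncated subtraction)
Extremal : Graph → Set
Extremal G = Brick G × (numPM G + V G ≡ length (E G) + 1)

-- Triangle insertion at v (of degree 3).  The vertex v is reused as b₁
-- and two new vertices b₂ = V, b₃ = V+1 are added; the j-th edge
-- incident with v (in list order) gets its v-end replaced by b_j, and
-- the triangle b₁b₂b₃ is added.  (Isomorphic to deleting v and adding
-- three fresh vertices.)

triIns : ℕ → Graph → Graph
triIns v (graph n es) =
  graph (2 + n) (go 0 es ++ ((v , n) ∷ (n , suc n) ∷ (suc n , v) ∷ []))
  where
  new : ℕ → ℕ
  new zero = v
  new (suc zero) = n
  new (suc (suc _)) = suc n
  go : ℕ → List (ℕ × ℕ) → List (ℕ × ℕ)
  go k [] = []
  go k ((a , b) ∷ rest) =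
    if a ≡ᵇ v then (new k , b) ∷ go (suc k) rest
    else (if b ≡ᵇ v then (a , new k) ∷ go (suc k) rest
          else (a , b) ∷ go k rest)

triInsAll : List ℕ → Graph → Graph
triInsAll vs G = foldl (λ H v → triIns v H) G vs

-- The construction.  Labels: u_s^k = 4s + (k-1) (s = 0..t, k = 1..4),
-- u = 4(t+1), u' = 4(t+1)+1.

uv : ℕ → ℕ → ℕ
uv s k = 4 * s + (k ∸ 1)

uT : ℕ → ℕ
uT t = 4 * suc t

u′ : ℕ → ℕ
u′ t = suc (4 * suc t)

Gt : ℕ → Graph
Gt t = graph (suc (4 * suc t))
  (concatMap (λ s → (uv s 1 , uv s 2) ∷ (uv s 2 , uv s 3) ∷ (uv s 3 , uv s 4) ∷ [])
             (upTo (suc t))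
   ++ concatMap (λ s → (uv s 1 , uv (suc s) 1) ∷ (uv s 4 , uv (suc s) 3) ∷ [])
                (upTo t)
   ++ ((uT t , uv t 1) ∷ (uT t , uv t 4) ∷ []))

S : ℕ → List ℕ
S t = uv 0 1 ∷ uv 0 3 ∷ uT t ∷ concatMap (λ s → uv s 2 ∷ uv s 4 ∷ []) (upTo (suc t))

G't : ℕ → Graph
G't t = graph (suc (V (Gt t))) (E (Gt t) ++ map (λ v → (u′ t , v)) (S t))

S₁ : ℕ → List ℕ
S₁ t = uv 0 1 ∷ uv 0 3 ∷ concatMap (λ s → uv s 2 ∷ uv s 4 ∷ []) (upTo t)

S₂ : ℕ → List ℕ
S₂ t = S₁ t ++ (uv t 2 ∷ [])

S₃ : ℕ → List ℕ
S₃ t = S₁ t ++ (uv t 2 ∷ uv t 4 ∷ [])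

S₄ : ℕ → List ℕ
S₄ t = S t

Ssel : ℕ → ℕ → List ℕ
Ssel t 2 = S₁ t
Ssel t 4 = S₂ t
Ssel t 6 = S₃ t
Ssel t 8 = S₄ t
Ssel t _ = []

G''n : ℕ → ℕ → Graph
G''n t i = triInsAll (Ssel t i) (G't t)

{-# OPTIONS --safe #-}
module Submission where

open import Defs
open import Data.Nat using (ℕ; zero; suc; _+_; _*_; _∸_; _≤_; _<_; _≡ᵇ_; z≤n; s≤s)
open import Data.Nat.Properties
open import Data.Nat.Tactic.RingSolver using (solve-∀)
open import Data.Bool using (Bool; true; false; _∧_; _∨_; _xor_; not; if_then_else_)
open import Data.Bool.Properties
  using (∨-comm; xor-comm; xor-same; not-involutive; ∧-zeroʳ; ∨-zeroʳ; ∧-identityʳ)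
open import Data.Fin using (Fin; toℕ; fromℕ<)
import Data.Fin as F
open import Data.Fin.Properties using (toℕ-fromℕ<; toℕ<n; toℕ-injective)
open import Data.Fin.Subset using (Subset; ∣_∣)
open import Data.List
  using (List; []; _∷_; _++_; length; lookup; map; filter; concatMap; upTo; applyUpTo)
open import Data.List.Properties
  using (filter-++; length-++; map-++; concatMap-map; map-concatMap; concatMap-cong; map-upTo; length-map)
open import Data.List.Relation.Binary.Permutation.Propositional as Perm using (_↭_; ↭-refl)
open import Data.List.Relation.Binary.Permutation.Propositional.Properties
  using (++-comm; ++-commutativeMonoid)
open import Data.Vec using (Vec; []; _∷_)
import Data.Vec as Vec
open import Data.Product using (_×_; _,_; proj₁; proj₂; ∃-syntax)
open import Data.Sum as Sum using (_⊎_; inj₁; inj₂)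
open import Data.Empty using (⊥; ⊥-elim)
open import Function using (_∘_)
open import Relation.Nullary using (¬_; Dec; yes; no; does)
open import Relation.Nullary.Decidable using (dec-true; dec-false)
open import Relation.Binary.PropositionalEquality
open import Algebra.Solver.CommutativeMonoid (++-commutativeMonoid {A = ℕ × ℕ})
  using (solve; _⊕_; _⊜_)

-- Let T be the triangle inserted at a cubic vertex v of a brick.  If the corners of T do not all
-- have the same colour in a tight cut, one corner is alone; contracting T to a vertex with the
-- colour of this corner gives a tight cut of the original brick, which is trivial.  A set M of
-- edges with degree 3 at v and degree 1 elsewhere excludes the cases that are not trivial after
-- the insertion, so the insertion yields a brick whenever such an M exists.  Perfect matchings
-- after all insertions correspond to the edge sets of G't with degree 1 or 3 at the selected
-- vertices and degree 1 elsewhere.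
--
-- In G't, contracting the first path together with u′ gives a smaller graph of the same kind, and
-- contracting everything else gives a wheel with five spokes; G't is a brick by induction.  The
-- edge sets with prescribed degrees are counted path by path, the state being the labels of the
-- two edges between consecutive paths and the number of used edges at u′.

-- An insertion adds three edges and two vertices, so it raises |E| - |V| + 1 by one: extremality
-- leaves room for exactly one new perfect matching per triangle. The set M serves both purposes. It
-- yields the new matching, and this matching meets the cut around the triangle in three edges;
-- without such a matching that cut would be tight. A further path with its two triangles adds 13
-- edges and 8 vertices, whence the constant 5 in the count.
--
-- The induction works because S contains the first and the third vertex of the first path. After a
-- path is contracted with u′, the two edges to the next path join u′ to the first and the third
-- vertex of that path, so the shape recurs; when no path is left, three parallel edges remain.
--
-- In both kinds of contraction the new vertex takes the colour of the lone vertex, not of the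
-- majority: a matching that crosses the cut inside the contracted part leaves that part from a
-- vertex of the majority colour without crossing, and after the contraction this leaving edge has
-- to supply the crossing.

Edges : Set
Edges = List (ℕ × ℕ)

-- Edge labellings, degrees and cuts

EdgeLabels : Edges → Set
EdgeLabels es = Vec Bool (length es)

𝟙 : Bool → ℕ
𝟙 b = if b then 1 else 0

-- Recursion along the edge list, instead of over `Fin` as in `countT`, lets degrees and cut sizes
-- compute on lists that begin with explicit edges, such as a star or a rung.
cnt : (ℕ × ℕ → Bool) → (es : Edges) → EdgeLabels es → ℕ
cnt P []       M       = 0
cnt P (e ∷ es) (b ∷ M) = 𝟙 (b ∧ P e) + cnt P es M

deg : (es : Edges) → EdgeLabels es → ℕ → ℕ
deg es M v = cnt (λ e → incident e v) es M

cut : (ℕ → Bool) → (es : Edges) → EdgeLabels es → ℕ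
cut x = cnt (λ e → x (proj₁ e) xor x (proj₂ e))

inc : Edges → ℕ → ℕ
inc []       v = 0
inc (e ∷ es) v = 𝟙 (incident e v) + inc es v

≡ᵇ-refl : ∀ n → (n ≡ᵇ n) ≡ true
≡ᵇ-refl n = dec-true (n ≟ n) refl

≡ᵇ-≢ : ∀ {m n} → m ≢ n → (m ≡ᵇ n) ≡ false
≡ᵇ-≢ {m} {n} = dec-false (m ≟ n)

≡ᵇ-true : ∀ {m n} → (m ≡ᵇ n) ≡ true → m ≡ n
≡ᵇ-true {m} {n} eq with m ≟ n
... | yes m≡n = m≡n
... | no m≢n with () ← trans (sym (≡ᵇ-≢ m≢n)) eq

≡ᵇ-false : ∀ {m n} → (m ≡ᵇ n) ≡ false → m ≢ n
≡ᵇ-false {m} eq refl with () ← trans (sym (≡ᵇ-refl m)) eq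

true≢false : ∀ {b} → b ≡ true → b ≡ false → ⊥
true≢false refl ()

bool-iff : ∀ {a b} → (a ≡ true → b ≡ true) → (b ≡ true → a ≡ true) → a ≡ b
bool-iff {true}  {b}     f g = sym (f refl)
bool-iff {false} {true}  f g = g refl
bool-iff {false} {false} f g = refl

∧-split : ∀ {a b} → a ∧ b ≡ true → a ≡ true × b ≡ true
∧-split {true} eq = refl , eq

countT-cnt : ∀ P es (M : EdgeLabels es) →
  countT (λ e → inSet M e ∧ P (lookup es e)) ≡ cnt P es M
countT-cnt P []       []      = refl
countT-cnt P (e ∷ es) (b ∷ M) = cong (𝟙 (b ∧ P e) +_) (countT-cnt P es M)

cnt-cong : ∀ {P Q : ℕ × ℕ → Bool} → (∀ e → P e ≡ Q e) → ∀ es M → cnt P es M ≡ cnt Q es M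
cnt-cong P≗Q []       M       = refl
cnt-cong P≗Q (e ∷ es) (b ∷ M) =
  cong₂ _+_ (cong (λ c → 𝟙 (b ∧ c)) (P≗Q e)) (cnt-cong P≗Q es M)

𝟙-∧ : ∀ b c → 𝟙 (b ∧ c) ≤ 𝟙 c
𝟙-∧ true  c = ≤-refl
𝟙-∧ false c = z≤n

deg≤inc : ∀ es M v → deg es M v ≤ inc es v
deg≤inc []       M       v = z≤n
deg≤inc (e ∷ es) (b ∷ M) v = +-mono-≤ (𝟙-∧ b (incident e v)) (deg≤inc es M v)

-- Sums over all edge labellings

sumB : (Bool → ℕ) → ℕ
sumB f = f true + f false

sumB-cong : ∀ {f g : Bool → ℕ} → (∀ b → f b ≡ g b) → sumB f ≡ sumB g
sumB-cong f≗g = cong₂ _+_ (f≗g true) (f≗g false)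

sumV : ∀ n → (Vec Bool n → ℕ) → ℕ
sumV zero    f = f []
sumV (suc n) f = sumB λ b → sumV n λ M → f (b ∷ M)

sumV-cong : ∀ n {f g : Vec Bool n → ℕ} → (∀ M → f M ≡ g M) → sumV n f ≡ sumV n g
sumV-cong zero    f≗g = f≗g []
sumV-cong (suc n) f≗g = sumB-cong λ b → sumV-cong n λ M → f≗g (b ∷ M)

sumV-zero : ∀ n → sumV n (λ _ → 0) ≡ 0
sumV-zero zero    = refl
sumV-zero (suc n) = cong₂ _+_ (sumV-zero n) (sumV-zero n)

+-swap : ∀ a b c d → (a + b) + (c + d) ≡ (a + c) + (b + d)
+-swap a b c d = begin
  (a + b) + (c + d)  ≡⟨ +-assoc a b (c + d) ⟩
  a + (b + (c + d))  ≡⟨ cong (a +_) (+-assoc b c d) ⟨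
  a + ((b + c) + d)  ≡⟨ cong (λ z → a + (z + d)) (+-comm b c) ⟩
  a + ((c + b) + d)  ≡⟨ cong (a +_) (+-assoc c b d) ⟩
  a + (c + (b + d))  ≡⟨ +-assoc a c (b + d) ⟨
  (a + c) + (b + d)  ∎
  where open ≡-Reasoning

sumV-sumB : ∀ n (f : Bool → Vec Bool n → ℕ) →
  sumV n (λ M → sumB λ b → f b M) ≡ sumB λ b → sumV n (f b)
sumV-sumB zero    f = refl
sumV-sumB (suc n) f = trans
  (cong₂ _+_ (sumV-sumB n λ b M → f b (true ∷ M)) (sumV-sumB n λ b M → f b (false ∷ M)))
  (+-swap (sumV n λ M → f true (true ∷ M)) _ _ _)

length-filter-map : ∀ {A B : Set} {P : B → Set} (P? : ∀ b → Dec (P b)) (f : A → B) xs →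
  length (filter P? (map f xs)) ≡ length (filter (λ a → P? (f a)) xs)
length-filter-map P? f [] = refl
length-filter-map P? f (x ∷ xs) with P? (f x)
... | yes _ = cong suc (length-filter-map P? f xs)
... | no  _ = length-filter-map P? f xs

length-filter-allSubsets : ∀ n {P : Subset n → Set} (P? : ∀ M → Dec (P M)) →
  length (filter P? (allSubsets n)) ≡ sumV n (λ M → 𝟙 (does (P? M)))
length-filter-allSubsets zero P? with P? []
... | yes _ = refl
... | no  _ = refl
length-filter-allSubsets (suc n) P? = begin
  length (filter P? (map (true ∷_) Ms ++ map (false ∷_) Ms))
    ≡⟨ cong length (filter-++ P? (map (true ∷_) Ms) _) ⟩
  length (filter P? (map (true ∷_) Ms) ++ filter P? (map (false ∷_) Ms))
    ≡⟨ length-++ (filter P? (map (true ∷_) Ms)) ⟩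
  length (filter P? (map (true ∷_) Ms)) + length (filter P? (map (false ∷_) Ms))
    ≡⟨ cong₂ _+_ (half true) (half false) ⟩
  sumV (suc n) (λ M → 𝟙 (does (P? M))) ∎
  where
  open ≡-Reasoning
  Ms = allSubsets n
  half : ∀ b → length (filter P? (map (b ∷_) Ms)) ≡ sumV n (λ M → 𝟙 (does (P? (b ∷ M))))
  half b = trans (length-filter-map P? (b ∷_) Ms)
                 (length-filter-allSubsets n (λ M → P? (b ∷ M)))

-- Degree conditions at all vertices

allB : ℕ → (ℕ → Bool) → Bool
allB zero    f = true
allB (suc n) f = f 0 ∧ allB n (f ∘ suc)

allB-sound : ∀ n f → allB n f ≡ true → ∀ v → v < n → f v ≡ true
allB-sound (suc n) f eq zero    v<n       = proj₁ (∧-split eq)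
allB-sound (suc n) f eq (suc v) (s≤s v<n) =
  allB-sound n (f ∘ suc) (proj₂ (∧-split {f 0} eq)) v v<n

allB-complete : ∀ n {f} → (∀ v → v < n → f v ≡ true) → allB n f ≡ true
allB-complete zero    h = refl
allB-complete (suc n) h = cong₂ _∧_ (h 0 (s≤s z≤n)) (allB-complete n λ v v<n → h (suc v) (s≤s v<n))

allB-cong : ∀ n {f g : ℕ → Bool} → (∀ v → v < n → f v ≡ g v) → allB n f ≡ allB n g
allB-cong zero    h = refl
allB-cong (suc n) h = cong₂ _∧_ (h 0 (s≤s z≤n)) (allB-cong n λ v v<n → h (suc v) (s≤s v<n))

allB-last : ∀ n (f : ℕ → Bool) → allB (suc n) f ≡ f n ∧ allB n f
allB-last n f = bool-iff
  (λ eq → cong₂ _∧_ (allB-sound (suc n) f eq n (n<1+n n))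
                    (allB-complete n λ v v<n → allB-sound (suc n) f eq v (m<n⇒m<1+n v<n)))
  (λ eq → let (fn , rest) = ∧-split {f n} eq in allB-complete (suc n) λ v v≤n →
    case-≤ fn rest v v≤n (v ≟ n))
  where
  case-≤ : f n ≡ true → allB n f ≡ true → ∀ v → v < suc n → Dec (v ≡ n) → f v ≡ true
  case-≤ fn rest v v≤n (yes refl) = fn
  case-≤ fn rest v v≤n (no v≢n)   = allB-sound n f rest v (≤∧≢⇒< (≤-pred v≤n) v≢n)

-- The condition at `v` is pulled out, but `v` stays in the range with a vacuous condition, so that
-- no vertex has to be renumbered.
allB-extract : ∀ n (f : ℕ → Bool) v → v < n → allB n f ≡ f v ∧ allB n (λ w → (w ≡ᵇ v) ∨ f w)
allB-extract n f v v<n = bool-iff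
  (λ eq → cong₂ _∧_ (allB-sound n f eq v v<n)
     (allB-complete n λ w w<n → trans (cong ((w ≡ᵇ v) ∨_) (allB-sound n f eq w w<n)) (∨-zeroʳ (w ≡ᵇ v))))
  (λ eq → let (fv , rest) = ∧-split {f v} eq in allB-complete n λ w w<n →
     recover fv w (w ≟ v) (allB-sound n _ rest w w<n))
  where
  recover : f v ≡ true → ∀ w → Dec (w ≡ v) → (w ≡ᵇ v) ∨ f w ≡ true → f w ≡ true
  recover fv w (yes refl) _  = fv
  recover fv w (no w≢v)   eq = trans (cong (_∨ f w) (sym (≡ᵇ-≢ w≢v))) eq

-- The condition `D` depends on the vertex because summing out an inserted triangle turns "degree 1"
-- at its vertex into "degree 1 or 3".
total : ℕ → (ℕ → ℕ → Bool) → Edges → ℕ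
total n D es = sumV (length es) λ M → 𝟙 (allB n λ v → D v (deg es M v))

total-cong : ∀ n {D D′ : ℕ → ℕ → Bool} → (∀ v → v < n → ∀ k → D v k ≡ D′ v k) → ∀ es →
  total n D es ≡ total n D′ es
total-cong n D≗D′ es = sumV-cong (length es) λ M →
  cong 𝟙 (allB-cong n λ v v<n → D≗D′ v v<n (deg es M v))

Sat : ℕ → (ℕ → ℕ) → (es : Edges) → EdgeLabels es → Set
Sat n d es M = ∀ v → v < n → deg es M v ≡ d v

one : ℕ → ℕ
one _ = 1

degIn-deg : ∀ n es M v → degIn (graph n es) M v ≡ deg es M v
degIn-deg n es M v = countT-cnt (λ e → incident e v) es M

Sat⇒PM : ∀ n es M → Sat n one es M → IsPerfectMatching (graph n es) M
Sat⇒PM n es M sat v = trans (degIn-deg n es M (toℕ v)) (sat (toℕ v) (toℕ<n v))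

PM⇒Sat : ∀ n es M → IsPerfectMatching (graph n es) M → Sat n one es M
PM⇒Sat n es M pm v v<n = begin
  deg es M v                              ≡⟨ degIn-deg n es M v ⟨
  degIn (graph n es) M v                  ≡⟨ cong (degIn (graph n es) M) (toℕ-fromℕ< v<n) ⟨
  degIn (graph n es) M (toℕ (fromℕ< v<n)) ≡⟨ pm (fromℕ< v<n) ⟩
  1                                       ∎
  where open ≡-Reasoning

isOne : ℕ → Bool
isOne k = k ≡ᵇ 1

numPM-total : ∀ n es → numPM (graph n es) ≡ total n (λ _ → isOne) es
numPM-total n es = trans (length-filter-allSubsets (length es) (isPM? (graph n es)))
  (sumV-cong (length es) λ M → cong 𝟙 (decide M))
  where
  sound : ∀ M → IsPerfectMatching (graph n es) M → allB n (λ v → isOne (deg es M v)) ≡ true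
  sound M pm = allB-complete n λ v v<n → cong isOne (PM⇒Sat n es M pm v v<n)
  decide : ∀ M → does (isPM? (graph n es) M) ≡ allB n (λ v → isOne (deg es M v))
  decide M with allB n (λ v → isOne (deg es M v)) in eq
  ... | true  = dec-true (isPM? (graph n es) M)
                  (Sat⇒PM n es M λ v v<n → ≡ᵇ-true (allB-sound n _ eq v v<n))
  ... | false = dec-false (isPM? (graph n es) M) λ pm → true≢false (sound M pm) eq

-- Rearranging edge lists

-- Equality of graphs on the same vertices, up to the order and the orientation of the edges. It is
-- data, not a mere relation: `carry` moves labellings forward along it, and `source` traces edges
-- back.
data _≈_ : Edges → Edges → Set where
  done  : [] ≈ []
  keep  : ∀ e {es fs} → es ≈ fs → (e ∷ es) ≈ (e ∷ fs)
  flip  : ∀ a b {es fs} → es ≈ fs → ((a , b) ∷ es) ≈ ((b , a) ∷ fs)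
  swap  : ∀ e f {es fs} → es ≈ fs → (e ∷ f ∷ es) ≈ (f ∷ e ∷ fs)
  _then_ : ∀ {es fs gs} → es ≈ fs → fs ≈ gs → es ≈ gs

infix  4 _≈_
infixr 3 _then_

≈-refl : ∀ {es} → es ≈ es
≈-refl {[]}     = done
≈-refl {e ∷ es} = keep e ≈-refl

≈-sym : ∀ {es fs} → es ≈ fs → fs ≈ es
≈-sym done         = done
≈-sym (keep e p)   = keep e (≈-sym p)
≈-sym (flip a b p) = flip b a (≈-sym p)
≈-sym (swap e f p) = swap f e (≈-sym p)
≈-sym (p then q)   = ≈-sym q then ≈-sym p

↭⇒≈ : ∀ {es fs} → es ↭ fs → es ≈ fs
↭⇒≈ Perm.refl         = ≈-refl
↭⇒≈ (Perm.prep e p)   = keep e (↭⇒≈ p)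
↭⇒≈ (Perm.swap e f p) = swap e f (↭⇒≈ p)
↭⇒≈ (Perm.trans p q)  = ↭⇒≈ p then ↭⇒≈ q

≈-++ˡ : ∀ es {fs gs} → fs ≈ gs → es ++ fs ≈ es ++ gs
≈-++ˡ []       p = p
≈-++ˡ (e ∷ es) p = keep e (≈-++ˡ es p)

≈-++ʳ : ∀ {es fs} gs → es ≈ fs → es ++ gs ≈ fs ++ gs
≈-++ʳ gs done         = ≈-refl
≈-++ʳ gs (keep e p)   = keep e (≈-++ʳ gs p)
≈-++ʳ gs (flip a b p) = flip a b (≈-++ʳ gs p)
≈-++ʳ gs (swap e f p) = swap e f (≈-++ʳ gs p)
≈-++ʳ gs (p then q)   = ≈-++ʳ gs p then ≈-++ʳ gs q

length-≈ : ∀ {es fs} → es ≈ fs → length es ≡ length fs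
length-≈ done         = refl
length-≈ (keep e p)   = cong suc (length-≈ p)
length-≈ (flip a b p) = cong suc (length-≈ p)
length-≈ (swap e f p) = cong (λ k → suc (suc k)) (length-≈ p)
length-≈ (p then q)   = trans (length-≈ p) (length-≈ q)

carry : ∀ {es fs} → es ≈ fs → EdgeLabels es → EdgeLabels fs
carry done         M           = []
carry (keep e p)   (b ∷ M)     = b ∷ carry p M
carry (flip a b p) (c ∷ M)     = c ∷ carry p M
carry (swap e f p) (b ∷ c ∷ M) = c ∷ b ∷ carry p M
carry (p then q)   M           = carry q (carry p M)

source : ∀ {es fs} → es ≈ fs → Fin (length fs) → Fin (length es)
source (keep e p)   F.zero          = F.zero
source (keep e p)   (F.suc i)      = F.suc (source p i)
source (flip a b p) F.zero          = F.zero
source (flip a b p) (F.suc i)      = F.suc (source p i)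
source (swap e f p) F.zero          = F.suc F.zero
source (swap e f p) (F.suc F.zero)     = F.zero
source (swap e f p) (F.suc (F.suc i)) = F.suc (F.suc (source p i))
source (p then q)   i           = source p (source q i)

lookup-carry : ∀ {es fs} (p : es ≈ fs) M i →
  Vec.lookup (carry p M) i ≡ Vec.lookup M (source p i)
lookup-carry (keep e p)   (b ∷ M)     F.zero          = refl
lookup-carry (keep e p)   (b ∷ M)     (F.suc i)      = lookup-carry p M i
lookup-carry (flip a b p) (c ∷ M)     F.zero          = refl
lookup-carry (flip a b p) (c ∷ M)     (F.suc i)      = lookup-carry p M i
lookup-carry (swap e f p) (b ∷ c ∷ M) F.zero          = refl
lookup-carry (swap e f p) (b ∷ c ∷ M) (F.suc F.zero)     = refl
lookup-carry (swap e f p) (b ∷ c ∷ M) (F.suc (F.suc i)) = lookup-carry p M i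
lookup-carry (p then q)   M           i           =
  trans (lookup-carry q (carry p M) i) (lookup-carry p M (source q i))

reverse : ℕ × ℕ → ℕ × ℕ
reverse (a , b) = (b , a)

ends-source : ∀ {es fs} (p : es ≈ fs) i →
  lookup fs i ≡ lookup es (source p i) ⊎ lookup fs i ≡ reverse (lookup es (source p i))
ends-source (keep e p)   F.zero          = inj₁ refl
ends-source (keep e p)   (F.suc i)      = ends-source p i
ends-source (flip a b p) F.zero          = inj₂ refl
ends-source (flip a b p) (F.suc i)      = ends-source p i
ends-source (swap e f p) F.zero          = inj₁ refl
ends-source (swap e f p) (F.suc F.zero)     = inj₁ refl
ends-source (swap e f p) (F.suc (F.suc i)) = ends-source p i
ends-source (p then q)   i with ends-source q i | ends-source p (source q i)
... | inj₁ r | inj₁ s = inj₁ (trans r s)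
... | inj₁ r | inj₂ s = inj₂ (trans r s)
... | inj₂ r | inj₁ s = inj₂ (trans r (cong reverse s))
... | inj₂ r | inj₂ s = inj₁ (trans r (cong reverse s))

Symmetric : (ℕ × ℕ → Bool) → Set
Symmetric P = ∀ a b → P (a , b) ≡ P (b , a)

incident-sym : ∀ v → Symmetric (λ e → incident e v)
incident-sym v a b = ∨-comm (a ≡ᵇ v) (b ≡ᵇ v)

+-leftswap : ∀ a b c → a + (b + c) ≡ b + (a + c)
+-leftswap a b c = trans (sym (+-assoc a b c)) (trans (cong (_+ c) (+-comm a b)) (+-assoc b a c))

cnt-carry : ∀ {P} → Symmetric P → ∀ {es fs} (p : es ≈ fs) M → cnt P fs (carry p M) ≡ cnt P es M
cnt-carry symP done         []          = refl
cnt-carry symP (keep e p)   (b ∷ M)     = cong (_ +_) (cnt-carry symP p M)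
cnt-carry symP (flip a b p) (c ∷ M)     =
  cong₂ _+_ (cong (λ z → 𝟙 (c ∧ z)) (symP b a)) (cnt-carry symP p M)
cnt-carry {P} symP (swap e f p) (b ∷ c ∷ M) = trans
  (cong (λ k → 𝟙 (c ∧ P f) + (𝟙 (b ∧ P e) + k)) (cnt-carry symP p M))
  (+-leftswap (𝟙 (c ∧ P f)) (𝟙 (b ∧ P e)) _)
cnt-carry symP (p then q)   M           = trans (cnt-carry symP q (carry p M)) (cnt-carry symP p M)

deg-carry : ∀ {es fs} (p : es ≈ fs) M v → deg fs (carry p M) v ≡ deg es M v
deg-carry p M v = cnt-carry (incident-sym v) p M

cut-carry : ∀ x {es fs} (p : es ≈ fs) M → cut x fs (carry p M) ≡ cut x es M
cut-carry x p M = cnt-carry (λ a b → xor-comm (x a) (x b)) p M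

inc-≈ : ∀ {es fs} → es ≈ fs → ∀ v → inc fs v ≡ inc es v
inc-≈ done         v = refl
inc-≈ (keep e p)   v = cong (_ +_) (inc-≈ p v)
inc-≈ (flip a b p) v = cong₂ _+_ (cong 𝟙 (incident-sym v b a)) (inc-≈ p v)
inc-≈ (swap e f p) v = trans (cong (λ k → 𝟙 (incident f v) + (𝟙 (incident e v) + k)) (inc-≈ p v))
  (+-leftswap (𝟙 (incident f v)) (𝟙 (incident e v)) _)
inc-≈ (p then q)   v = trans (inc-≈ q v) (inc-≈ p v)

sumV-carry : ∀ {es fs} (p : es ≈ fs) (f : EdgeLabels fs → ℕ) →
  sumV (length es) (λ M → f (carry p M)) ≡ sumV (length fs) f
sumV-carry done         f = refl
sumV-carry (keep e p)   f = sumB-cong λ b → sumV-carry p λ M → f (b ∷ M)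
sumV-carry (flip a b p) f = sumB-cong λ c → sumV-carry p λ M → f (c ∷ M)
sumV-carry {e ∷ f ∷ es} {_ ∷ _ ∷ fs} (swap e f p) g = trans
  (sumB-cong λ b → sumB-cong λ c → sumV-carry p λ M → g (c ∷ b ∷ M))
  (+-swap (sumV (length fs) λ M → g (true ∷ true ∷ M)) _ _ _)
sumV-carry (p then q)   f = trans (sumV-carry p λ M → f (carry q M)) (sumV-carry q f)

total-≈ : ∀ n D {es fs} → es ≈ fs → total n D es ≡ total n D fs
total-≈ n D {es} {fs} p = trans
  (sumV-cong (length es) λ M →
    cong 𝟙 (allB-cong n λ v _ → cong (D v) (sym (deg-carry p M v))))
  (sumV-carry p λ M → 𝟙 (allB n λ v → D v (deg fs M v)))

-- Bricks

-- Singletons and complements of singletons are treated alike, so the notion does not change when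
-- the two sides of a cut are exchanged.
Trivial : ℕ → (ℕ → Bool) → Set
Trivial n x = ∃[ w ] w < n × (∀ v → v < n → v ≢ w → x v ≡ not (x w))

-- The field `triangle` stands for nonbipartiteness and is supplied anew by every insertion. Cuts
-- are colourings of all of ℕ, so that contracting and renumbering become operations on functions.
record IsBrick (n : ℕ) (es : Edges) : Set where
  field
    wellFormed : WellFormed (graph n es)
    connected  : ∀ a b → a < n → b < n → Reach (graph n es) a b
    covered    : ∀ i → ∃[ M ] Sat n one es M × Vec.lookup M i ≡ true
    tight      : ∀ x → (∀ M → Sat n one es M → cut x es M ≡ 1) → Trivial n x
    triangle   : ∃[ a ] ∃[ b ] ∃[ c ] Adjacent (graph n es) a b ×
                   Adjacent (graph n es) b c × Adjacent (graph n es) c a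

Adjacent-≈ : ∀ {n es fs a b} → es ≈ fs → Adjacent (graph n es) a b → Adjacent (graph n fs) a b
Adjacent-≈ {fs = fs} p (i , q) = source (≈-sym p) i , ends-back q (ends-source (≈-sym p) i)
  where
  ends-back : ∀ {e f : ℕ × ℕ} {a b} → e ≡ (a , b) ⊎ e ≡ (b , a) → e ≡ f ⊎ e ≡ reverse f →
    f ≡ (a , b) ⊎ f ≡ (b , a)
  ends-back (inj₁ refl) (inj₁ refl) = inj₁ refl
  ends-back (inj₁ refl) (inj₂ refl) = inj₂ refl
  ends-back (inj₂ refl) (inj₁ refl) = inj₂ refl
  ends-back (inj₂ refl) (inj₂ refl) = inj₁ refl

Reach-trans : ∀ {G a b c} → Reach G a b → Reach G b c → Reach G a c
Reach-trans here       q = q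
Reach-trans (step e p) q = step e (Reach-trans p q)

Reach-map : ∀ {G H} (f : ℕ → ℕ) → (∀ {a b} → Adjacent G a b → Reach H (f a) (f b)) →
  ∀ {a b} → Reach G a b → Reach H (f a) (f b)
Reach-map f h here       = here
Reach-map f h (step e p) = Reach-trans (h e) (Reach-map f h p)

Adjacent-sym : ∀ G {a b} → Adjacent G a b → Adjacent G b a
Adjacent-sym G (i , inj₁ q) = i , inj₂ q
Adjacent-sym G (i , inj₂ q) = i , inj₁ q

Reach-sym : ∀ {G a b} → Reach G a b → Reach G b a
Reach-sym here       = here
Reach-sym {G} (step e p) = Reach-trans (Reach-sym p) (step (Adjacent-sym G e) here)

Sat-carry : ∀ {n d es fs} (p : es ≈ fs) {M} → Sat n d es M → Sat n d fs (carry p M)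
Sat-carry p {M} sat v v<n = trans (deg-carry p M v) (sat v v<n)

IsBrick-≈ : ∀ {n es fs} → es ≈ fs → IsBrick n es → IsBrick n fs
IsBrick-≈ {n} {es} {fs} p B = record
  { wellFormed = λ i → wf (wellFormed (source p i)) (ends-source p i)
  ; connected  = λ a b a<n b<n →
      Reach-map (λ v → v) (λ e → step (Adjacent-≈ {n} p e) here) (connected a b a<n b<n)
  ; covered    = λ i → let (M , sat , on) = covered (source p i) in
      carry p M , Sat-carry p sat , trans (lookup-carry p M i) on
  ; tight      = λ x h → tight x λ M sat → trans (sym (cut-carry x p M)) (h (carry p M) (Sat-carry p sat))
  ; triangle   = let (a , b , c , ab , bc , ca) = triangle in
      a , b , c , Adjacent-≈ {n} p ab , Adjacent-≈ {n} p bc , Adjacent-≈ {n} p ca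
  }
  where
  open IsBrick B
  wf : ∀ {e f : ℕ × ℕ} → proj₁ e < n × proj₂ e < n × proj₁ e ≢ proj₂ e → f ≡ e ⊎ f ≡ reverse e →
    proj₁ f < n × proj₂ f < n × proj₁ f ≢ proj₂ f
  wf h             (inj₁ refl) = h
  wf (l , r , l≢r) (inj₂ refl) = r , l , λ q → l≢r (sym q)

∣X∣≤1 : ∀ {n} (X : Subset n) w → (∀ v → v < n → v ≢ w → memℕ X v ≡ false) → ∣ X ∣ ≤ 1
∣X∣≤1 [] w h = z≤n
∣X∣≤1 (b ∷ X) (suc w) h with b | h 0 (s≤s z≤n) (λ ())
... | false | _ = ∣X∣≤1 X w λ v v<n v≢w → h (suc v) (s≤s v<n) λ q → v≢w (suc-injective q)
∣X∣≤1 (b ∷ X) zero h = bound b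
  where
  empty : ∀ {n} (Y : Subset n) → (∀ v → v < n → memℕ Y v ≡ false) → ∣ Y ∣ ≡ 0
  empty []      h = refl
  empty (b ∷ Y) h with b | h 0 (s≤s z≤n)
  ... | false | _ = empty Y λ v v<n → h (suc v) (s≤s v<n)
  X∅ : ∣ X ∣ ≡ 0
  X∅ = empty X λ v v<n → h (suc v) (s≤s v<n) λ ()
  bound : ∀ b → ∣ b ∷ X ∣ ≤ 1
  bound true  = s≤s (≤-reflexive X∅)
  bound false = ≤-trans (≤-reflexive X∅) z≤n

n≤1+∣X∣ : ∀ {n} (X : Subset n) w → (∀ v → v < n → v ≢ w → memℕ X v ≡ true) → n ≤ suc ∣ X ∣
n≤1+∣X∣ [] w h = z≤n
n≤1+∣X∣ (b ∷ X) (suc w) h with b | h 0 (s≤s z≤n) (λ ())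
... | true | _ = s≤s (n≤1+∣X∣ X w λ v v<n v≢w → h (suc v) (s≤s v<n) λ q → v≢w (suc-injective q))
n≤1+∣X∣ (b ∷ X) zero h = s≤s (bound b)
  where
  full : ∀ {n} (Y : Subset n) → (∀ v → v < n → memℕ Y v ≡ true) → n ≤ ∣ Y ∣
  full []      h = z≤n
  full (b ∷ Y) h with b | h 0 (s≤s z≤n)
  ... | true | _ = s≤s (full Y λ v v<n → h (suc v) (s≤s v<n))
  fullX : _ ≤ ∣ X ∣
  fullX = full X λ v v<n → h (suc v) (s≤s v<n) λ ()
  bound : ∀ b → _ ≤ ∣ b ∷ X ∣
  bound true  = m≤n⇒m≤1+n fullX
  bound false = fullX

triangle⇒¬Bipartite : ∀ G {a b c} → WellFormed G →
  Adjacent G a b → Adjacent G b c → Adjacent G c a → ¬ Bipartite G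
triangle⇒¬Bipartite G wf ab bc ca (col , proper) =
  no-three (differ ab) (differ bc) (differ ca)
  where
  differ : ∀ {a b} → Adjacent G a b →
    ∃[ v ] ∃[ w ] toℕ v ≡ a × toℕ w ≡ b × col v ≢ col w
  differ (e , q) with wf e
  differ (e , inj₁ refl) | l , r , _ =
    fromℕ< l , fromℕ< r , toℕ-fromℕ< l , toℕ-fromℕ< r ,
    proper e _ _ (cong₂ _,_ (sym (toℕ-fromℕ< l)) (sym (toℕ-fromℕ< r)))
  differ (e , inj₂ refl) | l , r , _ =
    fromℕ< r , fromℕ< l , toℕ-fromℕ< r , toℕ-fromℕ< l ,
    λ q → proper e _ _ (cong₂ _,_ (sym (toℕ-fromℕ< l)) (sym (toℕ-fromℕ< r))) (sym q)
  two : ∀ x y z → x ≢ y → y ≢ z → z ≢ x → ⊥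
  two true  true  z     p q r = p refl
  two false false z     p q r = p refl
  two true  false true  p q r = r refl
  two true  false false p q r = q refl
  two false true  true  p q r = q refl
  two false true  false p q r = r refl
  no-three : ∀ {a b c} → ∃[ v ] ∃[ w ] toℕ v ≡ a × toℕ w ≡ b × col v ≢ col w →
    ∃[ v ] ∃[ w ] toℕ v ≡ b × toℕ w ≡ c × col v ≢ col w →
    ∃[ v ] ∃[ w ] toℕ v ≡ c × toℕ w ≡ a × col v ≢ col w → ⊥
  no-three (u , v , ua , vb , u≢v) (v′ , w , v′b , wc , v≢w) (w′ , u′ , w′c , u′a , w≢u)
    with refl ← toℕ-injective (trans v′b (sym vb))
       | refl ← toℕ-injective (trans w′c (sym wc))
       | refl ← toℕ-injective (trans u′a (sym ua)) = two _ _ _ u≢v v≢w w≢u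


IsBrick⇒Brick : ∀ {n es} → 2 ≤ n → IsBrick n es → Brick (graph n es)
IsBrick⇒Brick {n} {es} 2≤n B =
  (let (a , b , c , ab , bc , ca) = triangle in triangle⇒¬Bipartite (graph n es) wellFormed ab bc ca) ,
  (2≤n , (λ v w → connected (toℕ v) (toℕ w) (toℕ<n v) (toℕ<n w)) ,
   λ e → let (M , sat , on) = covered e in M , Sat⇒PM n es M sat , on) ,
  λ X nontrivial tightX → trivial-absurd X nontrivial (tight (memℕ X) λ M sat →
    trans (cnt-cong (λ e → refl) es M)
      (trans (sym (countT-cnt (crosses X) es M)) (tightX M (Sat⇒PM n es M sat))))
  where
  open IsBrick B
  trivial-absurd : ∀ X → NontrivialCut (graph n es) X → Trivial n (memℕ X) → ⊥
  trivial-absurd X (2≤X , 2≤V∖X) (w , w<n , h) with memℕ X w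
  ... | true  = <⇒≱ 2≤X (∣X∣≤1 X w h)
  ... | false = <⇒≱ 2≤V∖X (m≤n+o⇒m∸n≤o n ∣ X ∣ (≤-trans (n≤1+∣X∣ X w h) (≤-reflexive (+-comm 1 ∣ X ∣))))

-- Inserting a triangle

corner : ℕ → ℕ → ℕ → ℕ
corner v n zero          = v
corner v n (suc zero)    = n
corner v n (suc (suc _)) = suc n

spread : ℕ → ℕ → ℕ → Edges → Edges
spread v n k [] = []
spread v n k ((a , b) ∷ es) =
  if a ≡ᵇ v then (corner v n k , b) ∷ spread v n (suc k) es
  else (if b ≡ᵇ v then (a , corner v n k) ∷ spread v n (suc k) es
        else (a , b) ∷ spread v n k es)

triangleOn : ℕ → ℕ → Edges
triangleOn v n = (v , n) ∷ (n , suc n) ∷ (suc n , v) ∷ []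

-- The local function of triIns cannot be named here; the left-hand side of
-- go-spread is found by unification with its uses in triIns-edges, where the
-- nested with-abstractions turn its arguments into distinct variables.
mutual
  triIns-edges : ∀ v n es → E (triIns v (graph n es)) ≡ spread v n 0 es ++ triangleOn v n
  triIns-edges v n [] = refl
  triIns-edges v n ((a , b) ∷ es) with a ≡ᵇ v | b ≡ᵇ v
  ... | true | _ with (a , b) ∷ es | 1
  ...   | es₀ | k = cong (λ r → (v , b) ∷ r ++ triangleOn v n) (go-spread v n es₀ k es)
  triIns-edges v n ((a , b) ∷ es) | false | true with (a , b) ∷ es | 1
  ...   | es₀ | k = cong (λ r → (a , v) ∷ r ++ triangleOn v n) (go-spread v n es₀ k es)
  triIns-edges v n ((a , b) ∷ es) | false | false with (a , b) ∷ es | 0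
  ...   | es₀ | k = cong (λ r → (a , b) ∷ r ++ triangleOn v n) (go-spread v n es₀ k es)

  go-spread : ∀ v n es₀ k es → _ ≡ spread v n k es
  go-spread v n es₀ k [] = refl
  go-spread v n es₀ k ((a , b) ∷ es) with a ≡ᵇ v | b ≡ᵇ v
  go-spread v n es₀ zero          (_ ∷ es) | true  | _     = cong (_ ∷_) (go-spread v n es₀ _ es)
  go-spread v n es₀ (suc zero)    (_ ∷ es) | true  | _     = cong (_ ∷_) (go-spread v n es₀ _ es)
  go-spread v n es₀ (suc (suc k)) (_ ∷ es) | true  | _     = cong (_ ∷_) (go-spread v n es₀ _ es)
  go-spread v n es₀ zero          (_ ∷ es) | false | true  = cong (_ ∷_) (go-spread v n es₀ _ es)
  go-spread v n es₀ (suc zero)    (_ ∷ es) | false | true  = cong (_ ∷_) (go-spread v n es₀ _ es)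
  go-spread v n es₀ (suc (suc k)) (_ ∷ es) | false | true  = cong (_ ∷_) (go-spread v n es₀ _ es)
  go-spread v n es₀ k             (_ ∷ es) | false | false = cong (_ ∷_) (go-spread v n es₀ _ es)

star : ℕ → ℕ → ℕ → ℕ → Edges → Edges
star v a b c rest = (v , a) ∷ (v , b) ∷ (v , c) ∷ rest

inflated : ℕ → ℕ → ℕ → ℕ → ℕ → Edges → Edges
inflated n v a b c rest =
  (v , a) ∷ (n , b) ∷ (suc n , c) ∷ (v , n) ∷ (n , suc n) ∷ (suc n , v) ∷ rest

spread-avoiding : ∀ v n k es → inc es v ≡ 0 → spread v n k es ≡ es
spread-avoiding v n k [] _ = refl
spread-avoiding v n k ((a , b) ∷ es) eq with a ≡ᵇ v | b ≡ᵇ v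
... | false | false = cong (_ ∷_) (spread-avoiding v n k es eq)

-- The edge moved to the front is the first one at `v`, hence the one that `spread` attaches to
-- corner `k`. Rearranging therefore commutes with the insertion, and three pulls with `k` equal to
-- 0, 1, 2 expose the whole star.
pull : ∀ v n d es → inc es v ≡ suc d → ∃[ a ] ∃[ fs ] es ≈ (v , a) ∷ fs × inc fs v ≡ d ×
  (∀ k → spread v n k es ≈ (corner v n k , a) ∷ spread v n (suc k) fs)
pull v n d ((a , b) ∷ es) eq with a ≡ᵇ v in av | b ≡ᵇ v in bv
... | true | _ with refl ← ≡ᵇ-true {a} {v} av =
  b , es , ≈-refl , suc-injective eq , λ k → ≈-refl
... | false | true with refl ← ≡ᵇ-true {b} {v} bv =
  a , es , flip a v ≈-refl , suc-injective eq , λ k → flip a (corner v n k) ≈-refl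
... | false | false with pull v n d es eq
...   | c , fs , p , incfs , q =
  c , (a , b) ∷ fs , (keep (a , b) p then swap _ _ ≈-refl) ,
  subst₂ (λ x y → 𝟙 (x ∨ y) + inc fs v ≡ d) (sym av) (sym bv) incfs ,
  λ k → keep (a , b) (q k) then
    subst₂ (λ x y → (a , b) ∷ (corner v n k , c) ∷ spread v n (suc k) fs ≈
      (corner v n k , c) ∷ (if x then (corner v n (suc k) , b) ∷ spread v n (suc (suc k)) fs
        else (if y then (a , corner v n (suc k)) ∷ spread v n (suc (suc k)) fs
              else (a , b) ∷ spread v n (suc k) fs))) (sym av) (sym bv) (swap _ _ ≈-refl)

cubic-star : ∀ v n es → inc es v ≡ 3 → ∃[ a ] ∃[ b ] ∃[ c ] ∃[ rest ]
  es ≈ star v a b c rest × E (triIns v (graph n es)) ≈ inflated n v a b c rest × inc rest v ≡ 0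
cubic-star v n es eq with pull v n 2 es eq
... | a , es₁ , p₁ , eq₁ , q₁ with pull v n 1 es₁ eq₁
... | b , es₂ , p₂ , eq₂ , q₂ with pull v n 0 es₂ eq₂
... | c , rest , p₃ , eq₃ , q₃ =
  a , b , c , rest , (p₁ then keep _ (p₂ then keep _ p₃)) ,
  subst (_≈ inflated n v a b c rest) (sym (triIns-edges v n es))
    (≈-++ʳ (triangleOn v n) (q₁ 0 then keep _ (q₂ 1 then keep _ (q₃ 2)))
     then keep _ (keep _ (keep _ (subst (λ r → r ++ triangleOn v n ≈ triangleOn v n ++ rest)
       (sym (spread-avoiding v n 3 rest eq₃)) (↭⇒≈ (++-comm rest (triangleOn v n))))))) , eq₃

Bounded : ℕ → Edges → Set
Bounded n es = ∀ i → proj₁ (lookup es i) < n × proj₂ (lookup es i) < n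

deg-inc0 : ∀ es M v → inc es v ≡ 0 → deg es M v ≡ 0
deg-inc0 es M v eq = n≤0⇒n≡0 (≤-trans (deg≤inc es M v) (≤-reflexive eq))

inc-fresh : ∀ {n} es → Bounded n es → ∀ w → n ≤ w → inc es w ≡ 0
inc-fresh []             bd w n≤w = refl
inc-fresh ((a , b) ∷ es) bd w n≤w
  rewrite ≡ᵇ-≢ (<⇒≢ (<-≤-trans (proj₁ (bd F.zero)) n≤w))
        | ≡ᵇ-≢ (<⇒≢ (<-≤-trans (proj₂ (bd F.zero)) n≤w)) =
  inc-fresh es (bd ∘ F.suc) w n≤w

inc-deg : ∀ es v → inc es v ≡ deg es (Vec.replicate (length es) true) v
inc-deg []       v = refl
inc-deg (e ∷ es) v = cong (_ +_) (inc-deg es v)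

recolour : ℕ → Bool → (ℕ → Bool) → ℕ → Bool
recolour v β x w = if w ≡ᵇ v then β else x w

recolour-same : ∀ v β x → recolour v β x v ≡ β
recolour-same v β x rewrite ≡ᵇ-refl v = refl

recolour-other : ∀ {v w} β x → w ≢ v → recolour v β x w ≡ x w
recolour-other β x w≢v rewrite ≡ᵇ-≢ w≢v = refl

cut-recolour : ∀ es M v β x → inc es v ≡ 0 → cut (recolour v β x) es M ≡ cut x es M
cut-recolour []             M       v β x eq = refl
cut-recolour ((a , b) ∷ es) (m ∷ M) v β x eq with a ≡ᵇ v | b ≡ᵇ v
... | false | false = cong (𝟙 (m ∧ (x a xor x b)) +_) (cut-recolour es M v β x eq)

spike : ℕ → ℕ → ℕ
spike v w = if w ≡ᵇ v then 3 else 1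

spike-same : ∀ v → spike v v ≡ 3
spike-same v rewrite ≡ᵇ-refl v = refl

spike-other : ∀ {v w} → w ≢ v → spike v w ≡ 1
spike-other w≢v rewrite ≡ᵇ-≢ w≢v = refl

-- The labelling with degree 3 at v extends to a perfect matching with three edges leaving the
-- inserted triangle, and it also shows that the three neighbours of v are distinct.
Inflatable : ℕ → Edges → ℕ → Set
Inflatable n es v = v < n × inc es v ≡ 3 × ∃[ M ] Sat n (spike v) es M

Inflatable-≈ : ∀ {n es fs v} → es ≈ fs → Inflatable n es v → Inflatable n fs v
Inflatable-≈ {v = v} p (v<n , eq , M , sat) =
  v<n , trans (inc-≈ p v) eq , carry p M , Sat-carry p sat

oneOrThree : ℕ → Bool
oneOrThree k = (k ≡ᵇ 1) ∨ (k ≡ᵇ 3)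

relax : ℕ → (ℕ → ℕ → Bool) → ℕ → ℕ → Bool
relax v D w k = if w ≡ᵇ v then oneOrThree k else D w k

-- The far ends of the star at v, and those of the inserted triangle, are collapsed to the vertex 3.
localStar localTriangle : Edges
localStar     = (0 , 3) ∷ (0 , 3) ∷ (0 , 3) ∷ []
localTriangle = (0 , 3) ∷ (1 , 3) ∷ (2 , 3) ∷ (0 , 1) ∷ (1 , 2) ∷ (2 , 0) ∷ []

-- The corners not matched outwards must be matched inside the triangle, so there are 0 or 2 of
-- them, and in either case the triangle edges are determined. The Boolean `r` stands for the
-- conditions at all other vertices.
triangle-extensions : ∀ m₁ m₂ m₃ r →
  (sumB λ t₁ → sumB λ t₂ → sumB λ t₃ → let M = m₁ ∷ m₂ ∷ m₃ ∷ t₁ ∷ t₂ ∷ t₃ ∷ [] in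
    𝟙 (isOne (deg localTriangle M 2) ∧ isOne (deg localTriangle M 1) ∧
       isOne (deg localTriangle M 0) ∧ r))
  ≡ 𝟙 (oneOrThree (deg localStar (m₁ ∷ m₂ ∷ m₃ ∷ []) 0) ∧ r)
triangle-extensions true  true  true  true  = refl
triangle-extensions true  true  true  false = refl
triangle-extensions true  true  false true  = refl
triangle-extensions true  true  false false = refl
triangle-extensions true  false true  true  = refl
triangle-extensions true  false true  false = refl
triangle-extensions true  false false true  = refl
triangle-extensions true  false false false = refl
triangle-extensions false true  true  true  = refl
triangle-extensions false true  true  false = refl
triangle-extensions false true  false true  = refl
triangle-extensions false true  false false = refl
triangle-extensions false false true  true  = refl
triangle-extensions false false true  false = refl
triangle-extensions false false false true  = refl
triangle-extensions false false false false = refl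

-- One formula for both admissible degrees: with degree 1 it takes the triangle edge opposite to the
-- corner matched outwards, with degree 3 it takes none.
extend : ∀ {k} → Vec Bool (3 + k) → Vec Bool (6 + k)
extend (m₁ ∷ m₂ ∷ m₃ ∷ M) = m₁ ∷ m₂ ∷ m₃ ∷ (m₃ ∧ not m₁) ∷ (m₁ ∧ not m₂) ∷ (m₂ ∧ not m₃) ∷ M

extend-degrees : ∀ m₁ m₂ m₃ → let k = deg localStar (m₁ ∷ m₂ ∷ m₃ ∷ []) 0 in k ≡ 1 ⊎ k ≡ 3 →
  let M = m₁ ∷ m₂ ∷ m₃ ∷ (m₃ ∧ not m₁) ∷ (m₁ ∧ not m₂) ∷ (m₂ ∧ not m₃) ∷ [] in
  deg localTriangle M 0 ≡ 1 × deg localTriangle M 1 ≡ 1 × deg localTriangle M 2 ≡ 1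
extend-degrees true  true  true  _ = refl , refl , refl
extend-degrees true  false false _ = refl , refl , refl
extend-degrees false true  false _ = refl , refl , refl
extend-degrees false false true  _ = refl , refl , refl
extend-degrees true  true  false (inj₁ ())
extend-degrees true  true  false (inj₂ ())
extend-degrees true  false true  (inj₁ ())
extend-degrees true  false true  (inj₂ ())
extend-degrees false true  true  (inj₁ ())
extend-degrees false true  true  (inj₂ ())
extend-degrees false false false (inj₁ ())
extend-degrees false false false (inj₂ ())

-- The colour of the corner that differs from the other two, if there is one, and otherwise the
-- common colour.
oddColour : Bool → Bool → Bool → Bool
oddColour true  true  s     = s
oddColour false false s     = s
oddColour true  false s     = not s
oddColour false true  s     = not s

-- If `q` and `s` agree, the odd colour is `p` and nothing changes. Otherwise the triangle edge is
-- the only crossing, so `α` equals `p`, which is the colour shared by two corners; the odd colour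
-- differs from it, and the crossing passes to the edge at the contracted vertex.
contract₁ : ∀ p q s α {r} → 𝟙 (p xor α) + (𝟙 (q xor s) + r) ≡ 1 → 𝟙 (oddColour p q s xor α) + r ≡ 1
contract₁ true  true  true  α     eq = eq
contract₁ true  false false α     eq = eq
contract₁ false true  true  α     eq = eq
contract₁ false false false α     eq = eq
contract₁ true  true  false true  eq = eq
contract₁ true  false true  true  eq = eq
contract₁ false true  false false eq = eq
contract₁ false false true  false eq = eq
contract₁ true  true  false false ()
contract₁ true  false true  false ()
contract₁ false true  false true  ()
contract₁ false false true  true  ()

contract₂ : ∀ p q s α {r} → 𝟙 (q xor α) + (𝟙 (s xor p) + r) ≡ 1 → 𝟙 (oddColour p q s xor α) + r ≡ 1
contract₂ true  true  true  α     eq = eq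
contract₂ true  false true  α     eq = eq
contract₂ false true  false α     eq = eq
contract₂ false false false α     eq = eq
contract₂ true  true  false true  eq = eq
contract₂ false true  true  true  eq = eq
contract₂ true  false false false eq = eq
contract₂ false false true  false eq = eq
contract₂ true  true  false false ()
contract₂ false true  true  false ()
contract₂ true  false false true  ()
contract₂ false false true  true  ()

contract₃ : ∀ p q s α {r} → 𝟙 (s xor α) + (𝟙 (p xor q) + r) ≡ 1 → 𝟙 (oddColour p q s xor α) + r ≡ 1
contract₃ true  true  s     α     eq = eq
contract₃ false false s     α     eq = eq
contract₃ true  false true  true  eq = eq
contract₃ true  false false false eq = eq
contract₃ false true  true  true  eq = eq
contract₃ false true  false false eq = eq
contract₃ true  false true  false ()
contract₃ true  false false true  ()
contract₃ false true  true  false ()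
contract₃ false true  false true  ()

-- The triangle edge takes up the single crossing, so the edge that leaves the third corner cannot
-- cross.
crossing-used : ∀ q α y z {r} → y ≢ z → 𝟙 (q xor α) + (𝟙 (y xor z) + r) ≡ 1 → α ≡ q
crossing-used q     α     true  true  y≢z eq = ⊥-elim (y≢z refl)
crossing-used q     α     false false y≢z eq = ⊥-elim (y≢z refl)
crossing-used true  true  true  false y≢z eq = refl
crossing-used false false true  false y≢z eq = refl
crossing-used true  true  false true  y≢z eq = refl
crossing-used false false false true  y≢z eq = refl
crossing-used true  false true  false y≢z ()
crossing-used false true  true  false y≢z ()
crossing-used true  false false true  y≢z ()
crossing-used false true  false true  y≢z ()

three-cross : ∀ p q s {α β γ δ r} → p ≡ δ → q ≡ δ → s ≡ δ → α ≡ not δ → β ≡ not δ → γ ≡ not δ →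
  𝟙 (p xor α) + (𝟙 (q xor β) + (𝟙 (s xor γ) + r)) ≢ 1
three-cross true  _ _ refl refl refl refl refl refl ()
three-cross false _ _ refl refl refl refl refl refl ()

data Corners (p q s β : Bool) : Set where
  equal : p ≡ β → q ≡ β → s ≡ β → Corners p q s β
  lone₀ : p ≡ β → q ≡ not β → s ≡ not β → Corners p q s β
  lone₁ : p ≡ not β → q ≡ β → s ≡ not β → Corners p q s β
  lone₂ : p ≡ not β → q ≡ not β → s ≡ β → Corners p q s β

corners : ∀ p q s → Corners p q s (oddColour p q s)
corners true  true  true  = equal refl refl refl
corners false false false = equal refl refl refl
corners true  false false = lone₀ refl refl refl
corners false true  true  = lone₀ refl refl refl
corners true  false true  = lone₁ refl refl refl
corners false true  false = lone₁ refl refl refl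
corners true  true  false = lone₂ refl refl refl
corners false false true  = lone₂ refl refl refl

opposite : ∀ {b c d : Bool} → b ≡ not d → c ≡ d → b ≢ c
opposite {d = true}  refl refl ()
opposite {d = false} refl refl ()

-- Counting, degrees and tight cuts after one insertion

module _ {n v a b c : ℕ} {rest : Edges} (v<n : v < n)
         (wf : WellFormed (graph n (star v a b c rest))) (rest∌v : inc rest v ≡ 0) where

  private
    es₀ = star v a b c rest
    es₁ = inflated n v a b c rest

    bounded : Bounded n rest
    bounded i = let (l , r , _) = wf (F.suc (F.suc (F.suc i))) in l , r

    a<n = proj₁ (proj₂ (wf F.zero))
    b<n = proj₁ (proj₂ (wf (F.suc F.zero)))
    c<n = proj₁ (proj₂ (wf (F.suc (F.suc F.zero))))
    a≢v : a ≢ v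
    a≢v q = proj₂ (proj₂ (wf F.zero)) (sym q)
    b≢v : b ≢ v
    b≢v q = proj₂ (proj₂ (wf (F.suc F.zero))) (sym q)
    c≢v : c ≢ v
    c≢v q = proj₂ (proj₂ (wf (F.suc (F.suc F.zero)))) (sym q)

    below-n : ∀ {w} → w < n → (w ≡ᵇ n) ≡ false
    below-n w<n = ≡ᵇ-≢ (<⇒≢ w<n)
    below-n′ : ∀ {w} → w < n → (n ≡ᵇ w) ≡ false
    below-n′ w<n = ≡ᵇ-≢ (>⇒≢ w<n)
    below-1+n : ∀ {w} → w < n → (w ≡ᵇ suc n) ≡ false
    below-1+n w<n = ≡ᵇ-≢ (<⇒≢ (m<n⇒m<1+n w<n))
    below-1+n′ : ∀ {w} → w < n → (suc n ≡ᵇ w) ≡ false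
    below-1+n′ w<n = ≡ᵇ-≢ (>⇒≢ (m<n⇒m<1+n w<n))

  deg-star : ∀ m₁ m₂ m₃ M → deg es₀ (m₁ ∷ m₂ ∷ m₃ ∷ M) v ≡ deg localStar (m₁ ∷ m₂ ∷ m₃ ∷ []) 0
  deg-star m₁ m₂ m₃ M rewrite ≡ᵇ-refl v | deg-inc0 rest M v rest∌v = refl

  deg-corner₀ : ∀ m₁ m₂ m₃ t₁ t₂ t₃ M → deg es₁ (m₁ ∷ m₂ ∷ m₃ ∷ t₁ ∷ t₂ ∷ t₃ ∷ M) v ≡
    deg localTriangle (m₁ ∷ m₂ ∷ m₃ ∷ t₁ ∷ t₂ ∷ t₃ ∷ []) 0
  deg-corner₀ m₁ m₂ m₃ t₁ t₂ t₃ M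
    rewrite ≡ᵇ-refl v | below-n′ v<n | below-1+n′ v<n | ≡ᵇ-≢ b≢v | ≡ᵇ-≢ c≢v
          | deg-inc0 rest M v rest∌v = refl

  deg-corner₁ : ∀ m₁ m₂ m₃ t₁ t₂ t₃ M → deg es₁ (m₁ ∷ m₂ ∷ m₃ ∷ t₁ ∷ t₂ ∷ t₃ ∷ M) n ≡
    deg localTriangle (m₁ ∷ m₂ ∷ m₃ ∷ t₁ ∷ t₂ ∷ t₃ ∷ []) 1
  deg-corner₁ m₁ m₂ m₃ t₁ t₂ t₃ M
    rewrite ≡ᵇ-refl n | below-n v<n | below-n a<n | below-n c<n | ≡ᵇ-≢ (1+n≢n {n})
          | deg-inc0 rest M n (inc-fresh rest bounded n ≤-refl) = refl

  deg-corner₂ : ∀ m₁ m₂ m₃ t₁ t₂ t₃ M → deg es₁ (m₁ ∷ m₂ ∷ m₃ ∷ t₁ ∷ t₂ ∷ t₃ ∷ M) (suc n) ≡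
    deg localTriangle (m₁ ∷ m₂ ∷ m₃ ∷ t₁ ∷ t₂ ∷ t₃ ∷ []) 2
  deg-corner₂ m₁ m₂ m₃ t₁ t₂ t₃ M
    rewrite ≡ᵇ-refl n | below-1+n v<n | below-1+n a<n | below-1+n b<n | ≡ᵇ-≢ (<⇒≢ (n<1+n n))
          | deg-inc0 rest M (suc n) (inc-fresh rest bounded (suc n) (n≤1+n n)) = refl

  deg-elsewhere : ∀ m₁ m₂ m₃ t₁ t₂ t₃ M {w} → w < n → w ≢ v →
    deg es₁ (m₁ ∷ m₂ ∷ m₃ ∷ t₁ ∷ t₂ ∷ t₃ ∷ M) w ≡ deg es₀ (m₁ ∷ m₂ ∷ m₃ ∷ M) w
  deg-elsewhere m₁ m₂ m₃ t₁ t₂ t₃ M w<n w≢v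
    rewrite ≡ᵇ-≢ (λ q → w≢v (sym q)) | below-n′ w<n | below-1+n′ w<n
          | ∧-zeroʳ t₁ | ∧-zeroʳ t₂ | ∧-zeroʳ t₃ = refl

  -- The triangle labels precede those of `rest`, so their sums are moved innermost; there
  -- `triangle-extensions` evaluates them for a fixed labelling of the star and of `rest`.
  total-inflated : ∀ {D : ℕ → ℕ → Bool} → (∀ k → D v k ≡ isOne k) → (∀ k → D n k ≡ isOne k) →
    (∀ k → D (suc n) k ≡ isOne k) → total (2 + n) D es₁ ≡ total n (relax v D) es₀
  total-inflated {D} Dv Dn D1+n =
    sumB-cong λ m₁ → sumB-cong λ m₂ → sumB-cong λ m₃ → begin
      (sumB λ t₁ → sumB λ t₂ → sumB λ t₃ → sumV k λ M → full m₁ m₂ m₃ t₁ t₂ t₃ M)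
        ≡⟨ (sumB-cong λ t₁ → sumB-cong λ t₂ → sumB-cong λ t₃ → sumV-cong k λ M →
             full-split m₁ m₂ m₃ t₁ t₂ t₃ M) ⟩
      (sumB λ t₁ → sumB λ t₂ → sumB λ t₃ → sumV k λ M → splitted m₁ m₂ m₃ t₁ t₂ t₃ M)
        ≡⟨ (sumB-cong λ t₁ → sumB-cong λ t₂ →
             sumV-sumB k λ t₃ M → splitted m₁ m₂ m₃ t₁ t₂ t₃ M) ⟨
      (sumB λ t₁ → sumB λ t₂ → sumV k λ M → sumB λ t₃ → splitted m₁ m₂ m₃ t₁ t₂ t₃ M)
        ≡⟨ (sumB-cong λ t₁ →
             sumV-sumB k λ t₂ M → sumB λ t₃ → splitted m₁ m₂ m₃ t₁ t₂ t₃ M) ⟨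
      (sumB λ t₁ → sumV k λ M → sumB λ t₂ → sumB λ t₃ → splitted m₁ m₂ m₃ t₁ t₂ t₃ M)
        ≡⟨ (sumV-sumB k λ t₁ M → sumB λ t₂ → sumB λ t₃ → splitted m₁ m₂ m₃ t₁ t₂ t₃ M) ⟨
      (sumV k λ M → sumB λ t₁ → sumB λ t₂ → sumB λ t₃ → splitted m₁ m₂ m₃ t₁ t₂ t₃ M)
        ≡⟨ (sumV-cong k λ M → trans
              (triangle-extensions m₁ m₂ m₃ (others (m₁ ∷ m₂ ∷ m₃ ∷ M)))
              (sym (star-split m₁ m₂ m₃ M))) ⟩
      (sumV k λ M → 𝟙 (allB n λ w → relax v D w (deg es₀ (m₁ ∷ m₂ ∷ m₃ ∷ M) w))) ∎
    where
    open ≡-Reasoning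
    k = length rest
    full splitted : (m₁ m₂ m₃ t₁ t₂ t₃ : Bool) → EdgeLabels rest → ℕ
    others : EdgeLabels es₀ → Bool
    others M = allB n λ w → (w ≡ᵇ v) ∨ D w (deg es₀ M w)
    full m₁ m₂ m₃ t₁ t₂ t₃ M =
      𝟙 (allB (2 + n) λ w → D w (deg es₁ (m₁ ∷ m₂ ∷ m₃ ∷ t₁ ∷ t₂ ∷ t₃ ∷ M) w))
    splitted m₁ m₂ m₃ t₁ t₂ t₃ M = let L = m₁ ∷ m₂ ∷ m₃ ∷ t₁ ∷ t₂ ∷ t₃ ∷ [] in
      𝟙 (isOne (deg localTriangle L 2) ∧ isOne (deg localTriangle L 1) ∧
         isOne (deg localTriangle L 0) ∧ others (m₁ ∷ m₂ ∷ m₃ ∷ M))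
    full-split : ∀ m₁ m₂ m₃ t₁ t₂ t₃ M →
      full m₁ m₂ m₃ t₁ t₂ t₃ M ≡ splitted m₁ m₂ m₃ t₁ t₂ t₃ M
    full-split m₁ m₂ m₃ t₁ t₂ t₃ M = cong 𝟙 (begin
      allB (2 + n) f
        ≡⟨ allB-last (suc n) f ⟩
      f (suc n) ∧ allB (suc n) f
        ≡⟨ cong (f (suc n) ∧_) (allB-last n f) ⟩
      f (suc n) ∧ f n ∧ allB n f
        ≡⟨ cong (λ r → f (suc n) ∧ f n ∧ r) (allB-extract n f v v<n) ⟩
      f (suc n) ∧ f n ∧ f v ∧ allB n (λ w → (w ≡ᵇ v) ∨ f w)
        ≡⟨ cong₂ _∧_ (trans (D1+n _) (cong isOne (deg-corner₂ m₁ m₂ m₃ t₁ t₂ t₃ M)))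
          (cong₂ _∧_ (trans (Dn _) (cong isOne (deg-corner₁ m₁ m₂ m₃ t₁ t₂ t₃ M)))
          (cong₂ _∧_ (trans (Dv _) (cong isOne (deg-corner₀ m₁ m₂ m₃ t₁ t₂ t₃ M)))
          (allB-cong n same))) ⟩
      _ ∎)
      where
      f : ℕ → Bool
      f w = D w (deg es₁ (m₁ ∷ m₂ ∷ m₃ ∷ t₁ ∷ t₂ ∷ t₃ ∷ M) w)
      same : ∀ w → w < n → (w ≡ᵇ v) ∨ f w ≡ (w ≡ᵇ v) ∨ D w (deg es₀ (m₁ ∷ m₂ ∷ m₃ ∷ M) w)
      same w w<n with w ≡ᵇ v in eq
      ... | true  = refl
      ... | false = cong (D w) (deg-elsewhere m₁ m₂ m₃ t₁ t₂ t₃ M w<n (≡ᵇ-false eq))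
    star-split : ∀ m₁ m₂ m₃ M →
      𝟙 (allB n λ w → relax v D w (deg es₀ (m₁ ∷ m₂ ∷ m₃ ∷ M) w)) ≡
      𝟙 (oneOrThree (deg localStar (m₁ ∷ m₂ ∷ m₃ ∷ []) 0) ∧ others (m₁ ∷ m₂ ∷ m₃ ∷ M))
    star-split m₁ m₂ m₃ M = cong 𝟙 (trans (allB-extract n g v v<n)
      (cong₂ _∧_ gv (allB-cong n same)))
      where
      g : ℕ → Bool
      g w = relax v D w (deg es₀ (m₁ ∷ m₂ ∷ m₃ ∷ M) w)
      gv : g v ≡ oneOrThree (deg localStar (m₁ ∷ m₂ ∷ m₃ ∷ []) 0)
      gv = trans (cong (λ z → if z then oneOrThree (deg es₀ (m₁ ∷ m₂ ∷ m₃ ∷ M) v)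
                              else D v (deg es₀ (m₁ ∷ m₂ ∷ m₃ ∷ M) v)) (≡ᵇ-refl v))
                 (cong oneOrThree (deg-star m₁ m₂ m₃ M))
      same : ∀ w → w < n → (w ≡ᵇ v) ∨ g w ≡ (w ≡ᵇ v) ∨ D w (deg es₀ (m₁ ∷ m₂ ∷ m₃ ∷ M) w)
      same w w<n with w ≡ᵇ v
      ... | true  = refl
      ... | false = refl

  data Position : ℕ → Set where
    top    : Position (suc n)
    middle : Position n
    pivot  : Position v
    other  : ∀ {w} → w < n → w ≢ v → Position w

  position : ∀ w → w < 2 + n → Position w
  position w w<2+n with w ≟ suc n | w ≟ n | w ≟ v
  ... | yes refl | _        | _        = top
  ... | no _     | yes refl | _        = middle
  ... | no _     | no _     | yes refl = pivot
  ... | no ≢1+n  | no ≢n    | no ≢v    =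
    other (≤∧≢⇒< (≤-pred (≤∧≢⇒< (≤-pred w<2+n) ≢1+n)) ≢n) ≢v

  -- General degrees cover three uses: extending perfect matchings, turning a labelling with degree
  -- 3 at `v` into a perfect matching, and keeping a labelling with degree 3 at another vertex for a
  -- later insertion.
  Sat-extend : ∀ {d d′ : ℕ → ℕ} → d v ≡ 1 ⊎ d v ≡ 3 → d′ v ≡ 1 → d′ n ≡ 1 → d′ (suc n) ≡ 1 →
    (∀ {w} → w < n → w ≢ v → d′ w ≡ d w) → ∀ M → Sat n d es₀ M → Sat (2 + n) d′ es₁ (extend M)
  Sat-extend {d} {d′} dv d′v d′n d′1+n agree (m₁ ∷ m₂ ∷ m₃ ∷ M) sat w w<2+n =
    at (position w w<2+n)
    where
    at-v : deg localStar (m₁ ∷ m₂ ∷ m₃ ∷ []) 0 ≡ d v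
    at-v = trans (sym (deg-star m₁ m₂ m₃ M)) (sat v v<n)
    degrees = extend-degrees m₁ m₂ m₃ (Sum.map (trans at-v) (trans at-v) dv)
    at : ∀ {w} → Position w →
      deg es₁ (m₁ ∷ m₂ ∷ m₃ ∷ (m₃ ∧ not m₁) ∷ (m₁ ∧ not m₂) ∷ (m₂ ∧ not m₃) ∷ M) w ≡ d′ w
    at top    = trans (deg-corner₂ m₁ m₂ m₃ (m₃ ∧ not m₁) (m₁ ∧ not m₂) (m₂ ∧ not m₃) M)
      (trans (proj₂ (proj₂ degrees)) (sym d′1+n))
    at middle = trans (deg-corner₁ m₁ m₂ m₃ (m₃ ∧ not m₁) (m₁ ∧ not m₂) (m₂ ∧ not m₃) M)
      (trans (proj₁ (proj₂ degrees)) (sym d′n))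
    at pivot  = trans (deg-corner₀ m₁ m₂ m₃ (m₃ ∧ not m₁) (m₁ ∧ not m₂) (m₂ ∧ not m₃) M)
      (trans (proj₁ degrees) (sym d′v))
    at (other {w} w<n w≢v) =
      trans (deg-elsewhere m₁ m₂ m₃ (m₃ ∧ not m₁) (m₁ ∧ not m₂) (m₂ ∧ not m₃) M w<n w≢v)
        (trans (sat w w<n) (sym (agree w<n w≢v)))

  Inflatable-inflated : ∀ {w} → w ≢ v → Inflatable n es₀ w → Inflatable (2 + n) es₁ w
  Inflatable-inflated {w} w≢v (w<n , three , M , sat) =
    m≤n⇒m≤1+n (m<n⇒m<1+n w<n) ,
    (begin
      inc es₁ w                                        ≡⟨ inc-deg es₁ w ⟩
      deg es₁ (Vec.replicate (length es₁) true) w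
        ≡⟨ deg-elsewhere true true true true true true (Vec.replicate (length rest) true) w<n w≢v ⟩
      deg es₀ (Vec.replicate (length es₀) true) w      ≡⟨ inc-deg es₀ w ⟨
      inc es₀ w                                        ≡⟨ three ⟩
      3                                                ∎) ,
    extend M ,
    Sat-extend (inj₁ (spike-other λ q → w≢v (sym q)))
      (spike-other λ q → w≢v (sym q)) (spike-other (>⇒≢ w<n)) (spike-other (>⇒≢ (m<n⇒m<1+n w<n)))
      (λ _ _ → refl) M sat
    where open ≡-Reasoning

  private
    module Inflate (B : IsBrick n es₀) (Mᵥ : EdgeLabels es₀) (satᵥ : Sat n (spike v) es₀ Mᵥ) where
      open IsBrick B

      ext : EdgeLabels es₀ → EdgeLabels es₁
      ext = extend

      PM-extend : ∀ M → Sat n one es₀ M → Sat (2 + n) one es₁ (ext M)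
      PM-extend = Sat-extend (inj₁ refl) refl refl refl λ _ _ → refl

      wellFormed₁ : WellFormed (graph (2 + n) es₁)
      wellFormed₁ F.zero = let (l , r , l≢r) = wf F.zero in up l , up r , l≢r
        where up : ∀ {w} → w < n → w < 2 + n
              up w<n = m≤n⇒m≤1+n (m<n⇒m<1+n w<n)
      wellFormed₁ (F.suc F.zero) = m≤n⇒m≤1+n (n<1+n n) , m≤n⇒m≤1+n (m<n⇒m<1+n b<n) , >⇒≢ b<n
      wellFormed₁ (F.suc (F.suc F.zero)) =
        n<1+n (suc n) , m≤n⇒m≤1+n (m<n⇒m<1+n c<n) , >⇒≢ (m<n⇒m<1+n c<n)
      wellFormed₁ (F.suc (F.suc (F.suc F.zero))) =
        m≤n⇒m≤1+n (m<n⇒m<1+n v<n) , m≤n⇒m≤1+n (n<1+n n) , <⇒≢ v<n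
      wellFormed₁ (F.suc (F.suc (F.suc (F.suc F.zero)))) =
        m≤n⇒m≤1+n (n<1+n n) , n<1+n (suc n) , <⇒≢ (n<1+n n)
      wellFormed₁ (F.suc (F.suc (F.suc (F.suc (F.suc F.zero))))) =
        n<1+n (suc n) , m≤n⇒m≤1+n (m<n⇒m<1+n v<n) , >⇒≢ (m<n⇒m<1+n v<n)
      wellFormed₁ (F.suc (F.suc (F.suc (F.suc (F.suc (F.suc i)))))) =
        let (l , r , l≢r) = wf (F.suc (F.suc (F.suc i))) in
        m≤n⇒m≤1+n (m<n⇒m<1+n l) , m≤n⇒m≤1+n (m<n⇒m<1+n r) , l≢r

      G₁ = graph (2 + n) es₁

      v–a : Adjacent G₁ v a
      v–a = F.zero , inj₁ refl
      n–b : Adjacent G₁ n b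
      n–b = F.suc F.zero , inj₁ refl
      1+n–c : Adjacent G₁ (suc n) c
      1+n–c = F.suc (F.suc F.zero) , inj₁ refl
      v–n : Adjacent G₁ v n
      v–n = F.suc (F.suc (F.suc F.zero)) , inj₁ refl
      n–1+n : Adjacent G₁ n (suc n)
      n–1+n = F.suc (F.suc (F.suc (F.suc F.zero))) , inj₁ refl
      1+n–v : Adjacent G₁ (suc n) v
      1+n–v = F.suc (F.suc (F.suc (F.suc (F.suc F.zero)))) , inj₁ refl

      reroute : ∀ {x y} → Adjacent (graph n es₀) x y → Reach G₁ x y
      reroute (F.zero , inj₁ refl) = step v–a here
      reroute (F.zero , inj₂ refl) = Reach-sym (step v–a here)
      reroute (F.suc F.zero , inj₁ refl) = step v–n (step n–b here)
      reroute (F.suc F.zero , inj₂ refl) = Reach-sym (step v–n (step n–b here))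
      reroute (F.suc (F.suc F.zero) , inj₁ refl) =
        step (Adjacent-sym G₁ 1+n–v) (step 1+n–c here)
      reroute (F.suc (F.suc F.zero) , inj₂ refl) =
        Reach-sym (step (Adjacent-sym G₁ 1+n–v) (step 1+n–c here))
      reroute (F.suc (F.suc (F.suc i)) , q) =
        step (F.suc (F.suc (F.suc (F.suc (F.suc (F.suc i))))) , q) here

      to-pivot : ∀ {w} → Position w → Reach G₁ w v
      to-pivot top            = step 1+n–v here
      to-pivot middle         = step (Adjacent-sym G₁ v–n) here
      to-pivot pivot          = here
      to-pivot (other w<n _)  = Reach-map (λ w → w) reroute (connected _ _ w<n v<n)

      connected₁ : ∀ x y → x < 2 + n → y < 2 + n → Reach G₁ x y
      connected₁ x y x< y< =
        Reach-trans (to-pivot (position x x<)) (Reach-sym (to-pivot (position y y<)))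

      data Single : Bool → Bool → Bool → Set where
        first  : Single true false false
        second : Single false true false
        third  : Single false false true

      single : ∀ m₁ m₂ m₃ {M} → Sat n one es₀ (m₁ ∷ m₂ ∷ m₃ ∷ M) → Single m₁ m₂ m₃
      single m₁ m₂ m₃ {M} sat = go m₁ m₂ m₃ (trans (sym (deg-star m₁ m₂ m₃ M)) (sat v v<n))
        where
        go : ∀ m₁ m₂ m₃ → deg localStar (m₁ ∷ m₂ ∷ m₃ ∷ []) 0 ≡ 1 → Single m₁ m₂ m₃
        go true  false false _ = first
        go false true  false _ = second
        go false false true  _ = third
        go true  true  true  ()
        go true  true  false ()
        go true  false true  ()
        go false true  true  ()
        go false false false ()

      through₁ : ∃[ M ] Sat n one es₀ (true ∷ false ∷ false ∷ M)
      through₁ with covered F.zero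
      ... | m₁ ∷ m₂ ∷ m₃ ∷ M , sat , on with single m₁ m₂ m₃ sat | on
      ... | first | _ = M , sat

      through₂ : ∃[ M ] Sat n one es₀ (false ∷ true ∷ false ∷ M)
      through₂ with covered (F.suc F.zero)
      ... | m₁ ∷ m₂ ∷ m₃ ∷ M , sat , on with single m₁ m₂ m₃ sat | on
      ... | second | _ = M , sat

      through₃ : ∃[ M ] Sat n one es₀ (false ∷ false ∷ true ∷ M)
      through₃ with covered (F.suc (F.suc F.zero))
      ... | m₁ ∷ m₂ ∷ m₃ ∷ M , sat , on with single m₁ m₂ m₃ sat | on
      ... | third | _ = M , sat

      covered₁ : ∀ i → ∃[ M ] Sat (2 + n) one es₁ M × Vec.lookup M i ≡ true
      covered₁ F.zero = let (M , sat) = through₁ in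
        ext (true ∷ false ∷ false ∷ M) , PM-extend (true ∷ false ∷ false ∷ M) sat , refl
      covered₁ (F.suc F.zero) =
        let (M , sat) = through₂ in
        ext (false ∷ true ∷ false ∷ M) , PM-extend (false ∷ true ∷ false ∷ M) sat , refl
      covered₁ (F.suc (F.suc F.zero)) =
        let (M , sat) = through₃ in
        ext (false ∷ false ∷ true ∷ M) , PM-extend (false ∷ false ∷ true ∷ M) sat , refl
      -- A triangle edge is covered by a matching that leaves through the opposite corner; for the
      -- edge from `v` to `n` this corner is `suc n`, so the third star edge is chosen.
      covered₁ (F.suc (F.suc (F.suc F.zero))) =
        let (M , sat) = through₃ in
        ext (false ∷ false ∷ true ∷ M) , PM-extend (false ∷ false ∷ true ∷ M) sat , refl
      covered₁ (F.suc (F.suc (F.suc (F.suc F.zero)))) =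
        let (M , sat) = through₁ in
        ext (true ∷ false ∷ false ∷ M) , PM-extend (true ∷ false ∷ false ∷ M) sat , refl
      covered₁ (F.suc (F.suc (F.suc (F.suc (F.suc F.zero))))) =
        let (M , sat) = through₂ in
        ext (false ∷ true ∷ false ∷ M) , PM-extend (false ∷ true ∷ false ∷ M) sat , refl
      covered₁ (F.suc (F.suc (F.suc (F.suc (F.suc (F.suc i)))))) with covered (F.suc (F.suc (F.suc i)))
      ... | m₁ ∷ m₂ ∷ m₃ ∷ M , sat , on =
        ext (m₁ ∷ m₂ ∷ m₃ ∷ M) , PM-extend (m₁ ∷ m₂ ∷ m₃ ∷ M) sat , on

      spike-star : ∃[ M ] Sat n (spike v) es₀ (true ∷ true ∷ true ∷ M)
      spike-star = from Mᵥ satᵥ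
        where
        from : ∀ M → Sat n (spike v) es₀ M → ∃[ M ] Sat n (spike v) es₀ (true ∷ true ∷ true ∷ M)
        from (m₁ ∷ m₂ ∷ m₃ ∷ M) sat =
          go m₁ m₂ m₃ (trans (sym (deg-star m₁ m₂ m₃ M)) (trans (sat v v<n) (spike-same v))) sat
          where
          go : ∀ m₁ m₂ m₃ → deg localStar (m₁ ∷ m₂ ∷ m₃ ∷ []) 0 ≡ 3 →
            Sat n (spike v) es₀ (m₁ ∷ m₂ ∷ m₃ ∷ M) →
            ∃[ M ] Sat n (spike v) es₀ (true ∷ true ∷ true ∷ M)
          go true  true  true  _ sat = M , sat
          go true  true  false ()
          go true  false true  ()
          go true  false false ()
          go false true  true  ()
          go false true  false ()
          go false false true  ()
          go false false false ()

      distinct-ends : a ≢ b × b ≢ c × a ≢ c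
      distinct-ends = let (M , sat) = spike-star in
        (λ { refl → ab M (trans (sat a a<n) (spike-other a≢v)) }) ,
        (λ { refl → bc M (trans (sat b b<n) (spike-other b≢v)) }) ,
        (λ { refl → ac M (trans (sat a a<n) (spike-other a≢v)) })
        where
        v∨true : ∀ w → (v ≡ᵇ w) ∨ (w ≡ᵇ w) ≡ true
        v∨true w = trans (cong ((v ≡ᵇ w) ∨_) (≡ᵇ-refl w)) (∨-zeroʳ (v ≡ᵇ w))
        ab : ∀ M → deg (star v a a c rest) (true ∷ true ∷ true ∷ M) a ≢ 1
        ab M rewrite v∨true a = λ ()
        bc : ∀ M → deg (star v a b b rest) (true ∷ true ∷ true ∷ M) b ≢ 1
        bc M rewrite v∨true b = λ eq → 1+n≢0 (m+n≡0⇒n≡0 _ (suc-injective (trans (sym (+-suc _ _)) eq)))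
        ac : ∀ M → deg (star v a b a rest) (true ∷ true ∷ true ∷ M) a ≢ 1
        ac M rewrite v∨true a = λ eq → 1+n≢0 (m+n≡0⇒n≡0 _ (suc-injective eq))

      module Cut (x : ℕ → Bool) (tight₁ : ∀ M → Sat (2 + n) one es₁ M → cut x es₁ M ≡ 1) where
        p = x v
        q = x n
        s = x (suc n)
        β = oddColour p q s

        x̂ : ℕ → Bool
        x̂ = recolour v β x

        cut-contract : ∀ {w M k} → w ≢ v → 𝟙 (β xor x w) + cut x rest M ≡ k →
          𝟙 (x̂ v xor x̂ w) + cut x̂ rest M ≡ k
        cut-contract {w} {M} w≢v eq = trans
          (cong₂ _+_ (cong₂ (λ y z → 𝟙 (y xor z)) (recolour-same v β x) (recolour-other β x w≢v))
                     (cut-recolour rest M v β x rest∌v)) eq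

        tight₀ : ∀ M → Sat n one es₀ M → cut x̂ es₀ M ≡ 1
        tight₀ (m₁ ∷ m₂ ∷ m₃ ∷ M) sat with single m₁ m₂ m₃ sat
            | tight₁ (ext (m₁ ∷ m₂ ∷ m₃ ∷ M)) (PM-extend (m₁ ∷ m₂ ∷ m₃ ∷ M) sat)
        ... | first  | eq = cut-contract a≢v (contract₁ p q s (x a) eq)
        ... | second | eq = cut-contract b≢v (contract₂ p q s (x b) eq)
        ... | third  | eq = cut-contract c≢v (contract₃ p q s (x c) eq)

        cut₁ : ∃[ r ] 𝟙 (p xor x a) + (𝟙 (q xor s) + r) ≡ 1
        cut₁ = let (M , sat) = through₁ in
          cut x rest M , tight₁ (ext (true ∷ false ∷ false ∷ M)) (PM-extend (true ∷ false ∷ false ∷ M) sat)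

        cut₂ : ∃[ r ] 𝟙 (q xor x b) + (𝟙 (s xor p) + r) ≡ 1
        cut₂ = let (M , sat) = through₂ in
          cut x rest M , tight₁ (ext (false ∷ true ∷ false ∷ M)) (PM-extend (false ∷ true ∷ false ∷ M) sat)

        cut₃ : ∃[ r ] 𝟙 (s xor x c) + (𝟙 (p xor q) + r) ≡ 1
        cut₃ = let (M , sat) = through₃ in
          cut x rest M , tight₁ (ext (false ∷ false ∷ true ∷ M)) (PM-extend (false ∷ false ∷ true ∷ M) sat)

        cut₁₂₃ : ∃[ r ] 𝟙 (p xor x a) + (𝟙 (q xor x b) + (𝟙 (s xor x c) + r)) ≡ 1
        cut₁₂₃ = let (M , sat) = spike-star in cut x rest M , tight₁ (ext (true ∷ true ∷ true ∷ M))
          (Sat-extend (inj₂ (spike-same v)) refl refl refl (λ _ w≢v → sym (spike-other w≢v))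
            (true ∷ true ∷ true ∷ M) sat)

        build : ∀ w → w < 2 + n → (∀ {u} → Position u → u ≢ w → x u ≡ not (x w)) → Trivial (2 + n) x
        build w w< h = w , w< , λ u u< → h (position u u<)

        -- Here the contracted vertex is the lone one. If the corners agree, the cut is the one
        -- around the triangle, which the matching from the labelling with degree 3 crosses three
        -- times; otherwise the odd corner is alone in the whole graph.
        outside : (∀ w → w < n → w ≢ v → x w ≡ not β) → Corners p q s β → Trivial (2 + n) x
        outside h (equal p≡ q≡ s≡) = ⊥-elim
          (three-cross p q s p≡ q≡ s≡ (h a a<n a≢v) (h b b<n b≢v) (h c c<n c≢v) (proj₂ cut₁₂₃))
        outside h (lone₀ p≡ q≡ s≡) = build v (m≤n⇒m≤1+n (m<n⇒m<1+n v<n)) λ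
          { top             _   → trans s≡ (cong not (sym p≡))
          ; middle          _   → trans q≡ (cong not (sym p≡))
          ; pivot           v≢v → ⊥-elim (v≢v refl)
          ; (other w<n w≢v) _   → trans (h _ w<n w≢v) (cong not (sym p≡)) }
        outside h (lone₁ p≡ q≡ s≡) = build n (m≤n⇒m≤1+n (n<1+n n)) λ
          { top             _   → trans s≡ (cong not (sym q≡))
          ; middle          n≢n → ⊥-elim (n≢n refl)
          ; pivot           _   → trans p≡ (cong not (sym q≡))
          ; (other w<n w≢v) _   → trans (h _ w<n w≢v) (cong not (sym q≡)) }
        outside h (lone₂ p≡ q≡ s≡) = build (suc n) (n<1+n (suc n)) λ
          { top             s≢s → ⊥-elim (s≢s refl)
          ; middle          _   → trans q≡ (cong not (sym s≡))
          ; pivot           _   → trans p≡ (cong not (sym s≡))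
          ; (other w<n w≢v) _   → trans (h _ w<n w≢v) (cong not (sym s≡)) }

        -- Here an old vertex `w` is the lone one. If the corners differ, each of the two majority
        -- corners has a matching through it whose triangle edge crosses, so its outer neighbour has
        -- the majority colour `not β` and must be `w`. Two outer neighbours would then coincide,
        -- against `distinct-ends`.
        inside : ∀ w → w < n → w ≢ v → β ≡ not (x w) →
          (∀ u → u < n → u ≢ v → u ≢ w → x u ≡ not (x w)) → Corners p q s β → Trivial (2 + n) x
        inside w w<n w≢v β≡ h = go
          where
          forced : ∀ {u} → u < n → u ≢ v → x u ≡ not β → u ≡ w
          forced {u} u<n u≢v eq with u ≟ w
          ... | yes u≡w = u≡w
          ... | no u≢w  = ⊥-elim (opposite eq (trans (h u u<n u≢v u≢w) (sym β≡)) refl)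
          go : Corners p q s β → Trivial (2 + n) x
          go (equal p≡ q≡ s≡) = build w (m≤n⇒m≤1+n (m<n⇒m<1+n w<n)) λ
            { top             _   → trans s≡ β≡
            ; middle          _   → trans q≡ β≡
            ; pivot           _   → trans p≡ β≡
            ; (other u<n u≢v) u≢w → h _ u<n u≢v u≢w }
          go (lone₀ p≡ q≡ s≡) = ⊥-elim (proj₁ (proj₂ distinct-ends) (trans
            (forced b<n b≢v (trans (crossing-used q (x b) s p (opposite s≡ p≡) (proj₂ cut₂)) q≡))
            (sym (forced c<n c≢v (trans
              (crossing-used s (x c) p q (λ e → opposite q≡ p≡ (sym e)) (proj₂ cut₃)) s≡)))))
          go (lone₁ p≡ q≡ s≡) = ⊥-elim (proj₂ (proj₂ distinct-ends) (trans
            (forced a<n a≢v (trans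
              (crossing-used p (x a) q s (λ e → opposite s≡ q≡ (sym e)) (proj₂ cut₁)) p≡))
            (sym (forced c<n c≢v (trans
              (crossing-used s (x c) p q (opposite p≡ q≡) (proj₂ cut₃)) s≡)))))
          go (lone₂ p≡ q≡ s≡) = ⊥-elim (proj₁ distinct-ends (trans
            (forced a<n a≢v (trans (crossing-used p (x a) q s (opposite q≡ s≡) (proj₂ cut₁)) p≡))
            (sym (forced b<n b≢v (trans
              (crossing-used q (x b) s p (λ e → opposite p≡ s≡ (sym e)) (proj₂ cut₂)) q≡)))))

        trivial₁ : Trivial n x̂ → Trivial (2 + n) x
        trivial₁ (w , w<n , h) with w ≟ v
        ... | yes refl = outside
          (λ u u<n u≢v → trans (sym (recolour-other β x u≢v))
                               (trans (h u u<n u≢v) (cong not (recolour-same v β x))))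
          (corners p q s)
        ... | no w≢v = inside w w<n w≢v
          (trans (sym (recolour-same v β x))
                 (trans (h v v<n λ v≡w → w≢v (sym v≡w)) (cong not (recolour-other β x w≢v))))
          (λ u u<n u≢v u≢w → trans (sym (recolour-other β x u≢v))
                                   (trans (h u u<n u≢w) (cong not (recolour-other β x w≢v))))
          (corners p q s)

  IsBrick-inflated : IsBrick n es₀ → ∃[ M ] Sat n (spike v) es₀ M → IsBrick (2 + n) es₁
  IsBrick-inflated B (M , sat) = record
    { wellFormed = wellFormed₁
    ; connected  = connected₁
    ; covered    = covered₁
    ; tight      = λ x h → Cut.trivial₁ x h (IsBrick.tight B (Cut.x̂ x h) (Cut.tight₀ x h))
    ; triangle   = v , n , suc n , v–n , n–1+n , 1+n–v
    }
    where open Inflate B M sat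

module _ {n es v} (B : IsBrick n es) (I : Inflatable n es v) where

  private
    v<n = proj₁ I
    canon = cubic-star v n es (proj₁ (proj₂ I))

  IsBrick-triIns : IsBrick (2 + n) (E (triIns v (graph n es)))
  IsBrick-triIns with canon
  ... | a , b , c , rest , p , q , rest∌v =
    IsBrick-≈ (≈-sym q) (IsBrick-inflated v<n (IsBrick.wellFormed B₀) rest∌v B₀
      (proj₂ (proj₂ (Inflatable-≈ p I))))
    where B₀ = IsBrick-≈ p B

  Inflatable-triIns : ∀ {w} → w ≢ v → Inflatable n es w →
    Inflatable (2 + n) (E (triIns v (graph n es))) w
  Inflatable-triIns w≢v J with canon
  ... | a , b , c , rest , p , q , rest∌v =
    Inflatable-≈ (≈-sym q) (Inflatable-inflated v<n (IsBrick.wellFormed B₀) rest∌v w≢v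
      (Inflatable-≈ p J))
    where B₀ = IsBrick-≈ p B

  length-triIns : length (E (triIns v (graph n es))) ≡ 3 + length es
  length-triIns with canon
  ... | a , b , c , rest , p , q , _ =
    trans (length-≈ q) (cong (3 +_) (sym (length-≈ p)))

  total-triIns : ∀ {D : ℕ → ℕ → Bool} → (∀ k → D v k ≡ isOne k) → (∀ k → D n k ≡ isOne k) →
    (∀ k → D (suc n) k ≡ isOne k) →
    total (2 + n) D (E (triIns v (graph n es))) ≡ total n (relax v D) es
  total-triIns {D} Dv Dn D1+n with canon
  ... | a , b , c , rest , p , q , rest∌v = trans (total-≈ (2 + n) D q) (trans
    (total-inflated v<n (IsBrick.wellFormed (IsBrick-≈ p B)) rest∌v Dv Dn D1+n)
    (sym (total-≈ n (relax v D) p)))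

-- Renumbering by four vertices

shift : Edges → Edges
shift = map λ e → (4 + proj₁ e , 4 + proj₂ e)

up : ∀ es → EdgeLabels es → EdgeLabels (shift es)
up []       []      = []
up (e ∷ es) (b ∷ M) = b ∷ up es M

unshift : ∀ es → Fin (length (shift es)) → Fin (length es)
unshift (e ∷ es) F.zero    = F.zero
unshift (e ∷ es) (F.suc i) = F.suc (unshift es i)

reshift : ∀ es → Fin (length es) → Fin (length (shift es))
reshift (e ∷ es) F.zero    = F.zero
reshift (e ∷ es) (F.suc i) = F.suc (reshift es i)

lookup-up : ∀ es (M : EdgeLabels es) i → Vec.lookup (up es M) i ≡ Vec.lookup M (unshift es i)
lookup-up (e ∷ es) (b ∷ M) F.zero    = refl
lookup-up (e ∷ es) (b ∷ M) (F.suc i) = lookup-up es M i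

ends-shift : ∀ es i → let e = lookup es (unshift es i) in
  lookup (shift es) i ≡ (4 + proj₁ e , 4 + proj₂ e)
ends-shift (e ∷ es) F.zero    = refl
ends-shift (e ∷ es) (F.suc i) = ends-shift es i

ends-reshift : ∀ es i → let e = lookup es i in
  lookup (shift es) (reshift es i) ≡ (4 + proj₁ e , 4 + proj₂ e)
ends-reshift (e ∷ es) F.zero    = refl
ends-reshift (e ∷ es) (F.suc i) = ends-reshift es i

cnt-up : ∀ P es M → cnt P (shift es) (up es M) ≡ cnt (λ e → P (4 + proj₁ e , 4 + proj₂ e)) es M
cnt-up P []       []      = refl
cnt-up P (e ∷ es) (b ∷ M) = cong (_ +_) (cnt-up P es M)

deg-up : ∀ es M w → deg (shift es) (up es M) (4 + w) ≡ deg es M w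
deg-up es M w = cnt-up (λ e → incident e (4 + w)) es M

cut-up : ∀ x es M → cut x (shift es) (up es M) ≡ cut (λ w → x (4 + w)) es M
cut-up x es M = cnt-up _ es M

inc-up : ∀ es w → inc (shift es) (4 + w) ≡ inc es w
inc-up []       w = refl
inc-up (e ∷ es) w = cong (_ +_) (inc-up es w)

-- The bound `k < 4` in a form that computes: for a numeral it is proved by `λ _ → refl`.
Low : ℕ → Set
Low k = ∀ a → (4 + a ≡ᵇ k) ≡ false

inc-low : ∀ es {k} → Low k → inc (shift es) k ≡ 0
inc-low []       low = refl
inc-low (e ∷ es) low rewrite low (proj₁ e) | low (proj₂ e) = inc-low es low

deg-low : ∀ es {k} → Low k → ∀ M → deg (shift es) M k ≡ 0
deg-low es {k} low M = deg-inc0 (shift es) M k (inc-low es low)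

sumV-up : ∀ es (f : EdgeLabels (shift es) → ℕ) →
  sumV (length (shift es)) f ≡ sumV (length es) (λ M → f (up es M))
sumV-up []       f = refl
sumV-up (e ∷ es) f = sumB-cong λ b → sumV-up es λ M → f (b ∷ M)

-- In closed form these are 4m + 1, 4m + 2 and 4m, but the recursion makes a step by one rung
-- compute. An entering edge ends in the third vertex of the next path; after the last path both
-- entering edges end in u, hence `entry 0` is 0.
hub size end entry : ℕ → ℕ
hub zero    = 1
hub (suc m) = 4 + hub m
size zero    = 2
size (suc m) = 4 + size m
end zero    = 0
end (suc m) = 4 + end m
entry zero    = 0
entry (suc m) = 2

-- Ladders

-- The part of G't after the first few paths, with the vertices renumbered from 0; m paths remain,
-- end m is u, and hub m is u′.  The two edges from the removed part would end in 0 and entry m.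
ladder : ℕ → Edges
ladder zero    = (hub 0 , end 0) ∷ []
ladder (suc m) =
  (0 , 1) ∷ (1 , 2) ∷ (2 , 3) ∷ (hub (suc m) , 1) ∷ (hub (suc m) , 3) ∷
  (0 , 4) ∷ (3 , 4 + entry m) ∷ shift (ladder m)

-- The ladder with its removed part contracted into the hub. For `m` equal to `suc t` this is G't,
-- where the edges from u′ to the first and the third vertex of the first path act as the entering
-- edges; for 0 it consists of three parallel edges.
capped : ℕ → Edges
capped m = (hub m , 0) ∷ (hub m , entry m) ∷ ladder m

-- The vertices 4 and 5 stand for the hub and for the next rung.
localRung : Edges
localRung = (0 , 1) ∷ (1 , 2) ∷ (2 , 3) ∷ (4 , 1) ∷ (4 , 3) ∷ (0 , 5) ∷ (3 , 5) ∷ []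

extra : ℕ → Bool → Bool → ℕ → ℕ → ℕ
extra m c d h w = 𝟙 (c ∧ (0 ≡ᵇ w)) + 𝟙 (d ∧ (entry m ≡ᵇ w)) + (if hub m ≡ᵇ w then h else 0)

-- The degrees when the two edges into the ladder have labels c and d and h edges at the hub are
-- used outside the ladder.
load : ∀ m → Bool → Bool → ℕ → EdgeLabels (ladder m) → ℕ → ℕ
load m c d h M w = extra m c d h w + deg (ladder m) M w

rungLoad : Bool → Bool → EdgeLabels localRung → ℕ → ℕ
rungLoad c d L k = 𝟙 (c ∧ (0 ≡ᵇ k)) + 𝟙 (d ∧ (2 ≡ᵇ k)) + 0 + deg localRung L k

load-above : ∀ m c d h e₁ e₂ e₃ q₂ q₄ o₁ o₄ M w →
  load (suc m) c d h (e₁ ∷ e₂ ∷ e₃ ∷ q₂ ∷ q₄ ∷ o₁ ∷ o₄ ∷ up (ladder m) M) (4 + w) ≡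
  load m o₁ o₄ (h + (𝟙 q₂ + 𝟙 q₄)) M w
load-above m c d h e₁ e₂ e₃ q₂ q₄ o₁ o₄ M w
  rewrite ∧-zeroʳ c | ∧-zeroʳ d | ∧-zeroʳ e₁ | ∧-zeroʳ e₂ | ∧-zeroʳ e₃
        | deg-up (ladder m) M w with hub m ≡ᵇ w
... | true  rewrite ∧-identityʳ q₂ | ∧-identityʳ q₄ =
  lemma h (𝟙 q₂) (𝟙 q₄) (𝟙 (o₁ ∧ (0 ≡ᵇ w))) (𝟙 (o₄ ∧ (entry m ≡ᵇ w))) (deg (ladder m) M w)
  where
  lemma : ∀ h a b x y z → h + (a + (b + (x + (y + z)))) ≡ x + y + (h + (a + b)) + z
  lemma = solve-∀
... | false rewrite ∧-zeroʳ q₂ | ∧-zeroʳ q₄ =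
  lemma (𝟙 (o₁ ∧ (0 ≡ᵇ w))) (𝟙 (o₄ ∧ (entry m ≡ᵇ w))) (deg (ladder m) M w)
  where
  lemma : ∀ x y z → x + (y + z) ≡ x + y + 0 + z
  lemma = solve-∀

module _ (m : ℕ) (c d : Bool) (h : ℕ) (e₁ e₂ e₃ q₂ q₄ o₁ o₄ : Bool)
         (M : EdgeLabels (shift (ladder m))) where
  private
    L : EdgeLabels localRung
    L = e₁ ∷ e₂ ∷ e₃ ∷ q₂ ∷ q₄ ∷ o₁ ∷ o₄ ∷ []
    N : EdgeLabels (ladder (suc m))
    N = e₁ ∷ e₂ ∷ e₃ ∷ q₂ ∷ q₄ ∷ o₁ ∷ o₄ ∷ M

  load-0 : load (suc m) c d h N 0 ≡ rungLoad c d L 0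
  load-0 rewrite deg-low (ladder m) {0} (λ _ → refl) M = refl

  load-1 : load (suc m) c d h N 1 ≡ rungLoad c d L 1
  load-1 rewrite deg-low (ladder m) {1} (λ _ → refl) M = refl

  load-2 : load (suc m) c d h N 2 ≡ rungLoad c d L 2
  load-2 rewrite deg-low (ladder m) {2} (λ _ → refl) M = refl

  load-3 : load (suc m) c d h N 3 ≡ rungLoad c d L 3
  load-3 rewrite deg-low (ladder m) {3} (λ _ → refl) M = refl

hub<size : ∀ m → hub m < size m
hub<size zero    = s≤s (s≤s z≤n)
hub<size (suc m) = s≤s (s≤s (s≤s (s≤s (hub<size m))))

0<size : ∀ m → 0 < size m
0<size zero    = s≤s z≤n
0<size (suc m) = s≤s z≤n

entry<size : ∀ m → entry m < size m
entry<size zero    = s≤s z≤n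
entry<size (suc m) = s≤s (s≤s (s≤s z≤n))

end<size : ∀ m → end m < size m
end<size zero    = s≤s z≤n
end<size (suc m) = s≤s (s≤s (s≤s (s≤s (end<size m))))

0≢hub : ∀ m → (0 ≡ᵇ hub m) ≡ false
0≢hub zero    = refl
0≢hub (suc m) = refl

entry≢hub : ∀ m → (entry m ≡ᵇ hub m) ≡ false
entry≢hub zero    = refl
entry≢hub (suc m) = refl

end≢hub : ∀ m → (end m ≡ᵇ hub m) ≡ false
end≢hub zero    = refl
end≢hub (suc m) = end≢hub m

deg-capped : ∀ m a b M w → deg (capped m) (a ∷ b ∷ M) w ≡ load m a b (𝟙 a + 𝟙 b) M w
deg-capped m a b M w with hub m ≡ᵇ w in eq
... | true with refl ← ≡ᵇ-true {hub m} {w} eq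
  rewrite 0≢hub m | entry≢hub m | ∧-zeroʳ a | ∧-zeroʳ b | ∧-identityʳ a | ∧-identityʳ b =
  sym (+-assoc (𝟙 a) (𝟙 b) _)
... | false = lemma (𝟙 (a ∧ (0 ≡ᵇ w))) (𝟙 (b ∧ (entry m ≡ᵇ w))) (deg (ladder m) M w)
  where
  lemma : ∀ x y z → x + (y + z) ≡ x + y + 0 + z
  lemma = solve-∀

-- Counting edge sets with prescribed degrees

opaque
  states : (m : ℕ) → (ℕ → ℕ → Bool) → Bool → Bool → ℕ → ℕ
  states m D c d h = sumV (length (ladder m)) λ M → 𝟙 (allB (size m) λ w → D w (load m c d h M w))

rungOK : (ℕ → ℕ → Bool) → Bool → Bool → EdgeLabels localRung → Bool
rungOK D c d L = D 0 (rungLoad c d L 0) ∧ D 1 (rungLoad c d L 1) ∧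
                 D 2 (rungLoad c d L 2) ∧ D 3 (rungLoad c d L 3)

rungTerm : (ℕ → ℕ → Bool) → Bool → Bool → ℕ → (Bool → Bool → ℕ → ℕ) → EdgeLabels localRung → ℕ
rungTerm D c d h f L@(_ ∷ _ ∷ _ ∷ q₂ ∷ q₄ ∷ o₁ ∷ o₄ ∷ []) =
  if rungOK D c d L then f o₁ o₄ (h + (𝟙 q₂ + 𝟙 q₄)) else 0

sumV-∧ : ∀ k a b c d (f : Vec Bool k → Bool) → sumV k (λ M → 𝟙 (a ∧ b ∧ c ∧ d ∧ f M)) ≡
  (if a ∧ b ∧ c ∧ d then sumV k (λ M → 𝟙 (f M)) else 0)
sumV-∧ k false b     c     d     f = sumV-zero k
sumV-∧ k true  false c     d     f = sumV-zero k
sumV-∧ k true  true  false d     f = sumV-zero k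
sumV-∧ k true  true  true  false f = sumV-zero k
sumV-∧ k true  true  true  true  f = refl

sumV-++ : ∀ j k (f : Vec Bool (j + k) → ℕ) →
  sumV (j + k) f ≡ sumV j λ L → sumV k λ M → f (L Vec.++ M)
sumV-++ zero    k f = refl
sumV-++ (suc j) k f =
  cong₂ _+_ (sumV-++ j k λ M → f (true ∷ M)) (sumV-++ j k λ M → f (false ∷ M))

opaque
  unfolding states

  -- A transfer-matrix step: the remaining ladder sees the rung only through the labels of the two
  -- outgoing edges and the number of used hub edges.
  states-step : ∀ m D c d h →
    states (suc m) D c d h ≡ sumV 7 (rungTerm D c d h (states m (λ w → D (4 + w))))
  states-step m D c d h = trans
    (sumV-++ 7 k valid)
    (sumV-cong 7 {λ L → sumV k λ M → valid (L Vec.++ M)}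
                  {rungTerm D c d h (states m λ w → D (4 + w))} branch)
    where
    open ≡-Reasoning
    k : ℕ
    k = length (shift (ladder m))
    valid : EdgeLabels (ladder (suc m)) → ℕ
    valid M = 𝟙 (allB (size (suc m)) λ w → D w (load (suc m) c d h M w))
    branch : ∀ L → sumV k (λ M → valid (L Vec.++ M)) ≡
      rungTerm D c d h (states m (λ w → D (4 + w))) L
    branch L@(e₁ ∷ e₂ ∷ e₃ ∷ q₂ ∷ q₄ ∷ o₁ ∷ o₄ ∷ []) = begin
      sumV k (λ M → valid (L Vec.++ M))
        ≡⟨ sumV-up (ladder m) (λ M → valid (L Vec.++ M)) ⟩
      sumV (length (ladder m)) (λ M → valid (L Vec.++ up (ladder m) M))
        ≡⟨ sumV-cong (length (ladder m)) (λ M → cong 𝟙 (pointwise M)) ⟩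
      sumV (length (ladder m)) (λ M → 𝟙 (D 0 (l 0) ∧ D 1 (l 1) ∧ D 2 (l 2) ∧ D 3 (l 3) ∧ above M))
        ≡⟨ sumV-∧ (length (ladder m)) (D 0 (l 0)) (D 1 (l 1)) (D 2 (l 2)) (D 3 (l 3)) above ⟩
      rungTerm D c d h (states m (λ w → D (4 + w))) L ∎
      where
      l : ℕ → ℕ
      l = rungLoad c d L
      above : EdgeLabels (ladder m) → Bool
      above M = allB (size m) λ w → D (4 + w) (load m o₁ o₄ (h + (𝟙 q₂ + 𝟙 q₄)) M w)
      pointwise : ∀ M → allB (size (suc m)) (λ w → D w (load (suc m) c d h (L Vec.++ up (ladder m) M) w)) ≡
        D 0 (l 0) ∧ D 1 (l 1) ∧ D 2 (l 2) ∧ D 3 (l 3) ∧ above M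
      pointwise M =
        cong₂ _∧_ (cong (D 0) (load-0 m c d h e₁ e₂ e₃ q₂ q₄ o₁ o₄ (up (ladder m) M)))
        (cong₂ _∧_ (cong (D 1) (load-1 m c d h e₁ e₂ e₃ q₂ q₄ o₁ o₄ (up (ladder m) M)))
        (cong₂ _∧_ (cong (D 2) (load-2 m c d h e₁ e₂ e₃ q₂ q₄ o₁ o₄ (up (ladder m) M)))
        (cong₂ _∧_ (cong (D 3) (load-3 m c d h e₁ e₂ e₃ q₂ q₄ o₁ o₄ (up (ladder m) M)))
        (allB-cong (size m) λ w _ →
          cong (D (4 + w)) (load-above m c d h e₁ e₂ e₃ q₂ q₄ o₁ o₄ M w)))))

opaque
  unfolding states

  states-overused : ∀ m D c d h → (∀ k → D (hub m) k ≡ isOne k) → states m D c d (2 + h) ≡ 0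
  states-overused m D c d h Dhub =
    trans (sumV-cong (length (ladder m)) λ M → cong 𝟙 (never M)) (sumV-zero (length (ladder m)))
    where
    overload : ∀ x y → isOne (x + (2 + h) + y) ≡ false
    overload zero    y = refl
    overload (suc x) y rewrite +-suc x (suc h) = refl
    never : ∀ M → allB (size m) (λ w → D w (load m c d (2 + h) M w)) ≡ false
    never M with allB (size m) (λ w → D w (load m c d (2 + h) M w)) in eq
    ... | false = refl
    ... | true  with bad ← allB-sound (size m) _ eq (hub m) (hub<size m)
      rewrite Dhub (load m c d (2 + h) M (hub m)) | ≡ᵇ-refl (hub m) =
      ⊥-elim (true≢false bad (overload (𝟙 (c ∧ (0 ≡ᵇ hub m)) + 𝟙 (d ∧ (entry m ≡ᵇ hub m))) _))

opaque
  unfolding states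

  total-capped : ∀ m D → total (size m) D (capped m) ≡
    sumB λ a → sumB λ b → states m D a b (𝟙 a + 𝟙 b)
  total-capped m D = sumB-cong λ a → sumB-cong λ b → sumV-cong (length (ladder m)) λ M →
    cong 𝟙 (allB-cong (size m) λ w _ → cong (D w) (deg-capped m a b M w))

rungTerm-cong : ∀ D c d h {f g : Bool → Bool → ℕ → ℕ} → (∀ o₁ o₄ k → f o₁ o₄ k ≡ g o₁ o₄ k) →
  sumV 7 (rungTerm D c d h f) ≡ sumV 7 (rungTerm D c d h g)
rungTerm-cong D c d h {f} {g} f≗g =
  sumV-cong 7 {rungTerm D c d h f} {rungTerm D c d h g} term
  where
  term : ∀ L → rungTerm D c d h f L ≡ rungTerm D c d h g L
  term L@(_ ∷ _ ∷ _ ∷ q₂ ∷ q₄ ∷ o₁ ∷ o₄ ∷ []) with rungOK D c d L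
  ... | true  = f≗g o₁ o₄ (h + (𝟙 q₂ + 𝟙 q₄))
  ... | false = refl

-- Only the number k of completions from the state in which no edge is used grows with the ladder;
-- the states with values 0 are excluded by parity or because the hub is used twice.
values : ℕ → Bool → Bool → ℕ → ℕ
values k false false 0 = k
values k true  true  0 = 1
values k true  false 1 = 1
values k false true  1 = 1
values k _     _     _ = 0

values-overused : ∀ k c d h → values k c d (2 + h) ≡ 0
values-overused k true  true  h = refl
values-overused k true  false h = refl
values-overused k false true  h = refl
values-overused k false false h = refl

allV : ∀ n → (Vec Bool n → Bool) → Bool
allV zero    f = f []
allV (suc n) f = allV n (λ v → f (true ∷ v)) ∧ allV n (λ v → f (false ∷ v))

allV-sound : ∀ n f → allV n f ≡ true → ∀ v → f v ≡ true
allV-sound zero    f eq []          = eq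
allV-sound (suc n) f eq (true ∷ v)  = allV-sound n (λ v → f (true ∷ v)) (proj₁ (∧-split eq)) v
allV-sound (suc n) f eq (false ∷ v) = allV-sound n (λ v → f (false ∷ v))
  (proj₂ (∧-split {allV n λ v → f (true ∷ v)} eq)) v

lax : Bool → ℕ → Bool
lax b k = if b then oneOrThree k else isOne k

-- The arguments f₂, f₄ and fᵤ say whether a triangle is inserted at
-- the second and the fourth vertex of the last path and at u.
module _ (f₂ f₄ fᵤ : Bool) where

  flags : ℕ → ℕ → Bool
  flags zero 1 = f₂
  flags zero 3 = f₄
  flags zero 4 = fᵤ
  flags zero _ = false
  flags (suc m) 0 = false
  flags (suc m) 1 = true
  flags (suc m) 2 = false
  flags (suc m) 3 = true
  flags (suc m) (suc (suc (suc (suc w)))) = flags m w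

  topFlags : ℕ → ℕ → Bool
  topFlags m 0 = true
  topFlags m 2 = true
  topFlags m w = flags m w

flags-hub : ∀ f₂ f₄ fᵤ m → flags f₂ f₄ fᵤ m (hub (suc m)) ≡ false
flags-hub f₂ f₄ fᵤ zero    = refl
flags-hub f₂ f₄ fᵤ (suc m) = flags-hub f₂ f₄ fᵤ m


-- All selections and states at the last path form one Boolean, decided by evaluation: 64 cases with
-- 256 labellings each. One bit for `h` is enough because `states-overused` covers the larger
-- values.
endClaim : Vec Bool 6 → Bool
endClaim (f₂ ∷ f₄ ∷ fᵤ ∷ c ∷ d ∷ h ∷ []) =
  states 1 (λ w → lax (flags f₂ f₄ fᵤ 0 w)) c d (𝟙 h) ≡ᵇ
  values (3 + (𝟙 f₂ + 𝟙 f₄ + 𝟙 fᵤ)) c d (𝟙 h)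

opaque
  unfolding states

  endClaim-holds : allV 6 endClaim ≡ true
  endClaim-holds = refl

module Count (f₂ f₄ fᵤ : Bool) where

  demand topDemand : ℕ → ℕ → ℕ → Bool
  demand    m w = lax (flags f₂ f₄ fᵤ m w)
  topDemand m w = lax (topFlags f₂ f₄ fᵤ m w)

  selected : ℕ
  selected = 𝟙 f₂ + 𝟙 f₄ + 𝟙 fᵤ

  -- From the empty state three completions have degree 1 everywhere, and each selected vertex adds
  -- one with degree 3 there.
  values-end : ∀ c d h → states 1 (demand 0) c d (𝟙 h) ≡ values (3 + selected) c d (𝟙 h)
  values-end c d h = ≡ᵇ-true (allV-sound 6 endClaim endClaim-holds (f₂ ∷ f₄ ∷ fᵤ ∷ c ∷ d ∷ h ∷ []))

  -- From the empty state `rung₀₀` returns to the empty state and contributes `k`. Five other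
  -- labellings of the rung lead to states of value 1: three with degree 1 at all four vertices, and
  -- one with degree 3 at each of the second and the fourth.
  values-rung : ∀ m k c d h →
    sumV 7 (rungTerm (demand (suc m)) c d (𝟙 h) (values k)) ≡ values (5 + k) c d (𝟙 h)
  values-rung m k false false false = lemma k
    where
    lemma : ∀ k → 2 + (k + 0 + 3) ≡ 5 + k
    lemma = solve-∀
  values-rung m k false false true  = refl
  values-rung m k false true  false = refl
  values-rung m k false true  true  = refl
  values-rung m k true  false false = refl
  values-rung m k true  false true  = refl
  values-rung m k true  true  false = refl
  values-rung m k true  true  true  = refl

  any-use : ∀ m {k} → (∀ c d b → states (suc m) (demand m) c d (𝟙 b) ≡ values k c d (𝟙 b)) →
    ∀ c d h → states (suc m) (demand m) c d h ≡ values k c d h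
  any-use m eq c d zero          = eq c d false
  any-use m eq c d (suc zero)    = eq c d true
  any-use m eq c d (suc (suc h)) = trans
    (states-overused (suc m) (demand m) c d h λ k → cong (λ f → lax f k) (flags-hub f₂ f₄ fᵤ m))
    (sym (values-overused _ c d h))

  states-values : ∀ m c d h → states (suc m) (demand m) c d h ≡ values (3 + selected + 5 * m) c d h
  states-values zero    = any-use 0 λ c d b → trans (values-end c d b)
    (cong (λ k → values k c d (𝟙 b)) (sym (+-identityʳ (3 + selected))))
  states-values (suc m) = any-use (suc m) λ c d b →
    trans (states-step (suc m) (demand (suc m)) c d (𝟙 b)) (trans
      (rungTerm-cong (demand (suc m)) c d (𝟙 b) (states-values m)) (trans
      (values-rung m (3 + selected + 5 * m) c d b)
      (cong (λ k → values k c d (𝟙 b)) (lemma selected m))))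
    where
    lemma : ∀ s m → 5 + (3 + s + 5 * m) ≡ 3 + s + 5 * suc m
    lemma = solve-∀

  -- On the first path the first and the third vertex are selected too. Degree 3 there requires the
  -- edge to the hub, so only the states with exactly one cap edge gain a labelling; two cap edges
  -- overuse the hub.
  topValues : ℕ → Bool → Bool → ℕ
  topValues k true  true  = 0
  topValues k true  false = 2
  topValues k false true  = 2
  topValues k false false = 5 + k

  topValues-rung : ∀ m k a b →
    sumV 7 (rungTerm (topDemand (suc m)) a b (𝟙 a + 𝟙 b) (values k)) ≡ topValues k a b
  topValues-rung m k true  true  = refl
  topValues-rung m k true  false = refl
  topValues-rung m k false true  = refl
  topValues-rung m k false false = lemma k
    where
    lemma : ∀ k → 2 + (k + 0 + 3) ≡ 5 + k
    lemma = solve-∀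

  total-ladder : ∀ m → total (size (2 + m)) (topDemand (suc m)) (capped (2 + m)) ≡
    12 + selected + 5 * m
  total-ladder m = trans (total-capped (2 + m) (topDemand (suc m))) (trans
    (sumB-cong {λ a → sumB λ b → states (2 + m) (topDemand (suc m)) a b (𝟙 a + 𝟙 b)}
               {λ a → sumB λ b → topValues k a b} λ a →
     sumB-cong {λ b → states (2 + m) (topDemand (suc m)) a b (𝟙 a + 𝟙 b)}
               {λ b → topValues k a b} λ b →
       trans (states-step (suc m) (topDemand (suc m)) a b (𝟙 a + 𝟙 b)) (trans
         (rungTerm-cong (topDemand (suc m)) a b (𝟙 a + 𝟙 b) (states-values m))
         (topValues-rung m k a b)))
    (lemma selected m))
    where
    k = 3 + selected + 5 * m
    lemma : ∀ s m → 0 + 2 + (2 + (5 + (3 + s + 5 * m))) ≡ 12 + s + 5 * m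
    lemma = solve-∀

-- Labellings assembled rung by rung

Fits : (m : ℕ) → Bool → Bool → ℕ → (ℕ → ℕ) → EdgeLabels (ladder m) → Set
Fits m c d h g M = ∀ v → v < size m → load m c d h M v ≡ g v

RungFits : Bool → Bool → (ℕ → ℕ) → EdgeLabels localRung → Set
RungFits c d g L = rungLoad c d L 0 ≡ g 0 × rungLoad c d L 1 ≡ g 1 ×
                   rungLoad c d L 2 ≡ g 2 × rungLoad c d L 3 ≡ g 3

addRung : ∀ m → EdgeLabels localRung → EdgeLabels (ladder m) → EdgeLabels (ladder (suc m))
addRung m L M = L Vec.++ up (ladder m) M

Fits-addRung : ∀ m c d h L g M → RungFits c d g L →
  Fits m (Vec.lookup L (5 F.↑ʳ F.zero)) (Vec.lookup L (6 F.↑ʳ F.zero))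
    (h + (𝟙 (Vec.lookup L (3 F.↑ʳ F.zero)) + 𝟙 (Vec.lookup L (4 F.↑ʳ F.zero)))) (λ v → g (4 + v)) M →
  Fits (suc m) c d h g (addRung m L M)
Fits-addRung m c d h (e₁ ∷ e₂ ∷ e₃ ∷ q₂ ∷ q₄ ∷ o₁ ∷ o₄ ∷ []) g M (g₀ , g₁ , g₂ , g₃) fits = λ
  { 0 _ → trans (load-0 m c d h e₁ e₂ e₃ q₂ q₄ o₁ o₄ (up (ladder m) M)) g₀
  ; 1 _ → trans (load-1 m c d h e₁ e₂ e₃ q₂ q₄ o₁ o₄ (up (ladder m) M)) g₁
  ; 2 _ → trans (load-2 m c d h e₁ e₂ e₃ q₂ q₄ o₁ o₄ (up (ladder m) M)) g₂
  ; 3 _ → trans (load-3 m c d h e₁ e₂ e₃ q₂ q₄ o₁ o₄ (up (ladder m) M)) g₃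
  ; (suc (suc (suc (suc v)))) (s≤s (s≤s (s≤s (s≤s v<)))) →
      trans (load-above m c d h e₁ e₂ e₃ q₂ q₄ o₁ o₄ M v) (fits v v<) }

Fits⇒Sat : ∀ m a b g M → Fits m a b (𝟙 a + 𝟙 b) g M → Sat (size m) g (capped m) (a ∷ b ∷ M)
Fits⇒Sat m a b g M fits v v< = trans (deg-capped m a b M v) (fits v v<)

Sat⇒Fits : ∀ m a b g M → Sat (size m) g (capped m) (a ∷ b ∷ M) → Fits m a b (𝟙 a + 𝟙 b) g M
Sat⇒Fits m a b g M sat v v< = trans (sym (deg-capped m a b M v)) (sat v v<)

hub-load : ∀ m c d h g M → Fits m c d h g M → h + deg (ladder m) M (hub m) ≡ g (hub m)
hub-load m c d h g M fits = trans (sym load-hub) (fits (hub m) (hub<size m))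
  where
  load-hub : load m c d h M (hub m) ≡ h + deg (ladder m) M (hub m)
  load-hub rewrite 0≢hub m | entry≢hub m | ≡ᵇ-refl (hub m) | ∧-zeroʳ c | ∧-zeroʳ d = refl

-- Capped ladders are bricks

-- The subscripts are the labels of the two edges to the next rung. Together with the cap edges
-- chosen in the lifts below, these are five perfect matchings of the wheel with five spokes, and
-- they extend every matching of the contraction; a primed variant differs from its companion only
-- on the wheel.
rung₁₀ rung₁₀′ rung₀₁ rung₀₁′ rung₀₀ : EdgeLabels localRung
rung₁₀ = false ∷ true ∷ false ∷ false ∷ true ∷ true ∷ false ∷ []
rung₁₀′ = false ∷ false ∷ true ∷ true ∷ false ∷ true ∷ false ∷ []
rung₀₁ = true ∷ false ∷ false ∷ false ∷ false ∷ false ∷ true ∷ []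
rung₀₁′ = false ∷ true ∷ false ∷ false ∷ false ∷ false ∷ true ∷ []
rung₀₀ = true ∷ false ∷ true ∷ false ∷ false ∷ false ∷ false ∷ []

lift₁₀ lift₁₀′ lift₀₁ lift₀₁′ lift₀₀ : ∀ m → EdgeLabels (ladder m) → EdgeLabels (capped (suc m))
lift₁₀ m M = false ∷ false ∷ addRung m rung₁₀ M
lift₁₀′ m M = false ∷ false ∷ addRung m rung₁₀′ M
lift₀₁ m M = false ∷ true ∷ addRung m rung₀₁ M
lift₀₁′ m M = true ∷ false ∷ addRung m rung₀₁′ M
lift₀₀ m M = false ∷ false ∷ addRung m rung₀₀ M

PM : ∀ m → EdgeLabels (capped m) → Set
PM m = Sat (size m) one (capped m)

module _ (m : ℕ) (M : EdgeLabels (ladder m)) where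

  PM-lift₁₀ : Fits m true false 1 one M → PM (suc m) (lift₁₀ m M)
  PM-lift₁₀ fits = Fits⇒Sat (suc m) false false one (addRung m rung₁₀ M)
    (Fits-addRung m false false 0 rung₁₀ one M (refl , refl , refl , refl) fits)

  PM-lift₁₀′ : Fits m true false 1 one M → PM (suc m) (lift₁₀′ m M)
  PM-lift₁₀′ fits = Fits⇒Sat (suc m) false false one (addRung m rung₁₀′ M)
    (Fits-addRung m false false 0 rung₁₀′ one M (refl , refl , refl , refl) fits)

  PM-lift₀₁ : Fits m false true 1 one M → PM (suc m) (lift₀₁ m M)
  PM-lift₀₁ fits = Fits⇒Sat (suc m) false true one (addRung m rung₀₁ M)
    (Fits-addRung m false true 1 rung₀₁ one M (refl , refl , refl , refl) fits)

  PM-lift₀₁′ : Fits m false true 1 one M → PM (suc m) (lift₀₁′ m M)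
  PM-lift₀₁′ fits = Fits⇒Sat (suc m) true false one (addRung m rung₀₁′ M)
    (Fits-addRung m true false 1 rung₀₁′ one M (refl , refl , refl , refl) fits)

  PM-lift₀₀ : Fits m false false 0 one M → PM (suc m) (lift₀₀ m M)
  PM-lift₀₀ fits = Fits⇒Sat (suc m) false false one (addRung m rung₀₀ M)
    (Fits-addRung m false false 0 rung₀₀ one M (refl , refl , refl , refl) fits)

finish₀₁ : ∀ m → EdgeLabels (ladder m)
finish₀₁ zero    = false ∷ []
finish₀₁ (suc m) = addRung m rung₀₁ (finish₀₁ m)

finish₀₁-fits : ∀ m → Fits m false true 1 one (finish₀₁ m)
finish₀₁-fits zero 0 _ = refl
finish₀₁-fits zero 1 _ = refl
finish₀₁-fits zero (suc (suc v)) (s≤s (s≤s ()))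
finish₀₁-fits (suc m) = Fits-addRung m false true 1 rung₀₁ one (finish₀₁ m)
  (refl , refl , refl , refl) (finish₀₁-fits m)

finish₁₀ : ∀ m → EdgeLabels (ladder m)
finish₁₀ zero    = false ∷ []
finish₁₀ (suc m) = addRung m rung₀₁′ (finish₀₁ m)

finish₁₀-fits : ∀ m → Fits m true false 1 one (finish₁₀ m)
finish₁₀-fits zero 0 _ = refl
finish₁₀-fits zero 1 _ = refl
finish₁₀-fits zero (suc (suc v)) (s≤s (s≤s ()))
finish₁₀-fits (suc m) = Fits-addRung m true false 1 rung₀₁′ one (finish₀₁ m)
  (refl , refl , refl , refl) (finish₀₁-fits m)

spine : ∀ m → EdgeLabels (ladder m)
spine zero    = true ∷ []
spine (suc m) = addRung m rung₀₀ (spine m)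

spine-fits : ∀ m → Fits m false false 0 one (spine m)
spine-fits zero 0 _ = refl
spine-fits zero 1 _ = refl
spine-fits zero (suc (suc v)) (s≤s (s≤s ()))
spine-fits (suc m) = Fits-addRung m false false 0 rung₀₀ one (spine m)
  (refl , refl , refl , refl) (spine-fits m)

-- The last edge of `spine` joins the hub to `end m`. This ties a vertex at the far end of the
-- ladder to the colour of the hub.
spine-cut : ∀ m y → cut y (ladder m) (spine m) ≡ 0 → y (end m) ≡ y (hub m)
spine-cut zero    y eq with y 0 | y 1
... | true  | true  = refl
... | false | false = refl
spine-cut (suc m) y eq = spine-cut m (λ v → y (4 + v)) (trans (sym (cut-up y (ladder m) (spine m)))
  (m+n≡0⇒n≡0 (𝟙 (y 2 xor y 3)) (m+n≡0⇒n≡0 (𝟙 (y 0 xor y 1)) eq)))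

rungOut rungAbsorb : EdgeLabels localRung
rungOut    = false ∷ true ∷ false ∷ false ∷ false ∷ true ∷ true ∷ []
rungAbsorb = false ∷ false ∷ false ∷ true ∷ false ∷ false ∷ true ∷ []

-- Three of its edges leave the first rung and the hub, so these five vertices are no tight cut.
spread₃ : ∀ m → EdgeLabels (ladder (2 + m))
spread₃ m = addRung (suc m) rungOut (addRung m rungAbsorb (finish₀₁ m))

spread₃-PM : ∀ m → PM (2 + m) (false ∷ false ∷ spread₃ m)
spread₃-PM m = Fits⇒Sat (2 + m) false false one (spread₃ m)
  (Fits-addRung (suc m) false false 0 rungOut one (addRung m rungAbsorb (finish₀₁ m))
    (refl , refl , refl , refl)
    (Fits-addRung m true true 0 rungAbsorb one (finish₀₁ m) (refl , refl , refl , refl) (finish₀₁-fits m)))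

data CapUse : Bool → Bool → Set where
  via₁₀ : CapUse true false
  via₀₁ : CapUse false true
  via₀₀ : CapUse false false

capUse : ∀ m a b M → PM m (a ∷ b ∷ M) → CapUse a b
capUse m true  false M _   = via₁₀
capUse m false true  M _   = via₀₁
capUse m false false M _   = via₀₀
capUse m true  true  M sat with () ← hub-load m true true 2 one M (Sat⇒Fits m true true one M sat)

capped-covered : ∀ m i → ∃[ M ] PM m M × Vec.lookup M i ≡ true
capped-covered zero F.zero =
  true ∷ false ∷ finish₁₀ 0 , Fits⇒Sat 0 true false one (finish₁₀ 0) (finish₁₀-fits 0) , refl
capped-covered zero (F.suc F.zero) =
  false ∷ true ∷ finish₀₁ 0 , Fits⇒Sat 0 false true one (finish₀₁ 0) (finish₀₁-fits 0) , refl
capped-covered zero (F.suc (F.suc F.zero)) =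
  false ∷ false ∷ spine 0 , Fits⇒Sat 0 false false one (spine 0) (spine-fits 0) , refl
capped-covered (suc m) F.zero =
  lift₀₁′ m (finish₀₁ m) , PM-lift₀₁′ m (finish₀₁ m) (finish₀₁-fits m) , refl
capped-covered (suc m) (F.suc F.zero) =
  lift₀₁ m (finish₀₁ m) , PM-lift₀₁ m (finish₀₁ m) (finish₀₁-fits m) , refl
capped-covered (suc m) (F.suc (F.suc F.zero)) =
  lift₀₁ m (finish₀₁ m) , PM-lift₀₁ m (finish₀₁ m) (finish₀₁-fits m) , refl
capped-covered (suc m) (F.suc (F.suc (F.suc F.zero))) =
  lift₁₀ m (finish₁₀ m) , PM-lift₁₀ m (finish₁₀ m) (finish₁₀-fits m) , refl
capped-covered (suc m) (F.suc (F.suc (F.suc (F.suc F.zero)))) =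
  lift₁₀′ m (finish₁₀ m) , PM-lift₁₀′ m (finish₁₀ m) (finish₁₀-fits m) , refl
capped-covered (suc m) (F.suc (F.suc (F.suc (F.suc (F.suc F.zero))))) =
  lift₁₀′ m (finish₁₀ m) , PM-lift₁₀′ m (finish₁₀ m) (finish₁₀-fits m) , refl
capped-covered (suc m) (F.suc (F.suc (F.suc (F.suc (F.suc (F.suc F.zero)))))) =
  lift₁₀ m (finish₁₀ m) , PM-lift₁₀ m (finish₁₀ m) (finish₁₀-fits m) , refl
capped-covered (suc m) (F.suc (F.suc (F.suc (F.suc (F.suc (F.suc (F.suc F.zero))))))) =
  lift₁₀ m (finish₁₀ m) , PM-lift₁₀ m (finish₁₀ m) (finish₁₀-fits m) , refl
capped-covered (suc m) (F.suc (F.suc (F.suc (F.suc (F.suc (F.suc (F.suc (F.suc F.zero)))))))) =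
  lift₀₁ m (finish₀₁ m) , PM-lift₀₁ m (finish₀₁ m) (finish₀₁-fits m) , refl
capped-covered (suc m) (F.suc (F.suc (F.suc (F.suc (F.suc (F.suc (F.suc (F.suc (F.suc i)))))))))
  with capped-covered m (F.suc (F.suc (unshift (ladder m) i)))
... | a ∷ b ∷ M , sat , on with capUse m a b M sat | trans (lookup-up (ladder m) M i) on
...   | via₁₀ | on′ = lift₁₀ m M , PM-lift₁₀ m M (Sat⇒Fits m true false one M sat) , on′
...   | via₀₁ | on′ = lift₀₁ m M , PM-lift₀₁ m M (Sat⇒Fits m false true one M sat) , on′
...   | via₀₀ | on′ = lift₀₀ m M , PM-lift₀₀ m M (Sat⇒Fits m false false one M sat) , on′

Loopless : Edges → Set
Loopless es = ∀ i → proj₁ (lookup es i) ≢ proj₂ (lookup es i)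

capped-wellFormed : ∀ m → WellFormed (graph (size m) (capped m))
capped-wellFormed m F.zero = hub<size m , 0<size m , λ q → ≡ᵇ-false (0≢hub m) (sym q)
capped-wellFormed m (F.suc F.zero) =
  hub<size m , entry<size m , λ q → ≡ᵇ-false (entry≢hub m) (sym q)
capped-wellFormed zero (F.suc (F.suc F.zero)) = s≤s (s≤s z≤n) , s≤s z≤n , λ ()
capped-wellFormed (suc m) (F.suc (F.suc i)) = rung i
  where
  4+ : ∀ {v} → v < size m → 4 + v < size (suc m)
  4+ v< = s≤s (s≤s (s≤s (s≤s v<)))
  rung : WellFormed (graph (size (suc m)) (ladder (suc m)))
  rung F.zero = s≤s z≤n , s≤s (s≤s z≤n) , λ ()
  rung (F.suc F.zero) = s≤s (s≤s z≤n) , s≤s (s≤s (s≤s z≤n)) , λ ()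
  rung (F.suc (F.suc F.zero)) = s≤s (s≤s (s≤s z≤n)) , s≤s (s≤s (s≤s (s≤s z≤n))) , λ ()
  rung (F.suc (F.suc (F.suc F.zero))) = 4+ (hub<size m) , s≤s (s≤s z≤n) , λ ()
  rung (F.suc (F.suc (F.suc (F.suc F.zero)))) =
    4+ (hub<size m) , s≤s (s≤s (s≤s (s≤s z≤n))) , λ ()
  rung (F.suc (F.suc (F.suc (F.suc (F.suc F.zero))))) = s≤s z≤n , 4+ (0<size m) , λ ()
  rung (F.suc (F.suc (F.suc (F.suc (F.suc (F.suc F.zero)))))) =
    s≤s (s≤s (s≤s (s≤s z≤n))) , 4+ (entry<size m) , λ ()
  rung (F.suc (F.suc (F.suc (F.suc (F.suc (F.suc (F.suc i)))))))
    with lookup (shift (ladder m)) i | ends-shift (ladder m) i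
       | capped-wellFormed m (F.suc (F.suc (unshift (ladder m) i)))
  ... | _ | refl | l , r , l≢r = 4+ l , 4+ r , λ q → l≢r (+-cancelˡ-≡ 4 _ _ q)

Capped : ℕ → Graph
Capped m = graph (size m) (capped m)

reach-hub : ∀ m v → v < size m → Reach (Capped m) v (hub m)
reach-hub zero 0 _ = step (F.zero , inj₂ refl) here
reach-hub zero 1 _ = here
reach-hub zero (suc (suc v)) (s≤s (s≤s ()))
reach-hub (suc m) 0 _ = step (F.zero , inj₂ refl) here
reach-hub (suc m) 1 _ = step (F.suc (F.suc (F.suc (F.suc (F.suc F.zero)))) , inj₂ refl) here
reach-hub (suc m) 2 _ = step (F.suc F.zero , inj₂ refl) here
reach-hub (suc m) 3 _ =
  step (F.suc (F.suc (F.suc (F.suc (F.suc (F.suc F.zero))))) , inj₂ refl) here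
reach-hub (suc m) (suc (suc (suc (suc v)))) (s≤s (s≤s (s≤s (s≤s v<)))) =
  Reach-map {Capped m} (4 +_) reroute (reach-hub m v v<)
  where
  hub–0 : Reach (Capped (suc m)) (4 + hub m) 4
  hub–0 = step (F.zero , inj₁ refl)
    (step (F.suc (F.suc (F.suc (F.suc (F.suc (F.suc (F.suc F.zero)))))) , inj₁ refl) here)
  hub–entry : Reach (Capped (suc m)) (4 + hub m) (4 + entry m)
  hub–entry = step (F.suc (F.suc (F.suc (F.suc (F.suc (F.suc F.zero))))) , inj₁ refl)
    (step (F.suc (F.suc (F.suc (F.suc (F.suc (F.suc (F.suc (F.suc F.zero))))))) , inj₁ refl) here)
  reroute : ∀ {a b} → Adjacent (Capped m) a b → Reach (Capped (suc m)) (4 + a) (4 + b)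
  reroute (F.zero , inj₁ refl) = hub–0
  reroute (F.zero , inj₂ refl) = Reach-sym hub–0
  reroute (F.suc F.zero , inj₁ refl) = hub–entry
  reroute (F.suc F.zero , inj₂ refl) = Reach-sym hub–entry
  reroute (F.suc (F.suc i) , q) = step
    (9 F.↑ʳ reshift (ladder m) i ,
     Sum.map (λ e → trans (ends-reshift (ladder m) i) (cong (λ (a , b) → (4 + a , 4 + b)) e))
                  (λ e → trans (ends-reshift (ladder m) i) (cong (λ (a , b) → (4 + a , 4 + b)) e)) q)
    here

capped-connected : ∀ m v w → v < size m → w < size m → Reach (Capped m) v w
capped-connected m v w v< w< = Reach-trans (reach-hub m v v<) (Reach-sym (reach-hub m w w<))

capped-cubic : ∀ m w → w < size m → w ≢ hub m → inc (capped m) w ≡ 3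
capped-cubic zero 0 _ _ = refl
capped-cubic zero 1 _ w≢hub = ⊥-elim (w≢hub refl)
capped-cubic zero (suc (suc w)) (s≤s (s≤s ()))
capped-cubic (suc m) 0 _ _ rewrite inc-low (ladder m) {0} (λ _ → refl) = refl
capped-cubic (suc m) 1 _ _ rewrite inc-low (ladder m) {1} (λ _ → refl) = refl
capped-cubic (suc m) 2 _ _ rewrite inc-low (ladder m) {2} (λ _ → refl) = refl
capped-cubic (suc m) 3 _ _ rewrite inc-low (ladder m) {3} (λ _ → refl) = refl
capped-cubic (suc m) (suc (suc (suc (suc w)))) (s≤s (s≤s (s≤s (s≤s w<)))) w≢hub
  with ih ← capped-cubic m w w< (λ q → w≢hub (cong (4 +_) q))
  rewrite inc-up (ladder m) w | ≡ᵇ-≢ {hub m} {w} (λ q → w≢hub (cong (4 +_) (sym q))) = ih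

-- Labellings with degree 3 at one vertex

Spiked : ∀ m → ℕ → Set
Spiked m w = ∃[ M ] Fits m false false 0 (spike w) M

Spiked-addRung : ∀ m w L M → RungFits false false (spike w) L →
  Fits m (Vec.lookup L (5 F.↑ʳ F.zero)) (Vec.lookup L (6 F.↑ʳ F.zero))
    (𝟙 (Vec.lookup L (3 F.↑ʳ F.zero)) + 𝟙 (Vec.lookup L (4 F.↑ʳ F.zero)))
    (λ v → spike w (4 + v)) M → Spiked (suc m) w
Spiked-addRung m w L M rung fits = addRung m L M , Fits-addRung m false false 0 L (spike w) M rung fits

ladder-spiked : ∀ m w → flags true true true m w ≡ true → Spiked (suc m) w
ladder-spiked m 1 _ =
  Spiked-addRung m 1 (true ∷ true ∷ false ∷ true ∷ false ∷ false ∷ true ∷ []) (finish₀₁ m)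
  (refl , refl , refl , refl) (finish₀₁-fits m)
ladder-spiked m 3 _ =
  Spiked-addRung m 3 (true ∷ false ∷ true ∷ false ∷ true ∷ false ∷ true ∷ []) (finish₀₁ m)
  (refl , refl , refl , refl) (finish₀₁-fits m)
ladder-spiked zero 4 _ =
  Spiked-addRung 0 4 (false ∷ true ∷ false ∷ false ∷ false ∷ true ∷ true ∷ []) (true ∷ [])
  (refl , refl , refl , refl) λ
    { 0 _ → refl
    ; 1 _ → refl
    ; (suc (suc v)) (s≤s (s≤s ())) }
ladder-spiked (suc m) (suc (suc (suc (suc w)))) on = let (M , fits) = ladder-spiked m w on in
  Spiked-addRung (suc m) (4 + w) rung₀₀ M (refl , refl , refl , refl) fits
ladder-spiked zero 0 ()
ladder-spiked zero 2 ()
ladder-spiked zero (suc (suc (suc (suc (suc w))))) ()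
ladder-spiked (suc m) 0 ()
ladder-spiked (suc m) 2 ()

rungSpike₀ rungSpike₂ : EdgeLabels localRung
rungSpike₀ = true ∷ false ∷ true ∷ false ∷ false ∷ true ∷ false ∷ []
rungSpike₂ = false ∷ true ∷ true ∷ false ∷ false ∷ true ∷ false ∷ []

capped-spiked : ∀ m w → topFlags true true true m w ≡ true →
  ∃[ M ] Sat (size (suc m)) (spike w) (capped (suc m)) M
capped-spiked m 0 _ = true ∷ false ∷ addRung m rungSpike₀ (finish₁₀ m) ,
  Fits⇒Sat (suc m) true false (spike 0) (addRung m rungSpike₀ (finish₁₀ m))
    (Fits-addRung m true false 1 rungSpike₀ (spike 0) (finish₁₀ m)
      (refl , refl , refl , refl) (finish₁₀-fits m))
capped-spiked m 2 _ = false ∷ true ∷ addRung m rungSpike₂ (finish₁₀ m) ,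
  Fits⇒Sat (suc m) false true (spike 2) (addRung m rungSpike₂ (finish₁₀ m))
    (Fits-addRung m false true 1 rungSpike₂ (spike 2) (finish₁₀ m)
      (refl , refl , refl , refl) (finish₁₀-fits m))
capped-spiked m 1 on = let (M , fits) = ladder-spiked m 1 on in
  false ∷ false ∷ M , Fits⇒Sat (suc m) false false (spike 1) M fits
capped-spiked m (suc (suc (suc w))) on = let (M , fits) = ladder-spiked m (3 + w) on in
  false ∷ false ∷ M , Fits⇒Sat (suc m) false false (spike (3 + w)) M fits

flags<size : ∀ m w → flags true true true m w ≡ true → w < size (suc m)
flags<size zero 1 _ = s≤s (s≤s z≤n)
flags<size zero 3 _ = s≤s (s≤s (s≤s (s≤s z≤n)))
flags<size zero 4 _ = s≤s (s≤s (s≤s (s≤s (s≤s z≤n))))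
flags<size (suc m) 1 _ = s≤s (s≤s z≤n)
flags<size (suc m) 3 _ = s≤s (s≤s (s≤s (s≤s z≤n)))
flags<size (suc m) (suc (suc (suc (suc w)))) on = s≤s (s≤s (s≤s (s≤s (flags<size m w on))))
flags<size zero 0 ()
flags<size zero 2 ()
flags<size zero (suc (suc (suc (suc (suc w))))) ()
flags<size (suc m) 0 ()
flags<size (suc m) 2 ()

topFlags<size : ∀ m w → topFlags true true true m w ≡ true → w < size (suc m)
topFlags<size m 0 _ = s≤s z≤n
topFlags<size m 1 on = flags<size m 1 on
topFlags<size m 2 _ = s≤s (s≤s (s≤s z≤n))
topFlags<size m (suc (suc (suc w))) on = flags<size m (3 + w) on

-- Proved for the largest selection only; the other three are contained in it by `topFlags-mono`.
capped-inflatable : ∀ m w → topFlags true true true m w ≡ true →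
  Inflatable (size (suc m)) (capped (suc m)) w
capped-inflatable m w on =
  topFlags<size m w on ,
  capped-cubic (suc m) w (topFlags<size m w on)
    (λ { refl → true≢false on (flags-hub true true true m) }) ,
  capped-spiked m w on

-- Tight cuts of capped ladders

recolour-unused : ∀ es M v β x → deg es M v ≡ 0 → cut (recolour v β x) es M ≡ cut x es M
recolour-unused []             M           v β x eq = refl
recolour-unused ((a , b) ∷ es) (false ∷ M) v β x eq = recolour-unused es M v β x eq
recolour-unused ((a , b) ∷ es) (true ∷ M)  v β x eq with a ≡ᵇ v | b ≡ᵇ v
... | false | false = cong (𝟙 (x a xor x b) +_) (recolour-unused es M v β x eq)

xor-zero : ∀ p q → 𝟙 (p xor q) ≡ 0 → p ≡ q
xor-zero true  true  eq = refl
xor-zero false false eq = refl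

flip-colour : ∀ p q k l → p ≡ q → k ≡ l → l ≡ 0 → 𝟙 (not p xor q) + k ≡ 1
flip-colour true  _ _ _ refl refl refl = refl
flip-colour false _ _ _ refl refl refl = refl

flip-colour′ : ∀ p q k l → q ≡ p → k ≡ l → l ≡ 0 → 𝟙 (q xor not p) + k ≡ 1
flip-colour′ true  _ _ _ refl refl refl = refl
flip-colour′ false _ _ _ refl refl refl = refl

-- The one used edge at `v` is no loop, so flipping the colour of `v` makes this edge cross and
-- affects no other used edge.
recolour-used : ∀ es → Loopless es → ∀ M v x → deg es M v ≡ 1 → cut x es M ≡ 0 →
  cut (recolour v (not (x v)) x) es M ≡ 1
recolour-used ((a , b) ∷ es) ll (false ∷ M) v x d c = recolour-used es (ll ∘ F.suc) M v x d c
recolour-used ((a , b) ∷ es) ll (true ∷ M)  v x d c with a ≡ᵇ v in av | b ≡ᵇ v in bv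
... | true  | true  = ⊥-elim (ll F.zero (trans (≡ᵇ-true av) (sym (≡ᵇ-true bv))))
... | true  | false with refl ← ≡ᵇ-true {a} {v} av =
  flip-colour (x a) (x b) _ _ (xor-zero (x a) (x b) (m+n≡0⇒m≡0 _ c))
    (recolour-unused es M a (not (x a)) x (suc-injective d)) (m+n≡0⇒n≡0 (𝟙 (x a xor x b)) c)
... | false | true  with refl ← ≡ᵇ-true {b} {v} bv =
  flip-colour′ (x b) (x a) _ _ (xor-zero (x a) (x b) (m+n≡0⇒m≡0 _ c))
    (recolour-unused es M b (not (x b)) x (suc-injective d)) (m+n≡0⇒n≡0 (𝟙 (x a xor x b)) c)
... | false | false =
  cong₂ _+_ (m+n≡0⇒m≡0 (𝟙 (x a xor x b)) c)
    (recolour-used es (ll ∘ F.suc) M v x d (m+n≡0⇒n≡0 (𝟙 (x a xor x b)) c))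

-- The colours of the first rung in a tight cut in which the hub has colour false; β is the colour
-- of the vertex to which the rung and the hub are contracted.
data Rim (y₀ y₁ y₂ y₃ β : Bool) : Set where
  none : y₀ ≡ false → y₁ ≡ false → y₂ ≡ false → y₃ ≡ false → β ≡ false → Rim y₀ y₁ y₂ y₃ β
  only₀ : y₀ ≡ true → y₁ ≡ false → y₂ ≡ false → y₃ ≡ false → β ≡ true → Rim y₀ y₁ y₂ y₃ β
  only₁ : y₀ ≡ false → y₁ ≡ true → y₂ ≡ false → y₃ ≡ false → β ≡ true → Rim y₀ y₁ y₂ y₃ β
  only₂ : y₀ ≡ false → y₁ ≡ false → y₂ ≡ true → y₃ ≡ false → β ≡ true → Rim y₀ y₁ y₂ y₃ β
  only₃ : y₀ ≡ false → y₁ ≡ false → y₂ ≡ false → y₃ ≡ true → β ≡ true → Rim y₀ y₁ y₂ y₃ β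
  all : y₀ ≡ true → y₁ ≡ true → y₂ ≡ true → y₃ ≡ true → β ≡ false → Rim y₀ y₁ y₂ y₃ β

-- The part of the brick property of the wheel that is needed. Each of the rests `j` and `k` is
-- shared by two matchings that differ only on the wheel; the fifth equation belongs to `spine`. Ten
-- of the sixteen colourings violate an equation.
rim : ∀ y₀ y₁ y₂ y₃ {j k l} →
  𝟙 (y₁ xor y₂) + (𝟙 y₃ + j) ≡ 1 → 𝟙 (y₂ xor y₃) + (𝟙 y₁ + j) ≡ 1 →
  𝟙 y₂ + (𝟙 (y₀ xor y₁) + k) ≡ 1 → 𝟙 y₀ + (𝟙 (y₁ xor y₂) + k) ≡ 1 →
  𝟙 (y₀ xor y₁) + (𝟙 (y₂ xor y₃) + l) ≡ 1 → ∃[ β ] Rim y₀ y₁ y₂ y₃ β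
rim true true true true a a′ b b′ c = false , all refl refl refl refl refl
rim true true true false a ()
rim true true false true ()
rim true true false false a a′ b ()
rim true false true true ()
rim true false true false a a′ ()
rim true false false true a a′ b b′ ()
rim true false false false a a′ b b′ c = true , only₀ refl refl refl refl refl
rim false true true true a a′ ()
rim false true true false a ()
rim false true false true ()
rim false true false false a a′ b b′ c = true , only₁ refl refl refl refl refl
rim false false true true ()
rim false false true false a a′ b b′ c = true , only₂ refl refl refl refl refl
rim false false false true a a′ b b′ c = true , only₃ refl refl refl refl refl
rim false false false false a a′ b b′ c = false , none refl refl refl refl refl

contract₁₀ : ∀ {y₀ y₁ y₂ y₃ β} → Rim y₀ y₁ y₂ y₃ β → ∀ z {r} →
  𝟙 (y₁ xor y₂) + (𝟙 y₃ + (𝟙 (y₀ xor z) + r)) ≡ 1 → 𝟙 (β xor z) + r ≡ 1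
contract₁₀ (none refl refl refl refl refl) true eq = eq
contract₁₀ (none refl refl refl refl refl) false eq = eq
contract₁₀ (only₀ refl refl refl refl refl) true eq = eq
contract₁₀ (only₀ refl refl refl refl refl) false eq = eq
contract₁₀ (only₁ refl refl refl refl refl) true ()
contract₁₀ (only₁ refl refl refl refl refl) false eq = eq
contract₁₀ (only₂ refl refl refl refl refl) true ()
contract₁₀ (only₂ refl refl refl refl refl) false eq = eq
contract₁₀ (only₃ refl refl refl refl refl) true ()
contract₁₀ (only₃ refl refl refl refl refl) false eq = eq
contract₁₀ (all refl refl refl refl refl) true eq = eq
contract₁₀ (all refl refl refl refl refl) false ()

contract₀₁ : ∀ {y₀ y₁ y₂ y₃ β} → Rim y₀ y₁ y₂ y₃ β → ∀ z {r} →
  𝟙 y₂ + (𝟙 (y₀ xor y₁) + (𝟙 (y₃ xor z) + r)) ≡ 1 → 𝟙 (β xor z) + r ≡ 1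
contract₀₁ (none refl refl refl refl refl) true eq = eq
contract₀₁ (none refl refl refl refl refl) false eq = eq
contract₀₁ (only₀ refl refl refl refl refl) true ()
contract₀₁ (only₀ refl refl refl refl refl) false eq = eq
contract₀₁ (only₁ refl refl refl refl refl) true ()
contract₀₁ (only₁ refl refl refl refl refl) false eq = eq
contract₀₁ (only₂ refl refl refl refl refl) true ()
contract₀₁ (only₂ refl refl refl refl refl) false eq = eq
contract₀₁ (only₃ refl refl refl refl refl) true eq = eq
contract₀₁ (only₃ refl refl refl refl refl) false eq = eq
contract₀₁ (all refl refl refl refl refl) true eq = eq
contract₀₁ (all refl refl refl refl refl) false ()

contract₀₀ : ∀ {y₀ y₁ y₂ y₃ β r} → Rim y₀ y₁ y₂ y₃ β →
  𝟙 (y₀ xor y₁) + (𝟙 (y₂ xor y₃) + r) ≡ 1 → (β ≡ false × r ≡ 1) ⊎ (β ≡ true × r ≡ 0)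
contract₀₀ (none refl refl refl refl refl) eq = inj₁ (refl , eq)
contract₀₀ (only₀ refl refl refl refl refl) eq = inj₂ (refl , suc-injective eq)
contract₀₀ (only₁ refl refl refl refl refl) eq = inj₂ (refl , suc-injective eq)
contract₀₀ (only₂ refl refl refl refl refl) eq = inj₂ (refl , suc-injective eq)
contract₀₀ (only₃ refl refl refl refl refl) eq = inj₂ (refl , suc-injective eq)
contract₀₀ (all refl refl refl refl refl) eq = inj₁ (refl , eq)

forced-colour : ∀ y z {r} → 1 + (𝟙 (y xor z) + r) ≡ 1 → z ≡ y
forced-colour y z eq = sym (xor-zero y z (m+n≡0⇒m≡0 _ (suc-injective eq)))

entry≢end : ∀ m → entry m ≡ end m → m ≡ 0
entry≢end zero _ = refl

0≢end : ∀ m → 0 ≡ end m → m ≡ 0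
0≢end zero _ = refl

0≢entry : ∀ m → 0 ≡ entry m → m ≡ 0
0≢entry zero _ = refl

lonely : ∀ m → m ≡ 0 → ∀ v w → v < size m → v ≢ hub m → w < size m → w ≢ hub m → v ≡ w
lonely zero _ 0 0 _ _ _ _ = refl
lonely zero _ 1 _ _ v≢ _ _ = ⊥-elim (v≢ refl)
lonely zero _ 0 1 _ _ _ w≢ = ⊥-elim (w≢ refl)
lonely zero _ (suc (suc v)) _ (s≤s (s≤s ()))
lonely zero _ 0 (suc (suc w)) _ _ (s≤s (s≤s ()))

forced : ∀ p q y z {r} → 𝟙 p + 𝟙 q ≡ 1 → 𝟙 p + (𝟙 q + (𝟙 (y xor z) + r)) ≡ 1 → z ≡ y
forced true  false y z _ eq = forced-colour y z eq
forced false true  y z _ eq = forced-colour y z eq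

Tight : ∀ m → (ℕ → Bool) → Set
Tight m x = ∀ M → PM m M → cut x (capped m) M ≡ 1

module Contract (m : ℕ) (y : ℕ → Bool) (tight : Tight (suc m) y)
                (hub-colour : y (4 + hub m) ≡ false) where

  y⁺ : ℕ → Bool
  y⁺ v = y (4 + v)

  private
    normalise : ∀ (f : Bool → ℕ → ℕ) {M} →
      f (y (4 + hub m)) (cut y (shift (ladder m)) (up (ladder m) M)) ≡ 1 →
      f false (cut y⁺ (ladder m) M) ≡ 1
    normalise f {M} eq = trans (sym (cong₂ f hub-colour (cut-up y (ladder m) M))) eq

  cut₁₀ : ∀ M → Fits m true false 1 one M →
    𝟙 (y 1 xor y 2) + (𝟙 (y 3) + (𝟙 (y 0 xor y 4) + cut y⁺ (ladder m) M)) ≡ 1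
  cut₁₀ M fits = normalise (λ h r → 𝟙 (y 1 xor y 2) + (𝟙 (h xor y 3) + (𝟙 (y 0 xor y 4) + r)))
    (tight (lift₁₀ m M) (PM-lift₁₀ m M fits))

  cut₁₀′ : ∀ M → Fits m true false 1 one M →
    𝟙 (y 2 xor y 3) + (𝟙 (y 1) + (𝟙 (y 0 xor y 4) + cut y⁺ (ladder m) M)) ≡ 1
  cut₁₀′ M fits = normalise (λ h r → 𝟙 (y 2 xor y 3) + (𝟙 (h xor y 1) + (𝟙 (y 0 xor y 4) + r)))
    (tight (lift₁₀′ m M) (PM-lift₁₀′ m M fits))

  cut₀₁ : ∀ M → Fits m false true 1 one M →
    𝟙 (y 2) + (𝟙 (y 0 xor y 1) + (𝟙 (y 3 xor y⁺ (entry m)) + cut y⁺ (ladder m) M)) ≡ 1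
  cut₀₁ M fits = normalise (λ h r → 𝟙 (h xor y 2) + (𝟙 (y 0 xor y 1) + (𝟙 (y 3 xor y⁺ (entry m)) + r)))
    (tight (lift₀₁ m M) (PM-lift₀₁ m M fits))

  cut₀₁′ : ∀ M → Fits m false true 1 one M →
    𝟙 (y 0) + (𝟙 (y 1 xor y 2) + (𝟙 (y 3 xor y⁺ (entry m)) + cut y⁺ (ladder m) M)) ≡ 1
  cut₀₁′ M fits = normalise (λ h r → 𝟙 (h xor y 0) + (𝟙 (y 1 xor y 2) + (𝟙 (y 3 xor y⁺ (entry m)) + r)))
    (tight (lift₀₁′ m M) (PM-lift₀₁′ m M fits))

  cut₀₀ : ∀ M → Fits m false false 0 one M →
    𝟙 (y 0 xor y 1) + (𝟙 (y 2 xor y 3) + cut y⁺ (ladder m) M) ≡ 1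
  cut₀₀ M fits = normalise (λ h r → 𝟙 (y 0 xor y 1) + (𝟙 (y 2 xor y 3) + r))
    (tight (lift₀₀ m M) (PM-lift₀₀ m M fits))

  rimOf : ∃[ β ] Rim (y 0) (y 1) (y 2) (y 3) β
  rimOf = rim (y 0) (y 1) (y 2) (y 3)
    (cut₁₀ _ (finish₁₀-fits m)) (cut₁₀′ _ (finish₁₀-fits m))
    (cut₀₁ _ (finish₀₁-fits m)) (cut₀₁′ _ (finish₀₁-fits m)) (cut₀₀ _ (spine-fits m))

  module _ {β : Bool} (R : Rim (y 0) (y 1) (y 2) (y 3) β) where

    ŷ : ℕ → Bool
    ŷ = recolour (hub m) β y⁺

    ŷ-hub : ŷ (hub m) ≡ β
    ŷ-hub = recolour-same (hub m) β y⁺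

    ŷ-other : ∀ {v} → v ≢ hub m → ŷ v ≡ y⁺ v
    ŷ-other = recolour-other β y⁺

    -- A matching that uses a cap edge meets the hub nowhere else, so the new hub colour affects
    -- this edge alone. One without cap edges meets the hub inside the ladder: if `β` is true, its
    -- lift crosses on the rung and not beyond, and flipping the hub makes the used hub edge cross
    -- instead.
    contract-tight : Tight m ŷ
    contract-tight (a ∷ b ∷ M) sat with capUse m a b M sat
    ... | via₁₀ = trans
      (cong₂ (λ p k → 𝟙 p + k) (cong₂ _xor_ ŷ-hub (ŷ-other λ q → ≡ᵇ-false (0≢hub m) q))
        (recolour-unused (ladder m) M (hub m) β y⁺ (suc-injective (hub-load m true false 1 one M fits))))
      (contract₁₀ R (y 4) (cut₁₀ M fits))
      where fits = Sat⇒Fits m true false one M sat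
    ... | via₀₁ = trans
      (cong₂ (λ p k → 𝟙 p + k) (cong₂ _xor_ ŷ-hub (ŷ-other λ q → ≡ᵇ-false (entry≢hub m) q))
        (recolour-unused (ladder m) M (hub m) β y⁺ (suc-injective (hub-load m false true 1 one M fits))))
      (contract₀₁ R (y⁺ (entry m)) (cut₀₁ M fits))
      where fits = Sat⇒Fits m false true one M sat
    ... | via₀₀ = by (contract₀₀ R (cut₀₀ M fits))
      where
      fits = Sat⇒Fits m false false one M sat
      by : (β ≡ false × cut y⁺ (ladder m) M ≡ 1) ⊎ (β ≡ true × cut y⁺ (ladder m) M ≡ 0) →
        cut ŷ (ladder m) M ≡ 1
      by (inj₁ (β≡ , r≡)) = trans
        (cnt-cong (λ e → cong₂ _xor_ (same (proj₁ e)) (same (proj₂ e))) (ladder m) M) r≡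
        where
        same : ∀ v → ŷ v ≡ y⁺ v
        same v with v ≟ hub m
        ... | yes refl = trans ŷ-hub (trans β≡ (sym hub-colour))
        ... | no v≢    = ŷ-other v≢
      by (inj₂ (β≡ , r≡)) = subst (λ β → cut (recolour (hub m) β y⁺) (ladder m) M ≡ 1)
        (trans (cong not hub-colour) (sym β≡))
        (recolour-used (ladder m) (λ i → proj₂ (proj₂ (capped-wellFormed m (F.suc (F.suc i))))) M (hub m) y⁺
          (hub-load m false false 0 one M fits) r≡)

    Outside : Set
    Outside = ∀ v → v < size m → v ≢ hub m → y⁺ v ≡ not β

    -- If the lone vertex `w` is the hub, the claim is immediate. Otherwise all vertices except `w`
    -- have colour `β`, so `s` and `t` both equal `w`; this forces `m` to be 0, where only one
    -- vertex exists besides the hub.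
    two-outside : ∀ s t → s ≢ hub m → t ≢ hub m → s < size m → t < size m → (s ≡ t → m ≡ 0) →
      y⁺ s ≡ not β → y⁺ t ≡ not β → Trivial (size m) ŷ → Outside
    two-outside s t s≢ t≢ s< t< st ys yt (w , w< , h) v v< v≢ with w ≟ hub m
    ... | yes refl = trans (sym (ŷ-other v≢)) (trans (h v v< v≢) (cong not ŷ-hub))
    ... | no w≢ = trans
      (cong y⁺ (lonely m (st (trans (is-w s s≢ s< ys) (sym (is-w t t≢ t< yt)))) v s v< v≢ s< s≢)) ys
      where
      β≡ : β ≡ not (y⁺ w)
      β≡ = trans (sym ŷ-hub) (trans (h (hub m) (hub<size m) (λ q → w≢ (sym q))) (cong not (ŷ-other w≢)))
      is-w : ∀ s → s ≢ hub m → s < size m → y⁺ s ≡ not β → s ≡ w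
      is-w s s≢ s< ys with s ≟ w
      ... | yes s≡w = s≡w
      ... | no s≢w  = ⊥-elim (opposite ys
        (trans (sym (ŷ-other s≢)) (trans (h s s< s≢w) (trans (cong not (ŷ-other w≢)) (sym β≡)))) refl)

  assemble : ∀ w c → w < size (suc m) → y w ≡ c → (0 ≢ w → y 0 ≡ not c) → (1 ≢ w → y 1 ≡ not c) →
    (2 ≢ w → y 2 ≡ not c) → (3 ≢ w → y 3 ≡ not c) → (4 + hub m ≢ w → false ≡ not c) →
    (∀ v → v < size m → v ≢ hub m → 4 + v ≢ w → y⁺ v ≡ not c) → Trivial (size (suc m)) y
  assemble w c w< yw h₀ h₁ h₂ h₃ hub≢ out = w , w< , λ v v< v≢ → trans (go v v< v≢) (cong not (sym yw))
    where
    go : ∀ v → v < size (suc m) → v ≢ w → y v ≡ not c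
    go 0 _ = h₀
    go 1 _ = h₁
    go 2 _ = h₂
    go 3 _ = h₃
    go (suc (suc (suc (suc v)))) (s≤s (s≤s (s≤s (s≤s v<)))) v≢ with v ≟ hub m
    ... | yes refl = trans hub-colour (hub≢ v≢)
    ... | no v≢hub = out v v< v≢hub v≢

  private
    0≢ : 0 ≢ hub m
    0≢ = ≡ᵇ-false (0≢hub m)
    entry≢ : entry m ≢ hub m
    entry≢ = ≡ᵇ-false (entry≢hub m)
    end≢ : end m ≢ hub m
    end≢ = ≡ᵇ-false (end≢hub m)
    4+ : ∀ {v} → v < size m → 4 + v < size (suc m)
    4+ v< = s≤s (s≤s (s≤s (s≤s v<)))

    end-colour : ∀ {β} → Rim (y 0) (y 1) (y 2) (y 3) β → β ≡ true → y⁺ (end m) ≡ false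
    end-colour R β≡ with contract₀₀ R (cut₀₀ _ (spine-fits m))
    ... | inj₁ (β≡′ , _) = ⊥-elim (true≢false β≡ β≡′)
    ... | inj₂ (_ , r≡)  = trans (spine-cut m y⁺ r≡) hub-colour

    entry-colour : 𝟙 (y 2) + 𝟙 (y 0 xor y 1) ≡ 1 → y⁺ (entry m) ≡ y 3
    entry-colour eq = forced (y 2) (y 0 xor y 1) (y 3) _ eq (cut₀₁ _ (finish₀₁-fits m))

    first-colour : 𝟙 (y 1 xor y 2) + 𝟙 (y 3) ≡ 1 → y⁺ 0 ≡ y 0
    first-colour eq = forced (y 1 xor y 2) (y 3) (y 0) _ eq (cut₁₀ _ (finish₁₀-fits m))

    _⊻_ : ∀ {a b p q} → a ≡ p → b ≡ q → 𝟙 (a xor b) ≡ 𝟙 (p xor q)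
    e ⊻ f = cong₂ (λ a b → 𝟙 (a xor b)) e f

  module _ (crossing : y 0 ≡ false → y 1 ≡ false → y 2 ≡ false → y 3 ≡ false →
                       y⁺ 0 ≡ true → y⁺ (entry m) ≡ true → m ≡ 0) where

    -- When one of the five contracted vertices is lone, matchings that cross inside the contracted
    -- part cannot cross again, which fixes the colour of two outer vertices for `two-outside`. The
    -- vertices `0` and `entry m` are reached by the edges from the rung, `end m` through `spine`
    -- from the hub; the pair avoids the links that start at the lone vertex.
    expand : ∀ {β} (R : Rim (y 0) (y 1) (y 2) (y 3) β) → Trivial (size m) (ŷ R) → Trivial (size (suc m)) y
    expand R@(only₀ e₀ e₁ e₂ e₃ refl) T = assemble 0 true (s≤s z≤n) e₀
      (λ n → ⊥-elim (n refl)) (λ _ → e₁) (λ _ → e₂) (λ _ → e₃) (λ _ → refl) λ v v< v≢ _ →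
      two-outside R (entry m) (end m) entry≢ end≢ (entry<size m) (end<size m) (entry≢end m)
        (trans (entry-colour (cong₂ _+_ (cong 𝟙 e₂) (e₀ ⊻ e₁))) e₃) (end-colour R refl) T v v< v≢
    expand R@(only₁ e₀ e₁ e₂ e₃ refl) T = assemble 1 true (s≤s (s≤s z≤n)) e₁
      (λ _ → e₀) (λ n → ⊥-elim (n refl)) (λ _ → e₂) (λ _ → e₃) (λ _ → refl) λ v v< v≢ _ →
      two-outside R (entry m) (end m) entry≢ end≢ (entry<size m) (end<size m) (entry≢end m)
        (trans (entry-colour (cong₂ _+_ (cong 𝟙 e₂) (e₀ ⊻ e₁))) e₃) (end-colour R refl) T v v< v≢
    expand R@(only₂ e₀ e₁ e₂ e₃ refl) T = assemble 2 true (s≤s (s≤s (s≤s z≤n))) e₂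
      (λ _ → e₀) (λ _ → e₁) (λ n → ⊥-elim (n refl)) (λ _ → e₃) (λ _ → refl) λ v v< v≢ _ →
      two-outside R (entry m) (end m) entry≢ end≢ (entry<size m) (end<size m) (entry≢end m)
        (trans (entry-colour (cong₂ _+_ (cong 𝟙 e₂) (e₀ ⊻ e₁))) e₃) (end-colour R refl) T v v< v≢
    expand R@(only₃ e₀ e₁ e₂ e₃ refl) T = assemble 3 true (s≤s (s≤s (s≤s (s≤s z≤n)))) e₃
      (λ _ → e₀) (λ _ → e₁) (λ _ → e₂) (λ n → ⊥-elim (n refl)) (λ _ → refl) λ v v< v≢ _ →
      two-outside R 0 (end m) 0≢ end≢ (0<size m) (end<size m) (0≢end m)
        (trans (first-colour (cong₂ _+_ (e₁ ⊻ e₂) (cong 𝟙 e₃))) e₀) (end-colour R refl) T v v< v≢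
    expand R@(all e₀ e₁ e₂ e₃ refl) T = assemble (4 + hub m) false (4+ (hub<size m)) hub-colour
      (λ _ → e₀) (λ _ → e₁) (λ _ → e₂) (λ _ → e₃) (λ n → ⊥-elim (n refl)) λ v v< v≢ _ →
      two-outside R 0 (entry m) 0≢ entry≢ (0<size m) (entry<size m) (0≢entry m)
        (trans (first-colour (cong₂ _+_ (e₁ ⊻ e₂) (cong 𝟙 e₃))) e₀)
        (trans (entry-colour (cong₂ _+_ (cong 𝟙 e₂) (e₀ ⊻ e₁))) e₃) T v v< v≢
    expand R@(none e₀ e₁ e₂ e₃ refl) (w , w< , h) with w ≟ hub m
    ... | no w≢ = assemble (4 + w) true (4+ w<) yw
      (λ _ → e₀) (λ _ → e₁) (λ _ → e₂) (λ _ → e₃) (λ _ → refl) λ v v< v≢ v≢w →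
      trans (sym (ŷ-other R v≢)) (trans (h v v< λ q → v≢w (cong (4 +_) q))
        (cong not (trans (ŷ-other R w≢) yw)))
      where
      yw : y⁺ w ≡ true
      yw = trans (sym (not-involutive (y⁺ w))) (cong not (trans (cong not (sym (ŷ-other R w≢)))
        (trans (sym (h (hub m) (hub<size m) λ q → w≢ (sym q))) (ŷ-hub R))))
    -- The rung and the hub form one side of the cut. By `crossing` this happens only for `m` equal
    -- to 0, where the other side is the single vertex u.
    ... | yes refl = assemble 4 true (4+ (0<size m)) (out 0 (0<size m) 0≢)
      (λ _ → e₀) (λ _ → e₁) (λ _ → e₂) (λ _ → e₃) (λ _ → refl) λ v v< v≢ v≢0 →
      ⊥-elim (v≢0 (cong (4 +_) (lonely m (crossing e₀ e₁ e₂ e₃ (out 0 (0<size m) 0≢)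
        (out (entry m) (entry<size m) entry≢)) v 0 v< v≢ (0<size m) 0≢)))
      where
      out : ∀ v → v < size m → v ≢ hub m → y⁺ v ≡ true
      out v v< v≢ = trans (sym (ŷ-other R v≢)) (trans (h v v< v≢) (cong not (ŷ-hub R)))

no-crossing : ∀ m {y} → Tight (suc m) y → y 0 ≡ false → y 1 ≡ false → y 2 ≡ false → y 3 ≡ false →
  y 4 ≡ true → y (4 + entry m) ≡ true → m ≡ 0
no-crossing zero    t _  _  _  _  _  _  = refl
no-crossing (suc m) {y} t e₀ e₁ e₂ e₃ e₄ e₆ =
  ⊥-elim (two e₀ e₁ e₂ e₃ e₄ e₆ (t (false ∷ false ∷ spread₃ m) (spread₃-PM m)))
  where
  two : ∀ {a b c d e f r} → a ≡ false → b ≡ false → c ≡ false → d ≡ false → e ≡ true → f ≡ true →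
    𝟙 (b xor c) + (𝟙 (a xor e) + (𝟙 (d xor f) + r)) ≢ 1
  two refl refl refl refl refl refl ()

capped-tight : ∀ m x → Tight m x → Trivial (size m) x
capped-tight zero x t = 0 , s≤s z≤n , λ
  { 0 _ v≢ → ⊥-elim (v≢ refl)
  ; 1 _ _ → differ (x 1) (x 0)
      (t (false ∷ false ∷ spine 0) (Fits⇒Sat 0 false false one (spine 0) (spine-fits 0)))
  ; (suc (suc v)) (s≤s (s≤s ())) }
  where
  differ : ∀ p q → 𝟙 (p xor q) + 0 ≡ 1 → p ≡ not q
  differ true  false _ = refl
  differ false true  _ = refl
  differ true  true  ()
  differ false false ()
capped-tight (suc m) x t = w , w< , λ v v< v≢ → cancel (x v) (x w) H (h v v< v≢)
  where
  -- Adding the colour of the hub everywhere exchanges the two sides if necessary; the cut stays the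
  -- same and the hub gets colour `false`.
  H = x (4 + hub m)
  y : ℕ → Bool
  y v = x v xor H
  xor-cancel : ∀ a b h → (a xor h) xor (b xor h) ≡ a xor b
  xor-cancel true  true  true  = refl
  xor-cancel true  true  false = refl
  xor-cancel true  false true  = refl
  xor-cancel true  false false = refl
  xor-cancel false true  true  = refl
  xor-cancel false true  false = refl
  xor-cancel false false true  = refl
  xor-cancel false false false = refl
  cancel : ∀ a b h → a xor h ≡ not (b xor h) → a ≡ not b
  cancel true  false _     _ = refl
  cancel false true  _     _ = refl
  cancel true  true  true  ()
  cancel true  true  false ()
  cancel false false true  ()
  cancel false false false ()
  ty : Tight (suc m) y
  ty M sat = trans
    (cnt-cong (λ e → xor-cancel (x (proj₁ e)) (x (proj₂ e)) H) (capped (suc m)) M) (t M sat)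
  open Contract m y ty (xor-same H)
  R = proj₂ rimOf
  T = expand (no-crossing m {y} ty) R (capped-tight m (ŷ R) (contract-tight R))
  w = proj₁ T
  w< = proj₁ (proj₂ T)
  h = proj₂ (proj₂ T)

capped-brick : ∀ m → IsBrick (size (suc m)) (capped (suc m))
capped-brick m = record
  { wellFormed = capped-wellFormed (suc m)
  ; connected  = capped-connected (suc m)
  ; covered    = capped-covered (suc m)
  ; tight      = capped-tight (suc m)
  ; triangle   = hub (suc m) , 0 , 1 , (F.zero , inj₁ refl) , (2 F.↑ʳ F.zero , inj₁ refl) ,
                 (5 F.↑ʳ F.zero , inj₂ refl)
  }

-- Inserting all triangles

mult : ℕ → List ℕ → ℕ
mult w []       = 0
mult w (v ∷ vs) = 𝟙 (v ≡ᵇ w) + mult w vs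

record Inflation (n : ℕ) (es : Edges) (f : ℕ → Bool) (k : ℕ) (G : Graph) : Set where
  field
    order   : V G ≡ 2 * k + n
    edges   : length (E G) ≡ 3 * k + length es
    brick   : IsBrick (V G) (E G)
    counted : numPM G ≡ total n (λ w → lax (f w)) es

-- The equation for `mult` says at once that `vs` has no repetitions and that `f` is its
-- characteristic function. After the insertion at `v` the recursion continues with `f` switched off
-- at `v`; summing out the triangle then readmits degree 3 at `v`.
inflateAll : ∀ vs {n es f} → IsBrick n es → (∀ w → mult w vs ≡ 𝟙 (f w)) →
  (∀ w → f w ≡ true → Inflatable n es w) →
  Inflation n es f (length vs) (triInsAll vs (graph n es))
inflateAll [] {n} {es} {f} B mults _ = record
  { order = refl ; edges = refl ; brick = B
  ; counted = trans (numPM-total n es)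
      (total-cong n (λ w _ k → cong (λ b → lax b k) (sym (absent (mults w)))) es) }
  where
  absent : ∀ {b} → 0 ≡ 𝟙 b → b ≡ false
  absent {false} _ = refl
inflateAll (v ∷ vs) {n} {es} {f} B mults inflatable = record
  { order   = trans order (lemma₂ (length vs) n)
  ; edges   = trans edges (trans (cong (3 * length vs +_) (length-triIns B Iv))
      (lemma₃ (length vs) (length es)))
  ; brick   = brick
  ; counted = trans counted (trans
      (total-triIns B Iv (λ k → cong (λ b → lax b k) (recolour-same v false f))
        (λ k → cong (λ b → lax b k) (fresh ≤-refl)) (λ k → cong (λ b → lax b k) (fresh (n≤1+n n))))
      (total-cong n (λ w _ → relaxed w) es))
  }
  where
  lemma₂ : ∀ k n → 2 * k + (2 + n) ≡ 2 * suc k + n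
  lemma₂ = solve-∀
  lemma₃ : ∀ k n → 3 * k + (3 + n) ≡ 3 * suc k + n
  lemma₃ = solve-∀
  pos : ∀ {k b} → suc k ≡ 𝟙 b → b ≡ true
  pos {b = true} _ = refl
  fv : f v ≡ true
  fv = pos (trans (cong (λ b → 𝟙 b + mult v vs) (sym (≡ᵇ-refl v))) (mults v))
  Iv = inflatable v fv
  f′ : ℕ → Bool
  f′ = recolour v false f
  mults′ : ∀ w → mult w vs ≡ 𝟙 (f′ w)
  mults′ w with w ≟ v
  ... | yes refl = trans (suc-injective (trans (cong (λ b → 𝟙 b + mult v vs) (sym (≡ᵇ-refl v)))
                            (trans (mults v) (cong 𝟙 fv))))
                         (cong 𝟙 (sym (recolour-same v false f)))
  ... | no w≢v   = trans (trans (cong (λ b → 𝟙 b + mult w vs) (sym (≡ᵇ-≢ λ q → w≢v (sym q)))) (mults w))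
                         (cong 𝟙 (sym (recolour-other false f w≢v)))
  f′⇒f : ∀ w → f′ w ≡ true → w ≢ v × f w ≡ true
  f′⇒f w on with w ≟ v
  ... | yes refl = ⊥-elim (true≢false on (recolour-same v false f))
  ... | no w≢v   = w≢v , trans (sym (recolour-other false f w≢v)) on
  inflatable′ : ∀ w → f′ w ≡ true → Inflatable (2 + n) (E (triIns v (graph n es))) w
  inflatable′ w on = let (w≢v , fw) = f′⇒f w on in Inflatable-triIns B Iv w≢v (inflatable w fw)
  fresh : ∀ {w} → n ≤ w → f′ w ≡ false
  fresh {w} n≤w with f′ w in eq
  ... | false = refl
  ... | true  = ⊥-elim (<⇒≱ (proj₁ (inflatable w (proj₂ (f′⇒f w eq)))) n≤w)
  relaxed : ∀ w k → relax v (λ w → lax (f′ w)) w k ≡ lax (f w) k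
  relaxed w k with w ≟ v
  ... | yes refl rewrite ≡ᵇ-refl v | fv = refl
  ... | no w≢v   rewrite ≡ᵇ-≢ w≢v = refl
  open Inflation (inflateAll vs (IsBrick-triIns B Iv) mults′ inflatable′)

-- The graph G't

uv-suc : ∀ s k → uv (suc s) k ≡ 4 + uv s k
uv-suc s k = cong (_+ (k ∸ 1)) (*-suc 4 s)

unroll : ∀ {A : Set} (g : A → A) (f : ℕ → List A) → (∀ s → f (suc s) ≡ map g (f s)) →
  ∀ t → concatMap f (upTo (suc t)) ≡ f 0 ++ map g (concatMap f (upTo t))
unroll g f f-suc t = cong (f 0 ++_) (begin
  concatMap f (applyUpTo suc t)  ≡⟨ cong (concatMap f) (map-upTo suc t) ⟨
  concatMap f (map suc (upTo t))           ≡⟨ concatMap-map f suc (upTo t) ⟩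
  concatMap (f ∘ suc) (upTo t)             ≡⟨ concatMap-cong f-suc (upTo t) ⟩
  concatMap (map g ∘ f) (upTo t)           ≡⟨ map-concatMap g f (upTo t) ⟨
  map g (concatMap f (upTo t))             ∎)
  where open ≡-Reasoning

path rails : ℕ → Edges
path  s = (uv s 1 , uv s 2) ∷ (uv s 2 , uv s 3) ∷ (uv s 3 , uv s 4) ∷ []
rails s = (uv s 1 , uv (suc s) 1) ∷ (uv s 4 , uv (suc s) 3) ∷ []

evens : ℕ → List ℕ
evens s = uv s 2 ∷ uv s 4 ∷ []

-- `core` is G't without the edges from u′ to the first and the third vertex of the first path.
-- Those two are the cap edges; the rest follows the recursion of `ladder` up to order and
-- orientation.
caps spokes core : ℕ → Edges
caps t   = (uT t , uv t 1) ∷ (uT t , uv t 4) ∷ []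
spokes t = map (u′ t ,_) (concatMap evens (upTo (suc t)))
core t   = concatMap path (upTo (suc t)) ++ concatMap rails (upTo t) ++ caps t ++ (u′ t , uT t) ∷ spokes t

path-suc : ∀ s → path (suc s) ≡ shift (path s)
path-suc s rewrite uv-suc s 1 | uv-suc s 2 | uv-suc s 3 | uv-suc s 4 = refl

rails-suc : ∀ s → rails (suc s) ≡ shift (rails s)
rails-suc s rewrite uv-suc (suc s) 1 | uv-suc (suc s) 3 | uv-suc s 1 | uv-suc s 4 = refl

evens-suc : ∀ s → evens (suc s) ≡ map (4 +_) (evens s)
evens-suc s rewrite uv-suc s 2 | uv-suc s 4 = refl

uT-suc : ∀ t → uT (suc t) ≡ 4 + uT t
uT-suc t = *-suc 4 (suc t)

caps-suc : ∀ t → caps (suc t) ≡ shift (caps t)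
caps-suc t rewrite uT-suc t | uv-suc t 1 | uv-suc t 4 = refl

spokes-suc : ∀ t → spokes (suc t) ≡ (u′ (suc t) , 1) ∷ (u′ (suc t) , 3) ∷ shift (spokes t)
spokes-suc t = begin
  map (u′ (suc t) ,_) (concatMap evens (upTo (2 + t)))
    ≡⟨ cong (map (u′ (suc t) ,_)) (unroll (4 +_) evens evens-suc (suc t)) ⟩
  (u′ (suc t) , 1) ∷ (u′ (suc t) , 3) ∷ map (u′ (suc t) ,_) (map (4 +_) vs)
    ≡⟨ cong (λ h → (u′ (suc t) , 1) ∷ (u′ (suc t) , 3) ∷ map (h ,_) (map (4 +_) vs))
            (cong suc (uT-suc t)) ⟩
  (u′ (suc t) , 1) ∷ (u′ (suc t) , 3) ∷ map (4 + u′ t ,_) (map (4 +_) vs)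
    ≡⟨ cong (λ es → (u′ (suc t) , 1) ∷ (u′ (suc t) , 3) ∷ es) (commute vs) ⟩
  (u′ (suc t) , 1) ∷ (u′ (suc t) , 3) ∷ shift (map (u′ t ,_) vs) ∎
  where
  open ≡-Reasoning
  vs = concatMap evens (upTo (suc t))
  commute : ∀ vs → map (4 + u′ t ,_) (map (4 +_) vs) ≡ shift (map (u′ t ,_) vs)
  commute []       = refl
  commute (v ∷ vs) = cong (_ ∷_) (commute vs)

hub-u′ : ∀ t → u′ t ≡ hub (suc t)
hub-u′ zero    = refl
hub-u′ (suc t) = trans (cong suc (uT-suc t)) (cong (4 +_) (hub-u′ t))

size-V : ∀ t → V (G't t) ≡ size (suc t)
size-V zero    = refl
size-V (suc t) = trans (cong (suc ∘ suc) (uT-suc t)) (cong (4 +_) (size-V t))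

≈-reflexive : ∀ {es fs} → es ≡ fs → es ≈ fs
≈-reflexive refl = ≈-refl

shift-≈ : ∀ {es fs} → es ≈ fs → shift es ≈ shift fs
shift-≈ done         = done
shift-≈ (keep e p)   = keep _ (shift-≈ p)
shift-≈ (flip a b p) = flip _ _ (shift-≈ p)
shift-≈ (swap e f p) = swap _ _ (shift-≈ p)
shift-≈ (p then q)   = shift-≈ p then shift-≈ q

interleave : ∀ (p A r B C u q D : Edges) →
  (p ++ A) ++ (r ++ B) ++ C ++ u ++ q ++ D ↭ p ++ q ++ r ++ (A ++ B ++ C ++ u ++ D)
interleave = solve 8 (λ p A r B C u q D → (p ⊕ A) ⊕ (r ⊕ B) ⊕ C ⊕ u ⊕ q ⊕ D ⊜
  p ⊕ q ⊕ r ⊕ (A ⊕ B ⊕ C ⊕ u ⊕ D)) ↭-refl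

pull-out : ∀ (A B C s u D : Edges) → (A ++ B ++ C) ++ s ++ u ++ D ↭ s ++ (A ++ B ++ C ++ u ++ D)
pull-out = solve 6 (λ A B C s u D → (A ⊕ B ⊕ C) ⊕ s ⊕ u ⊕ D ⊜ s ⊕ (A ⊕ B ⊕ C ⊕ u ⊕ D)) ↭-refl

core-zero : core 0 ≈ ladder 1
core-zero = keep _ (keep _ (keep _ (flip 4 0 (flip 4 3 ≈-refl) then
  ↭⇒≈ (++-comm ((0 , 4) ∷ (3 , 4) ∷ (5 , 4) ∷ []) ((5 , 1) ∷ (5 , 3) ∷ [])))))

core-suc : ∀ t → core (suc t) ≡ (path 0 ++ shift (concatMap path (upTo (suc t)))) ++
  (rails 0 ++ shift (concatMap rails (upTo t))) ++ shift (caps t) ++ ((4 + u′ t , 4 + uT t) ∷ []) ++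
  ((hub (2 + t) , 1) ∷ (hub (2 + t) , 3) ∷ []) ++ shift (spokes t)
core-suc t = cong₂ _++_ (unroll _ path path-suc (suc t)) (cong₂ _++_ (unroll _ rails rails-suc t)
    (cong₂ _++_ (caps-suc t) (cong₂ _∷_ (cong₂ _,_ (cong suc (uT-suc t)) (uT-suc t))
      (trans (spokes-suc t) (cong (λ h → (h , 1) ∷ (h , 3) ∷ shift (spokes t)) (hub-u′ (suc t)))))))

shift-core : ∀ t → shift (core t) ≡
    shift (concatMap path (upTo (suc t))) ++ shift (concatMap rails (upTo t)) ++
    shift (caps t) ++ (4 + u′ t , 4 + uT t) ∷ shift (spokes t)
shift-core t = trans (map-++ _ (concatMap path (upTo (suc t))) _)
    (cong (shift (concatMap path (upTo (suc t))) ++_) (map-++ _ (concatMap rails (upTo t)) _))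

core-≈ : ∀ t → core t ≈ ladder (suc t)
core-≈ zero    = core-zero
core-≈ (suc t) =
  ≈-reflexive (core-suc t) then
  ↭⇒≈ (interleave (path 0) (shift (concatMap path (upTo (suc t)))) (rails 0)
    (shift (concatMap rails (upTo t))) (shift (caps t)) ((4 + u′ t , 4 + uT t) ∷ [])
    ((hub (2 + t) , 1) ∷ (hub (2 + t) , 3) ∷ []) (shift (spokes t))) then
  ≈-++ˡ (path 0 ++ (hub (2 + t) , 1) ∷ (hub (2 + t) , 3) ∷ rails 0)
    (≈-reflexive (sym (shift-core t)) then shift-≈ (core-≈ t))

G't-≈ : ∀ t → E (G't t) ≈ capped (suc t)
G't-≈ t =
  ↭⇒≈ (pull-out (concatMap path (upTo (suc t))) (concatMap rails (upTo t)) (caps t)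
    ((u′ t , 0) ∷ (u′ t , 2) ∷ []) ((u′ t , uT t) ∷ []) (spokes t)) then
  ≈-reflexive (cong (λ h → (h , 0) ∷ (h , 2) ∷ core t) (hub-u′ t)) then keep _ (keep _ (core-≈ t))

-- The vertices that receive a triangle

mult-up : ∀ w vs → mult (4 + w) (map (4 +_) vs) ≡ mult w vs
mult-up w []       = refl
mult-up w (v ∷ vs) = cong (𝟙 (v ≡ᵇ w) +_) (mult-up w vs)

mult-low : ∀ {k} → Low k → ∀ vs → mult k (map (4 +_) vs) ≡ 0
mult-low low []       = refl
mult-low low (v ∷ vs) = cong₂ _+_ (cong 𝟙 (low v)) (mult-low low vs)

-- `Z-suc` compares multiplicities and not lists because S names u before the vertices of the paths,
-- so the vertices 1 and 3 do not come first there.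
module Selection (f₂ f₄ fᵤ : Bool) (Z : ℕ → List ℕ)
  (Z-zero : ∀ w → mult w (Z 0) ≡ 𝟙 (flags f₂ f₄ fᵤ 0 w))
  (Z-suc : ∀ t w → mult w (Z (suc t)) ≡ mult w (1 ∷ 3 ∷ map (4 +_) (Z t))) where

  mult-flags : ∀ t w → mult w (Z t) ≡ 𝟙 (flags f₂ f₄ fᵤ t w)
  mult-flags zero    w = Z-zero w
  mult-flags (suc t) w = trans (Z-suc t w) (rung w)
    where
    rung : ∀ w → mult w (1 ∷ 3 ∷ map (4 +_) (Z t)) ≡ 𝟙 (flags f₂ f₄ fᵤ (suc t) w)
    rung 0 = mult-low (λ _ → refl) (Z t)
    rung 1 = cong suc (mult-low (λ _ → refl) (Z t))
    rung 2 = mult-low (λ _ → refl) (Z t)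
    rung 3 = cong suc (mult-low (λ _ → refl) (Z t))
    rung (suc (suc (suc (suc w)))) = trans (mult-up w (Z t)) (mult-flags t w)

  mult-topFlags : ∀ t w → mult w (0 ∷ 2 ∷ Z t) ≡ 𝟙 (topFlags f₂ f₄ fᵤ t w)
  mult-topFlags t 0 = cong suc (trans (mult-flags t 0) (off t))
    where off : ∀ t → 𝟙 (flags f₂ f₄ fᵤ t 0) ≡ 0
          off zero    = refl
          off (suc t) = refl
  mult-topFlags t 1 = mult-flags t 1
  mult-topFlags t 2 = cong suc (trans (mult-flags t 2) (off t))
    where off : ∀ t → 𝟙 (flags f₂ f₄ fᵤ t 2) ≡ 0
          off zero    = refl
          off (suc t) = refl
  mult-topFlags t (suc (suc (suc w))) = mult-flags t (3 + w)

flags-mono : ∀ f₂ f₄ fᵤ m w → flags f₂ f₄ fᵤ m w ≡ true → flags true true true m w ≡ true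
flags-mono f₂ f₄ fᵤ zero 1 _ = refl
flags-mono f₂ f₄ fᵤ zero 3 _ = refl
flags-mono f₂ f₄ fᵤ zero 4 _ = refl
flags-mono f₂ f₄ fᵤ (suc m) 1 _ = refl
flags-mono f₂ f₄ fᵤ (suc m) 3 _ = refl
flags-mono f₂ f₄ fᵤ (suc m) (suc (suc (suc (suc w)))) on = flags-mono f₂ f₄ fᵤ m w on
flags-mono f₂ f₄ fᵤ zero 0 ()
flags-mono f₂ f₄ fᵤ zero 2 ()
flags-mono f₂ f₄ fᵤ zero (suc (suc (suc (suc (suc w))))) ()
flags-mono f₂ f₄ fᵤ (suc m) 0 ()
flags-mono f₂ f₄ fᵤ (suc m) 2 ()

topFlags-mono : ∀ f₂ f₄ fᵤ m w → topFlags f₂ f₄ fᵤ m w ≡ true → topFlags true true true m w ≡ true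
topFlags-mono f₂ f₄ fᵤ m 0 _ = refl
topFlags-mono f₂ f₄ fᵤ m 1 on = flags-mono f₂ f₄ fᵤ m 1 on
topFlags-mono f₂ f₄ fᵤ m 2 _ = refl
topFlags-mono f₂ f₄ fᵤ m (suc (suc (suc w))) on = flags-mono f₂ f₄ fᵤ m (3 + w) on

-- Numbers of vertices, edges and perfect matchings

Goal : ℕ → ℕ → Graph → Set
Goal t i G = (V G ≡ i + 8 * suc t) × WellFormed G × Extremal G ×
  (8 * numPM G ≡ 5 * (i + 8 * suc t) + 8 ∸ i)

length-ladder : ∀ m → length (ladder m) ≡ 7 * m + 1
length-ladder zero    = refl
length-ladder (suc m) = trans (cong (7 +_) (trans (length-map _ (ladder m)) (length-ladder m))) (lemma m)
  where
  lemma : ∀ m → 7 + (7 * m + 1) ≡ 7 * suc m + 1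
  lemma = solve-∀

size-formula : ∀ m → size m ≡ 4 * m + 2
size-formula zero    = refl
size-formula (suc m) = trans (cong (4 +_) (size-formula m)) (cong (_+ 2) (sym (*-suc 4 m)))

-- Here t is `suc m`, and `k` counts the selected vertices among u and the second and fourth vertex
-- of the last path. So i is 2 + 2k, and there are 2 + 2t + k triangles.
goal : ∀ k m G → V G ≡ 2 * (2 + 2 * suc m + k) + (4 * (2 + m) + 2) →
  length (E G) ≡ 3 * (2 + 2 * suc m + k) + (2 + (7 * (2 + m) + 1)) →
  IsBrick (V G) (E G) → numPM G ≡ 12 + k + 5 * m → Goal (suc m) (2 + 2 * k) G
goal k m G order edges brick number =
  order′ , IsBrick.wellFormed brick ,
  (IsBrick⇒Brick (≤-trans (s≤s (s≤s z≤n)) (≤-reflexive (sym order′))) brick ,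
   trans (cong₂ _+_ number order′) (trans (sym (count-lemma k m)) (cong (_+ 1) (sym edges)))) ,
  trans (cong (8 *_) number)
    -- The minuend is rewritten as i plus a multiple of 8, so the truncated subtraction is exact.
    (sym (trans (cong (_∸ (2 + 2 * k)) (number-lemma k m)) (m+n∸m≡n (2 + 2 * k) _)))
  where
  order-lemma : ∀ k m → 2 * (2 + 2 * suc m + k) + (4 * (2 + m) + 2) ≡ 2 + 2 * k + 8 * (2 + m)
  order-lemma = solve-∀
  count-lemma : ∀ k m → 3 * (2 + 2 * suc m + k) + (2 + (7 * (2 + m) + 1)) + 1 ≡
    12 + k + 5 * m + (2 + 2 * k + 8 * (2 + m))
  count-lemma = solve-∀
  number-lemma : ∀ k m → 5 * (2 + 2 * k + 8 * (2 + m)) + 8 ≡ (2 + 2 * k) + 8 * (12 + k + 5 * m)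
  number-lemma = solve-∀
  order′ : V G ≡ 2 + 2 * k + 8 * (2 + m)
  order′ = trans order (order-lemma k m)

inflated-goal : ∀ m f₂ f₄ fᵤ vs n es → let k = 𝟙 f₂ + 𝟙 f₄ + 𝟙 fᵤ in
  n ≡ size (2 + m) → es ≈ capped (2 + m) →
  (∀ w → mult w vs ≡ 𝟙 (topFlags f₂ f₄ fᵤ (suc m) w)) → length vs ≡ 2 + 2 * suc m + k →
  Goal (suc m) (2 + 2 * k) (triInsAll vs (graph n es))
inflated-goal m f₂ f₄ fᵤ vs n es refl p mults len = goal k m (triInsAll vs (graph n es))
  (trans order (cong₂ (λ l s → 2 * l + s) len (size-formula (2 + m))))
  (trans edges (cong₂ (λ l e → 3 * l + e) len (trans (length-≈ p) (cong (2 +_) (length-ladder (2 + m))))))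
  brick
  (trans counted (trans (total-≈ (size (2 + m)) (Count.topDemand f₂ f₄ fᵤ (suc m)) p)
                        (Count.total-ladder f₂ f₄ fᵤ m)))
  where
  k = 𝟙 f₂ + 𝟙 f₄ + 𝟙 fᵤ
  open Inflation (inflateAll vs (IsBrick-≈ (≈-sym p) (capped-brick (suc m))) mults λ w on →
    Inflatable-≈ (≈-sym p) (capped-inflatable (suc m) w (topFlags-mono f₂ f₄ fᵤ (suc m) w on)))

-- The four selections

Q : ℕ → List ℕ
Q t = concatMap evens (upTo t)

Q-suc : ∀ t → Q (suc t) ≡ 1 ∷ 3 ∷ map (4 +_) (Q t)
Q-suc t = unroll (4 +_) evens evens-suc t

length-Q : ∀ t → length (Q t) ≡ 2 * t
length-Q zero    = refl
length-Q (suc t) = trans (cong length (Q-suc t)) (trans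
  (cong (2 +_) (trans (length-map (4 +_) (Q t)) (length-Q t))) (sym (*-suc 2 t)))

Q-then-suc : ∀ (T : ℕ → List ℕ) → (∀ t → T (suc t) ≡ map (4 +_) (T t)) → ∀ t w →
  mult w (Q (suc t) ++ T (suc t)) ≡ mult w (1 ∷ 3 ∷ map (4 +_) (Q t ++ T t))
Q-then-suc T T-suc t w = cong (mult w) (begin
  Q (suc t) ++ T (suc t)                       ≡⟨ cong₂ _++_ (Q-suc t) (T-suc t) ⟩
  1 ∷ 3 ∷ map (4 +_) (Q t) ++ map (4 +_) (T t) ≡⟨ cong (λ r → 1 ∷ 3 ∷ r) (map-++ (4 +_) (Q t) (T t)) ⟨
  1 ∷ 3 ∷ map (4 +_) (Q t ++ T t)              ∎)
  where open ≡-Reasoning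

Q-uT-suc : ∀ t w → mult w (uT (suc t) ∷ Q (2 + t)) ≡ mult w (1 ∷ 3 ∷ map (4 +_) (uT t ∷ Q (suc t)))
Q-uT-suc t w = begin
  𝟙 (uT (suc t) ≡ᵇ w) + mult w (Q (2 + t))
    ≡⟨ cong₂ (λ u vs → 𝟙 (u ≡ᵇ w) + mult w vs) (uT-suc t) (Q-suc (suc t)) ⟩
  𝟙 (4 + uT t ≡ᵇ w) + (𝟙 (1 ≡ᵇ w) + (𝟙 (3 ≡ᵇ w) + mult w (map (4 +_) (Q (suc t)))))
    ≡⟨ rotate (𝟙 (4 + uT t ≡ᵇ w)) (𝟙 (1 ≡ᵇ w)) (𝟙 (3 ≡ᵇ w)) _ ⟩
  𝟙 (1 ≡ᵇ w) + (𝟙 (3 ≡ᵇ w) + (𝟙 (4 + uT t ≡ᵇ w) + mult w (map (4 +_) (Q (suc t))))) ∎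
  where
  open ≡-Reasoning
  rotate : ∀ a b c d → a + (b + (c + d)) ≡ b + (c + (a + d))
  rotate = solve-∀

Q-step : ∀ t w → mult w (Q (suc t)) ≡ mult w (1 ∷ 3 ∷ map (4 +_) (Q t))
Q-step t w = cong (mult w) (Q-suc t)

selected-end₁ : ∀ w → mult w (Q 0) ≡ 𝟙 (flags false false false 0 w)
selected-end₁ 0 = refl
selected-end₁ 1 = refl
selected-end₁ 2 = refl
selected-end₁ 3 = refl
selected-end₁ 4 = refl
selected-end₁ (suc (suc (suc (suc (suc w))))) = refl

module Select₁ = Selection false false false Q
  selected-end₁
  Q-step

selected-end₂ : ∀ w → mult w (Q 0 ++ uv 0 2 ∷ []) ≡ 𝟙 (flags true false false 0 w)
selected-end₂ 0 = refl
selected-end₂ 1 = refl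
selected-end₂ 2 = refl
selected-end₂ 3 = refl
selected-end₂ 4 = refl
selected-end₂ (suc (suc (suc (suc (suc w))))) = refl

Q₂ : ℕ → List ℕ
Q₂ t = Q t ++ uv t 2 ∷ []

Q₂-step : ∀ t w → mult w (Q₂ (suc t)) ≡ mult w (1 ∷ 3 ∷ map (4 +_) (Q₂ t))
Q₂-step = Q-then-suc (λ t → uv t 2 ∷ []) λ t → cong (_∷ []) (uv-suc t 2)

module Select₂ = Selection true false false Q₂
  selected-end₂
  Q₂-step

selected-end₃ : ∀ w → mult w (Q 0 ++ evens 0) ≡ 𝟙 (flags true true false 0 w)
selected-end₃ 0 = refl
selected-end₃ 1 = refl
selected-end₃ 2 = refl
selected-end₃ 3 = refl
selected-end₃ 4 = refl
selected-end₃ (suc (suc (suc (suc (suc w))))) = refl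

Q₃ : ℕ → List ℕ
Q₃ t = Q t ++ evens t

module Select₃ = Selection true true false Q₃
  selected-end₃
  (Q-then-suc evens evens-suc)

selected-end₄ : ∀ w → mult w (uT 0 ∷ Q 1) ≡ 𝟙 (flags true true true 0 w)
selected-end₄ 0 = refl
selected-end₄ 1 = refl
selected-end₄ 2 = refl
selected-end₄ 3 = refl
selected-end₄ 4 = refl
selected-end₄ (suc (suc (suc (suc (suc w))))) = refl

Q₄ : ℕ → List ℕ
Q₄ t = uT t ∷ Q (suc t)

module Select₄ = Selection true true true Q₄
  selected-end₄
  Q-uT-suc

length-Q-then : ∀ t T → length (Q t ++ T) ≡ 2 * t + length T
length-Q-then t T = trans (length-++ (Q t)) (cong (_+ length T) (length-Q t))

G''n-goal : ∀ m i vs f₂ f₄ fᵤ → let k = 𝟙 f₂ + 𝟙 f₄ + 𝟙 fᵤ in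
  Ssel (suc m) i ≡ vs → i ≡ 2 + 2 * k →
  (∀ w → mult w vs ≡ 𝟙 (topFlags f₂ f₄ fᵤ (suc m) w)) → length vs ≡ 2 + 2 * suc m + k →
  Goal (suc m) i (G''n (suc m) i)
G''n-goal m i vs f₂ f₄ fᵤ selected i≡ mults len = subst₂ (λ i G → Goal (suc m) i G)
  (sym i≡) (cong (λ vs → triInsAll vs (G't (suc m))) (sym selected))
  (inflated-goal m f₂ f₄ fᵤ vs (V (G't (suc m))) (E (G't (suc m)))
    (size-V (suc m)) (G't-≈ (suc m)) mults len)

theorem3p1 : (t i : ℕ) → 1 ≤ t → (i ≡ 2 ⊎ i ≡ 4 ⊎ i ≡ 6 ⊎ i ≡ 8) →
    (V (G''n t i) ≡ i + 8 * suc t) × WellFormed (G''n t i) × Extremal (G''n t i) ×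
    (8 * numPM (G''n t i) ≡ 5 * (i + 8 * suc t) + 8 ∸ i)
theorem3p1 (suc m) _ _ (inj₁ refl) =
  G''n-goal m 2 (S₁ (suc m)) false false false refl refl (Select₁.mult-topFlags (suc m))
    (cong (2 +_) (trans (length-Q (suc m)) (sym (+-identityʳ (2 * suc m)))))
theorem3p1 (suc m) _ _ (inj₂ (inj₁ refl)) =
  G''n-goal m 4 (S₂ (suc m)) true false false refl refl (Select₂.mult-topFlags (suc m))
    (cong (2 +_) (length-Q-then (suc m) (uv (suc m) 2 ∷ [])))
theorem3p1 (suc m) _ _ (inj₂ (inj₂ (inj₁ refl))) =
  G''n-goal m 6 (S₃ (suc m)) true true false refl refl (Select₃.mult-topFlags (suc m))
    (cong (2 +_) (length-Q-then (suc m) (evens (suc m))))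
theorem3p1 (suc m) _ _ (inj₂ (inj₂ (inj₂ refl))) =
  G''n-goal m 8 (S₄ (suc m)) true true true refl refl (Select₄.mult-topFlags (suc m))
    (cong (2 +_) (trans (cong suc (length-Q (2 + m))) (lemma (suc m))))
  where
  lemma : ∀ t → suc (2 * suc t) ≡ 2 * t + 3
  lemma = solve-∀
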